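{- If $(\mathcal{K},\preccurlyeq)$ is a FUR-class, then $(\mathcal{K}^{eq},\preccurlyeq^{eq})$ is also a FUR-class.
   Context: SETTING. $(\mathcal{K},\preccurlyeq)$ is an abstract elementary class (AEC) with monster model $\mathbb{M}$: a $\delta$-model homogeneous and $\delta$-universal member of $\mathcal{K}$, $\delta$ a large cardinal. "Model" means $\mathcal{A}\in\mathcal{K}$, $\mathcal{A}\preccurlyeq\mathbb{M}$; models and parameter sets have size $<\delta$. $a\in X$ may be a finite tuple; juxtaposition denotes union or concatenation. TYPES. $\mathrm{Aut}(\mathbb{M}/A)$ is the group of automorphisms of $\mathbb{M}$ fixing $A$ pointwise. $a,b$ have the same Galois type over $A$, $t^g(a/A)=t^g(b/A)$, if $f(a)=b$ for some $f\in\mathrm{Aut}(\mathbb{M}/A)$; they have the same weak type, $t(a/A)=t(b/A)$, if $t^g(a/B)=t^g(b/B)$ for all finite $B\subseteq A$ (types of models are types of enumerations). For $A\subseteq B$ with $A$ finite, $t(a/B)$ splits over $A$ if there are $b,c\in B$ with $t(b/A)=t(c/A)$ but $t(ab/A)\ne t(ac/A)$. $a\downarrow^{ns}_B C$ means that $t(a/B\cup C)$ does not split over some finite $A\subseteq B$; $A\downarrow^{ns}_B C$ means $a\downarrow^{ns}_BC$ for each $a\in A$. FUR-CLASS. $\mathcal{K}$ is a FUR-class if it has AP and JEP, $LS(\mathcal{K})=\omega$, has arbitrarily large structures, contains no finite models, and satisfies: (AI) Every countable model $\mathcal{A}$ is s-saturated: for any $b\in\mathbb{M}$ and finite $A\subseteq\mathcal{A}$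 there is $a\in\mathcal{A}$ with $t(a/A)=t(b/A)$. (AII) For all $a$ and countable $\mathcal{A}$ there is an s-primary model $\mathcal{B}=\mathcal{A}a\cup\bigcup_{i<\omega}a_i$ over $\mathcal{A}a$. [s-primary: the $a_i$ are singletons and for all $n<\omega$ there is a finite $A_n\subset\mathcal{A}$ such that for all $(a',a_0',\dots,a_n')$ with $t(a'/\mathcal{A})=t(a/\mathcal{A})$: $t(a',a_0',\dots,a_n'/A_n)=t(a,a_0,\dots,a_n/A_n)$ implies $t(a',a_0',\dots,a_n'/\mathcal{A})=t(a,a_0,\dots,a_n/\mathcal{A})$.] (AIII) Let $\mathcal{A},\mathcal{B},\mathcal{C}$ be models with $\mathcal{A}\downarrow^{ns}_{\mathcal{B}}\mathcal{C}$ and $\mathcal{B}=\mathcal{A}\cap\mathcal{C}$. Then there is a unique (not only up to isomorphism) s-prime model $\mathcal{D}$ over $\mathcal{A}\cup\mathcal{C}$; furthermore, if $\mathcal{C}\subseteq\mathcal{C}'$ and $\mathcal{A}\downarrow^{ns}_{\mathcal{B}}\mathcal{C}'$, then $\mathcal{D}\downarrow^{ns}_{\mathcal{C}}\mathcal{C}'$. [For models $\mathcal{A}_i$, $i<\alpha$, and $A=\bigcup_{i<\alpha}\mathcal{A}_i$, a map $f:A\to\mathbb{M}$ is weakly elementary w.r.t. $(\mathcal{A}_i)_{i<\alpha}$ if $t(a/\emptyset)=t(f(a)/\emptyset)$ for all $a\in A$ and $f(\mathcal{A}_i)\preccurlyeq\mathbb{M}$ for all $i$. A model $\mathcal{D}$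 is s-prime over $A$ if for every model $\mathcal{B}$ and every $f:A\to\mathcal{B}$ weakly elementary w.r.t. $(\mathcal{A}_i)_{i<\alpha}$ there is an elementary embedding $g:\mathcal{D}\to\mathcal{B}$ with $f\subseteq g$.] (AIV) For each $a\in\mathbb{M}$ there is $n<\omega$ such that for every countable model $\mathcal{A}$ and finite $A\subset\mathcal{A}$, player II has a winning strategy in $GI(a,A,\mathcal{A})$ in $n$ moves. [$GI(a,A,\mathcal{A})$: start with $a_0=a$, $A_0=A$. At move $n$, player I chooses $a_{n+1}\in\mathbb{M}$ and a finite $A_{n+1}'\subseteq\mathcal{A}$ with $t(a_{n+1}/A_n)=t(a_n/A_n)$, $A_n\subseteq A'_{n+1}$ and $t(a_{n+1}/A'_{n+1})\ne t(a_n/A'_{n+1})$; then player II chooses a finite $A_{n+1}\subseteq\mathcal{A}$ with $A'_{n+1}\subseteq A_{n+1}$. Player II wins if player I can no longer move.] (AV) If $\mathcal{A}\subseteq\mathcal{B}$ are countable models, $a\in\mathbb{M}$ and $\mathcal{B}\downarrow^{ns}_{\mathcal{A}}a$, then $a\downarrow^{ns}_{\mathcal{A}}\mathcal{B}$. (AVI) For all models $\mathcal{A},\mathcal{B},\mathcal{D}$ with $\mathcal{A}\subseteq\mathcal{B}\cap\mathcal{D}$ there is a model $\mathcal{C}$ with $t(\mathcal{C}/\mathcal{A})=t(\mathcal{B}/\mathcal{A})$ and $\mathcal{C}\downarrow^{ns}_{\mathcal{A}}\mathcal{D}$. THE CLASS $\mathcal{K}^{eq}$. Let $\mathcal{E}$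 be a countable collection of $\emptyset$-invariant equivalence relations $E\subseteq\mathbb{M}^n\times\mathbb{M}^n$ (for various $n$), i.e. for each $E\in\mathcal{E}$ there is a countable collection $G_E$ of Galois types such that $(a,b)\in E$ iff $t^g(ab/\emptyset)\in G_E$; such an $E$ defines an equivalence relation on every model in $\mathcal{K}$. The identity relation $=$ is assumed to be in $\mathcal{E}$. For $\mathcal{A}\in\mathcal{K}$ let $\mathcal{A}^{eq}=\{a/E: a\in\mathcal{A},\ E\in\mathcal{E}\}$, identifying each $a$ with $a/{=}$. For each $E\in\mathcal{E}$ add to the language a predicate $P_E$ interpreted as $\{a/E:a\in\mathcal{A}\}$ and a function $F_E:\mathcal{A}^n\to\mathcal{A}^{eq}$ (suitable $n$) with $F_E(a)=a/E$; all the structure of $\mathcal{A}$ is retained on $P_=$. Then $\mathcal{K}^{eq}=\{\mathcal{A}^{eq}:\mathcal{A}\in\mathcal{K}\}$, and $\mathcal{A}^{eq}\preccurlyeq^{eq}\mathcal{B}^{eq}$ iff $\mathcal{A}^{eq}$ is a submodel of $\mathcal{B}^{eq}$ and $\mathcal{A}\preccurlyeq\mathcal{B}$. The monster model of $\mathcal{K}^{eq}$ is $\mathbb{M}^{eq}$. -}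

module Defs where

open import Level using (Level; Setω; _⊔_) renaming (suc to lsuc)
open import Axiom.ExcludedMiddle using (ExcludedMiddle)
open import Data.Bool.Base using (Bool; if_then_else_)
open import Data.Fin.Base using (Fin; toℕ; zero; suc)
open import Data.Maybe.Base as Maybe using (Maybe; just; nothing; maybe′)
open import Data.Maybe.Relation.Binary.Pointwise using (Pointwise; just; nothing)
open import Data.Nat.Base using (ℕ; zero; suc; _+_)
open import Data.Product.Base using (Σ; Σ-syntax; ∃; ∃-syntax; _×_; _,_; proj₁; proj₂)
open import Data.Sum.Base using (_⊎_; inj₁; inj₂)
open import Data.Sum.Relation.Binary.Pointwise using (_⊎ₛ_)
open import Data.Vec.Functional using (Vector; []; _∷_; _++_; tail)
open import Function.Base using (_∘_; id)
open import Function.Bundles using (Func; Injection; _⇔_; mk⇔; module Equivalence)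
open import Induction.WellFounded using (WellFounded)
open import Relation.Binary.Bundles using (Setoid)
open import Relation.Binary.Core using (Rel; REL)
open import Relation.Binary.Structures using (IsEquivalence; IsStrictTotalOrder)
import Relation.Binary.Construct.On as On
open import Relation.Binary.Construct.Closure.Equivalence using (EqClosure)
import Relation.Binary.Construct.Closure.Equivalence as EqClosure
open import Relation.Binary.PropositionalEquality.Core as ≡ using (_≡_)
open import Relation.Binary.PropositionalEquality.Properties using () renaming (setoid to ≡-setoid)
open import Relation.Nullary.Negation.Core using (¬_)
open import Relation.Unary using (Pred; _∈_; _⊆_; _≐_; _∩_; _∪_; ∅)

private
  variable
    s c r k p p′ i ℓ ℓ₁ ℓ₂ : Level

-- The ambient metatheory is ZFC; this record supplies excluded middle and
-- the extensional (setoid) form of the axiom of choice.  The type-theoretic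
-- form, in which f need not respect equality, is provable.
record ZermeloLogic : Setω where
  field
    excludedMiddle : ∀ {ℓ} → ExcludedMiddle ℓ
    choice : ∀ {a b ℓa ℓb ℓ} (A : Setoid a ℓa) (B : Setoid b ℓb) →
      let module A = Setoid A; module B = Setoid B in
      (R : REL A.Carrier B.Carrier ℓ) →
      (∀ {x x′ y y′} → x A.≈ x′ → y B.≈ y′ → R x y → R x′ y′) →
      (∀ x → ∃[ y ] R x y) →
      Σ[ f ∈ Func A B ] (∀ x → R x (Func.to f x))

_≲_ : Setoid p ℓ₁ → Setoid p′ ℓ₂ → Set (p ⊔ ℓ₁ ⊔ p′ ⊔ ℓ₂)
S ≲ T = Injection S T

_⋦_ : Setoid p ℓ₁ → Setoid p′ ℓ₂ → Set (p ⊔ ℓ₁ ⊔ p′ ⊔ ℓ₂)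
S ⋦ T = S ≲ T × ¬ (T ≲ S)

infix 4 _≲_ _⋦_

restrict : (S : Setoid p ℓ₁) → Pred (Setoid.Carrier S) p′ → Setoid (p ⊔ p′) ℓ₁
restrict S X = On.setoid {B = Σ (Setoid.Carrier S) X} S proj₁

record Signature (s : Level) : Set (lsuc s) where
  field
    Rel# Fun#  : Set s
    rel-arity  : Rel# → ℕ
    fun-arity  : Fun# → ℕ

-- Equality is that of a setoid, so that quotients exist.
record Structure (L : Signature s) (c r : Level) : Set (s ⊔ lsuc (c ⊔ r)) where
  open Signature L
  field
    setoid : Setoid c r
  open Setoid setoid public
  _≋_ : ∀ {n} → Vector Carrier n → Vector Carrier n → Set r
  xs ≋ ys = ∀ i → xs i ≈ ys i
  infix 4 _≋_
  field
    rel      : (R : Rel#) → Pred (Vector Carrier (rel-arity R)) r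
    rel-resp : ∀ R {xs ys} → xs ≋ ys → rel R xs → rel R ys
    fun      : (f : Fun#) → Vector Carrier (fun-arity f) → Carrier
    fun-cong : ∀ f {xs ys} → xs ≋ ys → fun f xs ≈ fun f ys

module _ {L : Signature s} where
  open Signature L

  record Embedding (A : Structure L c ℓ₁) (B : Structure L p ℓ₂)
         : Set (s ⊔ c ⊔ ℓ₁ ⊔ p ⊔ ℓ₂) where
    private
      module A = Structure A
      module B = Structure B
    field
      to        : A.Carrier → B.Carrier
      cong      : ∀ {x y} → x A.≈ y → to x B.≈ to y
      injective : ∀ {x y} → to x B.≈ to y → x A.≈ y
      rel-iff   : ∀ R xs → A.rel R xs ⇔ B.rel R (to ∘ xs)
      fun-hom   : ∀ f xs → to (A.fun f xs) B.≈ B.fun f (to ∘ xs)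

  record Isomorphism (A : Structure L c ℓ₁) (B : Structure L p ℓ₂)
         : Set (s ⊔ c ⊔ ℓ₁ ⊔ p ⊔ ℓ₂) where
    field
      embedding  : Embedding A B
    open Embedding embedding public
    field
      surjective : ∀ y → ∃[ x ] Structure._≈_ B (to x) y

  idᵉ : (A : Structure L c r) → Embedding A A
  idᵉ A = record
    { to = id ; cong = id ; injective = id
    ; rel-iff = λ _ _ → mk⇔ id id ; fun-hom = λ _ _ → Structure.refl A }

  infixr 9 _∘ᵉ_
  _∘ᵉ_ : {A : Structure L c r} {B : Structure L p ℓ₁} {C : Structure L p′ ℓ₂} →
         Embedding B C → Embedding A B → Embedding A C
  _∘ᵉ_ {C = C} g f = record
    { to        = g.to ∘ f.to
    ; cong      = g.cong ∘ f.cong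
    ; injective = f.injective ∘ g.injective
    ; rel-iff   = λ R xs → mk⇔
        (Equivalence.to (g.rel-iff R (f.to ∘ xs)) ∘ Equivalence.to (f.rel-iff R xs))
        (Equivalence.from (f.rel-iff R xs) ∘ Equivalence.from (g.rel-iff R (f.to ∘ xs)))
    ; fun-hom   = λ h xs → Structure.trans C (g.cong (f.fun-hom h xs)) (g.fun-hom h (f.to ∘ xs))
    }
    where module g = Embedding g
          module f = Embedding f

  record Substructure (A : Structure L c r) : Set (s ⊔ lsuc c ⊔ r) where
    open Structure A
    field
      mem    : Pred Carrier c
      resp   : ∀ {x y} → x ≈ y → x ∈ mem → y ∈ mem
      closed : ∀ f xs → (∀ i → xs i ∈ mem) → fun f xs ∈ mem

  open Substructure public using (mem)

  _↾_ : (A : Structure L c r) → Substructure A → Structure L c r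
  A ↾ S = record
    { setoid   = restrict A.setoid (mem S)
    ; rel      = λ R xs → A.rel R (proj₁ ∘ xs)
    ; rel-resp = λ R → A.rel-resp R
    ; fun      = λ f xs → A.fun f (proj₁ ∘ xs) ,
                          Substructure.closed S f (proj₁ ∘ xs) (proj₂ ∘ xs)
    ; fun-cong = λ f → A.fun-cong f
    }
    where module A = Structure A

  inclusion : {A : Structure L c r} (S : Substructure A) → Embedding (A ↾ S) A
  inclusion {A = A} S = record
    { to = proj₁ ; cong = id ; injective = id
    ; rel-iff = λ _ _ → mk⇔ id id ; fun-hom = λ _ _ → Structure.refl A }

  inclusion₂ : {A : Structure L c r} (S T : Substructure A) → mem S ⊆ mem T →
               Embedding (A ↾ S) (A ↾ T)
  inclusion₂ {A = A} S T S⊆T = record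
    { to = λ (x , x∈S) → x , S⊆T x∈S ; cong = id ; injective = id
    ; rel-iff = λ _ _ → mk⇔ id id ; fun-hom = λ _ _ → Structure.refl A }

-- The relation ≼ is given through embeddings: Strong f says f is a
-- 𝒦-embedding, and A ≼ B says that A is a substructure of B whose inclusion is
-- strong.  Strong is only meaningful between members of 𝕂.
record StructureClass (L : Signature s) (c r k : Level) : Set (s ⊔ lsuc (c ⊔ r ⊔ k)) where
  field
    𝕂      : Structure L c r → Set k
    Strong : {A B : Structure L c r} → Embedding A B → Set k

module _ {L : Signature s} (𝒦 : StructureClass L c r k) where
  open StructureClass 𝒦
  open Structure using (Carrier; setoid)

  -- Every subset X of a model A is contained in some A′ ≼ A with
  -- |A′| ≤ |X| + κ.
  LöwenheimSkolem : Set ℓ → Set (s ⊔ lsuc (c ⊔ r) ⊔ k ⊔ ℓ)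
  LöwenheimSkolem κ =
    ∀ A → 𝕂 A → (X : Pred (Carrier A) c) →
    Σ[ S ∈ Substructure A ]
      X ⊆ mem S × 𝕂 (A ↾ S) × Strong (inclusion S) ×
      setoid (A ↾ S) ≲ (restrict (setoid A) X ⊎ₛ ≡-setoid κ)

  record IsAEC : Set (s ⊔ lsuc (c ⊔ r) ⊔ k) where
    field
      𝕂-iso : ∀ {A B} → Isomorphism A B → 𝕂 A → 𝕂 B
      strong-iso : ∀ {A A′ B B′} → 𝕂 A → 𝕂 B →
        (i : Isomorphism A A′) (j : Isomorphism B B′) →
        (f : Embedding A B) (f′ : Embedding A′ B′) →
        (∀ x → Structure._≈_ B′ (Embedding.to f′ (Isomorphism.to i x))
                                (Isomorphism.to j (Embedding.to f x))) →
        Strong f → Strong f′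
      strong-refl : ∀ {A} → 𝕂 A → Strong (idᵉ A)
      strong-trans : ∀ {A B C} → 𝕂 A → 𝕂 B → 𝕂 C →
        (g : Embedding B C) (f : Embedding A B) →
        Strong g → Strong f → Strong (g ∘ᵉ f)
      coherence : ∀ {A B C} → 𝕂 A → 𝕂 B → 𝕂 C →
        (g : Embedding B C) (f : Embedding A B) →
        Strong g → Strong (g ∘ᵉ f) → Strong f
      -- U is the union of a ≼-increasing chain (S i) indexed by a nonempty
      -- well-order.
      chain : {I : Set c} (_<_ : Rel I c) →
        IsStrictTotalOrder _≡_ _<_ → WellFounded _<_ → I →
        (U : Structure L c r) (S : I → Substructure U) →
        (∀ x → ∃[ i ] x ∈ mem (S i)) →
        (∀ i → 𝕂 (U ↾ S i)) →
        (S-mono : ∀ {i j} → i < j → mem (S i) ⊆ mem (S j)) →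
        (∀ {i j} (i<j : i < j) → Strong (inclusion₂ (S i) (S j) (S-mono i<j))) →
        𝕂 U ×
        (∀ i → Strong (inclusion (S i))) ×
        (∀ {N} → 𝕂 N → (h : Embedding U N) →
          (∀ i → Strong (h ∘ᵉ inclusion (S i))) → Strong h)
      löwenheim-skolem : Σ[ κ ∈ Set c ] LöwenheimSkolem κ

  AmalgamationProperty : Set (s ⊔ lsuc (c ⊔ r) ⊔ k)
  AmalgamationProperty = ∀ {A B C} → 𝕂 A → 𝕂 B → 𝕂 C →
    (f : Embedding A B) (g : Embedding A C) → Strong f → Strong g →
    ∃[ D ] 𝕂 D × Σ[ h ∈ Embedding B D ] Σ[ l ∈ Embedding C D ] Strong h × Strong l ×
      (∀ x → Structure._≈_ D (Embedding.to h (Embedding.to f x))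
                             (Embedding.to l (Embedding.to g x)))

  JointEmbeddingProperty : Set (s ⊔ lsuc (c ⊔ r) ⊔ k)
  JointEmbeddingProperty = ∀ {A B} → 𝕂 A → 𝕂 B →
    ∃[ D ] 𝕂 D × Σ[ h ∈ Embedding A D ] Σ[ l ∈ Embedding B D ] Strong h × Strong l

  ArbitrarilyLarge : Set (s ⊔ lsuc (c ⊔ r) ⊔ k)
  ArbitrarilyLarge = (X : Set c) → ∃[ A ] 𝕂 A × ≡-setoid X ≲ setoid A

  NoFiniteModels : Set (s ⊔ lsuc (c ⊔ r) ⊔ k)
  NoFiniteModels = ∀ {A} → 𝕂 A → ∀ n → ¬ (setoid A ≲ ≡-setoid (Fin n))

  -- t^g(a/∅) = t^g(b/∅) for tuples from two members of the class, neither of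
  -- which need lie in a monster model.
  SameGaloisType : (A : Structure L c r) (B : Structure L c r) →
    ∀ {n} → Vector (Carrier A) n → Vector (Carrier B) n → Set (s ⊔ lsuc (c ⊔ r) ⊔ k)
  SameGaloisType A B a b =
    ∃[ C ] 𝕂 C × Σ[ f ∈ Embedding A C ] Σ[ g ∈ Embedding B C ] Strong f × Strong g ×
      Structure._≋_ C (Embedding.to f ∘ a) (Embedding.to g ∘ b)

-- The cardinal δ is |Δ|.  Of a large δ only uncountability, i.e. δ > LS(𝒦), is
-- asked.
module Monster {L : Signature s} (𝒦 : StructureClass L c r k)
               (𝕄 : Structure L c r) (Δ : Set c) where
  open StructureClass 𝒦
  open Structure 𝕄 using (Carrier; _≈_; _≋_; setoid)
  open Embedding using (to)

  Small : Structure L c r → Set (c ⊔ r)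
  Small A = Structure.setoid A ⋦ ≡-setoid Δ

  record Model : Set (s ⊔ lsuc (c ⊔ r) ⊔ k) where
    field
      sub     : Substructure 𝕄
    structure : Structure L c r
    structure = 𝕄 ↾ sub
    field
      ∈𝕂      : 𝕂 structure
      strong  : Strong (inclusion sub)
      small   : Small structure
    ∣_∣ : Pred Carrier c
    ∣_∣ = mem sub

  open Model using (structure; ∣_∣)

  Countable : Model → Set (c ⊔ r)
  Countable A = Structure.setoid (structure A) ≲ ≡-setoid ℕ

  record IsMonster : Set (s ⊔ lsuc (c ⊔ r) ⊔ k) where
    field
      𝕄∈𝕂         : 𝕂 𝕄
      uncountable : ≡-setoid ℕ ⋦ ≡-setoid Δ
      homogeneous : (A B : Model) (f : Isomorphism (structure A) (structure B)) →
        Σ[ σ ∈ Isomorphism 𝕄 𝕄 ]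
          (∀ x → Isomorphism.to σ (proj₁ x) ≈ proj₁ (Isomorphism.to f x))
      universal   : ∀ {A} → 𝕂 A → Small A → Σ[ f ∈ Embedding A 𝕄 ] Strong f

  private
    variable
      m n : ℕ
      I : Set i

  range : Vector Carrier n → Pred Carrier r
  range a x = ∃[ i ] x ≈ a i

  -- The finite subsets of A are the ranges of the tuples a with a inside A.
  _inside_ : Vector Carrier n → Pred Carrier p → Set p
  a inside A = ∀ i → a i ∈ A

  -- t^g(a/A) = t^g(b/A) and t(a/A) = t(b/A), for possibly infinite tuples.
  _≡ᵍ_over_ : (I → Carrier) → (I → Carrier) → Pred Carrier p → Set _
  _≡ᵍ_over_ a b A = Σ[ σ ∈ Isomorphism 𝕄 𝕄 ]
    (∀ x → x ∈ A → Isomorphism.to σ x ≈ x) × (∀ j → Isomorphism.to σ (a j) ≈ b j)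

  _≡ᵗ_over_ : (I → Carrier) → (I → Carrier) → Pred Carrier p → Set _
  _≡ᵗ_over_ a b A = ∀ {n} (B : Vector Carrier n) → B inside A → a ≡ᵍ b over range B

  infix 4 _≡ᵍ_over_ _≡ᵗ_over_ _inside_

  -- t(a/B) splits over range A.
  SplitsOver : Vector Carrier n → Pred Carrier p → Vector Carrier m → Set _
  SplitsOver a B A = ∃[ l ] Σ[ b ∈ Vector Carrier l ] Σ[ d ∈ Vector Carrier l ]
    b inside B × d inside B ×
    (b ≡ᵗ d over range A) × ¬ (a ++ b ≡ᵗ a ++ d over range A)

  -- a ↓ⁿˢ_B C for a tuple a, and A ↓ⁿˢ_B C for a set A.
  _↓[_]_ : Vector Carrier n → Pred Carrier p → Pred Carrier p′ → Set _
  a ↓[ B ] C = ∃[ m ] Σ[ A ∈ Vector Carrier m ] A inside B × ¬ SplitsOver a (B ∪ C) A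

  _⇓[_]_ : Pred Carrier ℓ → Pred Carrier p → Pred Carrier p′ → Set _
  A ⇓[ B ] C = ∀ {n} (a : Vector Carrier n) → a inside A → a ↓[ B ] C

  infix 4 _↓[_]_ _⇓[_]_

  -- t(C/A) = t(B/A): some enumeration of C has the type over A of an
  -- enumeration of B.
  SameTypeOfModels : Model → Model → Pred Carrier p → Set _
  SameTypeOfModels C B A =
    Σ[ e ∈ (Σ Carrier ∣ B ∣ → Carrier) ]
      ∣ C ∣ ≐ (λ y → ∃[ x ] y ≈ e x) × (e ≡ᵗ proj₁ over A)

  IsSPrimary : (A : Model) → Vector Carrier n → Model → Set _
  IsSPrimary A a B = Σ[ e ∈ (ℕ → Carrier) ]
    ∣ B ∣ ≐ ∣ A ∣ ∪ range a ∪ (λ y → ∃[ i ] y ≈ e i) ×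
    (∀ l → let eₗ : Vector Carrier (suc l)
               eₗ i = e (toℕ i) in
      ∃[ m ] Σ[ Aₗ ∈ Vector Carrier m ] Aₗ inside ∣ A ∣ ×
        (∀ (a′ : Vector Carrier _) (e′ : Vector Carrier (suc l)) →
          a′ ≡ᵗ a over ∣ A ∣ →
          a′ ++ e′ ≡ᵗ a ++ eₗ over range Aₗ →
          a′ ++ e′ ≡ᵗ a ++ eₗ over ∣ A ∣))

  ⋃ : {J : Set} → (J → Model) → Pred Carrier c
  ⋃ 𝒜 x = ∃[ j ] x ∈ ∣ 𝒜 j ∣

  -- f(𝒜 j) ≼ 𝕄 is expressed by f(𝒜 j) being the universe of a model.
  WeaklyElementary : {J : Set} (𝒜 : J → Model) → Func (restrict setoid (⋃ 𝒜)) setoid → Set _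
  WeaklyElementary 𝒜 f =
    (∀ {n} (a : Vector (Σ Carrier (⋃ 𝒜)) n) → proj₁ ∘ a ≡ᵗ Func.to f ∘ a over ∅) ×
    (∀ j → Σ[ B ∈ Model ]
      ∣ B ∣ ≐ (λ y → ∃[ x ] Σ[ x∈ ∈ x ∈ ∣ 𝒜 j ∣ ] y ≈ Func.to f (x , j , x∈)))

  IsSPrime : {J : Set} (𝒜 : J → Model) → Model → Set _
  IsSPrime 𝒜 D = Σ[ A⊆D ∈ ⋃ 𝒜 ⊆ ∣ D ∣ ]
    (∀ (B : Model) (f : Func (restrict setoid (⋃ 𝒜)) setoid) →
      WeaklyElementary 𝒜 f → (∀ x → Func.to f x ∈ ∣ B ∣) →
      Σ[ g ∈ Embedding (structure D) (structure B) ] Strong g ×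
        (∀ x (x∈A : x ∈ ⋃ 𝒜) → proj₁ (to g (x , A⊆D x∈A)) ≈ Func.to f (x , x∈A)))

  pair : Model → Model → Bool → Model
  pair A C b = if b then A else C

  -- Legal moves of player I in GI at the position (a , A).
  MoveI : Model → Vector Carrier n → Vector Carrier m →
          Vector Carrier n → ∀ {l} → Vector Carrier l → Set _
  MoveI 𝒜 a A a′ A′ =
    (a′ ≡ᵗ a over range A) × A′ inside ∣ 𝒜 ∣ × range A ⊆ range A′ ×
    ¬ (a′ ≡ᵗ a over range A′)

  -- II has a strategy from the position (a , A) after which I is stuck within
  -- the given number of moves.
  WinsII : ℕ → Model → Vector Carrier n → Vector Carrier m → Set (s ⊔ c ⊔ r)
  WinsII zero 𝒜 a A =
    ∀ {l} a′ (A′ : Vector Carrier l) → ¬ MoveI 𝒜 a A a′ A′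
  WinsII (suc q) 𝒜 a A =
    ∀ {l} a′ (A′ : Vector Carrier l) → MoveI 𝒜 a A a′ A′ →
    ∃[ l′ ] Σ[ A″ ∈ Vector Carrier l′ ]
      A″ inside ∣ 𝒜 ∣ × range A′ ⊆ range A″ × WinsII q 𝒜 a′ A″

  record IsFURClass : Set (s ⊔ lsuc (c ⊔ r) ⊔ k) where
    field
      isAEC     : IsAEC 𝒦
      isMonster : IsMonster
      ap        : AmalgamationProperty 𝒦
      jep       : JointEmbeddingProperty 𝒦
      LS≡ω      : LöwenheimSkolem 𝒦 ℕ
      large     : ArbitrarilyLarge 𝒦
      infinite  : NoFiniteModels 𝒦
      AI   : (𝒜 : Model) → Countable 𝒜 →
        ∀ {n m} (b : Vector Carrier n) (A : Vector Carrier m) → A inside ∣ 𝒜 ∣ →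
        Σ[ a ∈ Vector Carrier n ] a inside ∣ 𝒜 ∣ × (a ≡ᵗ b over range A)
      AII  : ∀ {n} (a : Vector Carrier n) (𝒜 : Model) → Countable 𝒜 →
        Σ[ ℬ ∈ Model ] IsSPrimary 𝒜 a ℬ
      AIII : (𝒜 ℬ 𝒞 : Model) → ∣ 𝒜 ∣ ⇓[ ∣ ℬ ∣ ] ∣ 𝒞 ∣ → ∣ ℬ ∣ ≐ ∣ 𝒜 ∣ ∩ ∣ 𝒞 ∣ →
        Σ[ 𝒟 ∈ Model ] IsSPrime (pair 𝒜 𝒞) 𝒟 ×
          (∀ 𝒟′ → IsSPrime (pair 𝒜 𝒞) 𝒟′ → ∣ 𝒟′ ∣ ≐ ∣ 𝒟 ∣) ×
          (∀ (𝒞′ : Model) → ∣ 𝒞 ∣ ⊆ ∣ 𝒞′ ∣ → ∣ 𝒜 ∣ ⇓[ ∣ ℬ ∣ ] ∣ 𝒞′ ∣ →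
            ∣ 𝒟 ∣ ⇓[ ∣ 𝒞 ∣ ] ∣ 𝒞′ ∣)
      AIV  : ∀ {n} (a : Vector Carrier n) → ∃[ q ]
        (∀ (𝒜 : Model) → Countable 𝒜 →
          ∀ {m} (A : Vector Carrier m) → A inside ∣ 𝒜 ∣ → WinsII q 𝒜 a A)
      AV   : (𝒜 ℬ : Model) → Countable 𝒜 → Countable ℬ → ∣ 𝒜 ∣ ⊆ ∣ ℬ ∣ →
        ∀ {n} (a : Vector Carrier n) → ∣ ℬ ∣ ⇓[ ∣ 𝒜 ∣ ] range a → a ↓[ ∣ 𝒜 ∣ ] ∣ ℬ ∣
      AVI  : (𝒜 ℬ 𝒟 : Model) → ∣ 𝒜 ∣ ⊆ ∣ ℬ ∣ ∩ ∣ 𝒟 ∣ →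
        Σ[ 𝒞 ∈ Model ] SameTypeOfModels 𝒞 ℬ ∣ 𝒜 ∣ × (∣ 𝒞 ∣ ⇓[ ∣ 𝒜 ∣ ] ∣ 𝒟 ∣)

open Monster public using (IsFURClass)

module _ {L : Signature s} (𝒦 : StructureClass L c r k)
         (𝕄 : Structure L c r) (Δ : Set c) where
  open Structure 𝕄 using (Carrier)
  open Monster 𝒦 𝕄 Δ

  -- G is a countable collection of Galois types over ∅, each type being
  -- represented by its realizations in 𝕄.
  record InvariantEquivalence : Set (s ⊔ lsuc c ⊔ r) where
    field
      arity     : ℕ
      G         : Pred (Vector Carrier (arity + arity)) c
      invariant : ∀ {u v} → u ≡ᵍ v over ∅ → u ∈ G → v ∈ G
      countable : Σ[ e ∈ (ℕ → Vector Carrier (arity + arity)) ]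
                    (∀ {u} → u ∈ G → ∃[ l ] e l ≡ᵍ u over ∅)
    E : Rel (Vector Carrier arity) c
    E a b = a ++ b ∈ G
    field
      isEquivalence : IsEquivalence E

  -- The identity relation always belongs to ℰ; Index lists the other members.
  record Equivalences : Set (s ⊔ lsuc c ⊔ r) where
    field
      Index     : Set
      countable : ≡-setoid Index ≲ ≡-setoid ℕ
      relation  : Index → InvariantEquivalence

module Eq {L : Signature s} {𝒦 : StructureClass L c r k}
          {𝕄 : Structure L c r} {Δ : Set c} (ℰ : Equivalences 𝒦 𝕄 Δ) where
  open StructureClass 𝒦
  open Signature L
  open Equivalences ℰ using (Index; relation)
  open InvariantEquivalence using (G)

  -- nothing stands for the identity relation.
  Symbol : Set
  Symbol = Maybe Index

  symbol-arity : Symbol → ℕ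
  symbol-arity nothing  = 1
  symbol-arity (just e) = InvariantEquivalence.arity (relation e)

  -- The symbols of L together with P_E and F_E for E in ℰ.
  Lᵉ : Signature s
  Lᵉ = record
    { Rel# = Rel# ⊎ Symbol
    ; Fun# = Fun# ⊎ Symbol
    ; rel-arity = λ { (inj₁ R) → rel-arity R ; (inj₂ _) → 1 }
    ; fun-arity = λ { (inj₁ f) → fun-arity f ; (inj₂ e) → symbol-arity e }
    }

  rᵉ : Level
  rᵉ = s ⊔ lsuc (c ⊔ r) ⊔ k

  module _ (A : Structure L c r) where
    open Structure A

    -- real x is x/= ; class e a is a/E.  Classes of different members of ℰ are
    -- different elements.
    data Elem : Set c where
      real  : Carrier → Elem
      class : (e : Index) → Vector Carrier (symbol-arity (just e)) → Elem

    -- (a , b) ∈ E on A, i.e. t^g(ab/∅) ∈ G_E, where A need not lie in 𝕄.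
    Related : (e : Index) → Rel (Vector Carrier (symbol-arity (just e))) rᵉ
    Related e a b = ∃[ v ] v ∈ G (relation e) × SameGaloisType 𝒦 A 𝕄 (a ++ b) v

    -- For A ∈ 𝕂, Related e is already an equivalence relation that is
    -- invariant under ≋, so a/E = b/E is then just Related e a b; closing off
    -- makes sense of A^eq for an arbitrary structure A.
    SameClass : (e : Index) → Rel (Vector Carrier (symbol-arity (just e))) rᵉ
    SameClass e = EqClosure (λ a b → a ≋ b ⊎ Related e a b)

    data _≈ᵉ_ : Rel Elem rᵉ where
      real≈  : ∀ {x y} → x ≈ y → real x ≈ᵉ real y
      class≈ : ∀ {e a b} → SameClass e a b → class e a ≈ᵉ class e b

    ≈ᵉ-refl : ∀ {u} → u ≈ᵉ u
    ≈ᵉ-refl {real _}    = real≈ refl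
    ≈ᵉ-refl {class _ _} = class≈ (EqClosure.reflexive _)

    ≈ᵉ-sym : ∀ {u v} → u ≈ᵉ v → v ≈ᵉ u
    ≈ᵉ-sym (real≈ p)  = real≈ (sym p)
    ≈ᵉ-sym (class≈ p) = class≈ (EqClosure.symmetric _ p)

    ≈ᵉ-trans : ∀ {u v w} → u ≈ᵉ v → v ≈ᵉ w → u ≈ᵉ w
    ≈ᵉ-trans (real≈ p)  (real≈ q)  = real≈ (trans p q)
    ≈ᵉ-trans (class≈ p) (class≈ q) = class≈ (EqClosure.transitive _ p q)

    setoidᵉ : Setoid c rᵉ
    setoidᵉ = record
      { Carrier = Elem ; _≈_ = _≈ᵉ_
      ; isEquivalence = record { refl = ≈ᵉ-refl ; sym = ≈ᵉ-sym ; trans = ≈ᵉ-trans } }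

    quotient : (e : Symbol) → Vector Carrier (symbol-arity e) → Elem
    quotient nothing  a = real (a zero)
    quotient (just e) a = class e a

    quotient-cong : ∀ e {a b} → a ≋ b → quotient e a ≈ᵉ quotient e b
    quotient-cong nothing  p = real≈ (p zero)
    quotient-cong (just e) p = class≈ (EqClosure.return (inj₁ p))

    reals : ∀ {n} → Vector Elem n → Maybe (Vector Carrier n)
    reals {zero}  us = just []
    reals {suc n} us with us zero
    ... | class _ _ = nothing
    ... | real x    = Maybe.map (x ∷_) (reals (tail us))

    -- Function symbols must be total: a function whose domain is the set of
    -- tuples from A takes its first argument as value elsewhere.  (A function of
    -- arity 0 has no other arguments.)
    extend : ∀ {n} → (Vector Carrier n → Elem) → Vector Elem n → Elem
    extend {zero}  h us = h []
    extend {suc n} h us = maybe′ h (us zero) (reals us)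

    reals-cong : ∀ {n} {us vs : Vector Elem n} → (∀ i → us i ≈ᵉ vs i) →
                 Pointwise _≋_ (reals us) (reals vs)
    reals-cong {zero}  p = just λ ()
    reals-cong {suc n} {us} {vs} p with us zero | vs zero | p zero
    ... | _ | _ | class≈ _ = nothing
    ... | _ | _ | real≈ q with reals (tail us) | reals (tail vs) | reals-cong (p ∘ suc)
    ...   | _ | _ | nothing = nothing
    ...   | _ | _ | just qs = just λ { zero → q ; (suc i) → qs i }

    extend-cong : ∀ {n} {h : Vector Carrier n → Elem} → (∀ {a b} → a ≋ b → h a ≈ᵉ h b) →
                  ∀ {us vs} → (∀ i → us i ≈ᵉ vs i) → extend h us ≈ᵉ extend h vs
    extend-cong {zero}  h-cong p = ≈ᵉ-refl
    extend-cong {suc n} h-cong {us} {vs} p with reals us | reals vs | reals-cong p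
    ... | _ | _ | just qs = h-cong qs
    ... | _ | _ | nothing = p zero

    relᵉ : (R : Rel# ⊎ Symbol) → Pred (Vector Elem (Signature.rel-arity Lᵉ R)) rᵉ
    relᵉ (inj₁ R) us = ∃[ xs ] (∀ i → us i ≈ᵉ real (xs i)) × rel R xs
    relᵉ (inj₂ e) us = ∃[ a ] us zero ≈ᵉ quotient e a

    funᵉ : (f : Fun# ⊎ Symbol) → Vector Elem (Signature.fun-arity Lᵉ f) → Elem
    funᵉ (inj₁ f) = extend (real ∘ fun f)
    funᵉ (inj₂ e) = extend (quotient e)

    infix 9 _^eq
    _^eq : Structure Lᵉ c rᵉ
    _^eq = record
      { setoid   = setoidᵉ
      ; rel      = relᵉ
      ; rel-resp = λ
          { (inj₁ R) p (xs , q , xs∈R) → xs , (λ i → ≈ᵉ-trans (≈ᵉ-sym (p i)) (q i)) , xs∈R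
          ; (inj₂ e) p (a , q) → a , ≈ᵉ-trans (≈ᵉ-sym (p zero)) q }
      ; fun      = funᵉ
      ; fun-cong = λ
          { (inj₁ f) → extend-cong (real≈ ∘ fun-cong f)
          ; (inj₂ e) → extend-cong (quotient-cong e) }
      }

  -- 𝒦^eq is closed under isomorphism: its members are the copies of the A^eq,
  -- and f : N → N′ is strong if it is, up to such copies, an embedding
  -- A^eq → B^eq whose restriction to A is a 𝒦-embedding A → B.
  𝒦ᵉ : StructureClass Lᵉ c rᵉ rᵉ
  𝒦ᵉ = record
    { 𝕂      = λ N → ∃[ A ] 𝕂 A × Isomorphism (A ^eq) N
    ; Strong = λ {N} {N′} f → (∃[ A ] ∃[ B ] 𝕂 A × 𝕂 B ×
        Σ[ i ∈ Isomorphism (A ^eq) N ] Σ[ j ∈ Isomorphism (B ^eq) N′ ]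
        Σ[ g ∈ Embedding A B ] Strong g ×
        (∀ x → Structure._≈_ N′ (Embedding.to f (Isomorphism.to i (real x)))
                                (Isomorphism.to j (real (Embedding.to g x)))))
    }

  𝕄ᵉ : Structure Lᵉ c rᵉ
  𝕄ᵉ = 𝕄 ^eq

{-# OPTIONS --safe #-}
module Submission where

-- An element of A^eq is definable over finitely many elements of A, so every question about 𝒦^eq is
-- reduced to real elements.  By amalgamation a 𝒦-embedding preserves and reflects the relations
-- Related e, hence it lifts to the eq-structures; strong maps and automorphisms of eq-structures are
-- exactly the lifted ones, and the models inside 𝕄^eq are the sets of elements over a model inside 𝕄.
-- The cardinality requirements reduce to |A^eq| = |A|, which needs κ² = κ for infinite κ.
--
-- Of the axioms on types, AII is the one where coordinates must be chosen with care: among the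
-- conjugates over a of a tuple of coordinates of a, a play of the game of AIV that cannot be continued
-- yields an x whose type over 𝒜 is determined by a and finitely much of 𝒜, and then an s-primary model
-- over 𝒜x gives one over 𝒜a.  For AIII, AV and AVI it is used that nonsplitting over
-- a model can be tested on real tuples, by s-saturation.

open import Defs
open import Level using (Level; Lift; lift; lower; _⊔_) renaming (suc to lsuc; zero to lzero)
open import Data.Bool.Base using (true; false)
open import Data.Empty using (⊥; ⊥-elim)
open import Data.Fin.Base using (Fin; zero; suc; toℕ; fromℕ<; splitAt; _↑ˡ_; _↑ʳ_)
import Data.Fin.Properties as Finₚ
open import Data.List.Base as List using (List)
open import Data.Maybe.Base as Maybe using (just; nothing)
open import Data.Maybe.Relation.Binary.Pointwise using (Pointwise; just; nothing)
open import Data.Nat.Base using (ℕ; zero; suc; _+_; _*_; _≤_; _<_; s≤s; _≤′_; ≤′-refl; ≤′-step)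
  renaming (_⊔_ to _⊔ℕ_)
import Data.Nat.Properties as ℕₚ
open import Data.Product.Base using (Σ; Σ-syntax; ∃; ∃-syntax; _×_; _,_; proj₁; proj₂)
open import Data.Product.Function.NonDependent.Setoid using (_×-injection_)
open import Data.Product.Relation.Binary.Pointwise.NonDependent using (_×ₛ_)
open import Data.Sum.Base using (_⊎_; inj₁; inj₂)
open import Data.Sum.Function.Setoid using (_⊎-injection_)
open import Data.Sum.Relation.Binary.Pointwise using (_⊎ₛ_; inj₁; inj₂)
open import Data.Unit.Base using (⊤)
open import Data.Vec.Functional using (Vector; []; _∷_; tail; _++_)
import Data.Vec.Functional.Properties as Vecₚ
open import Function.Base using (_∘_; id)
open import Function.Bundles using (Func; Injection; _⇔_; mk⇔; module Equivalence)
import Function.Construct.Composition as Compose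
import Function.Construct.Identity as Identity
open import Induction.WellFounded using (WellFounded)
open import Relation.Binary.Bundles using (Setoid)
import Relation.Binary.Construct.Closure.Equivalence as EqClosure
open import Relation.Binary.Core using (Rel; REL)
open import Relation.Binary.Definitions using (tri<; tri≈; tri>)
open import Relation.Binary.PropositionalEquality as ≡ using (_≡_)
open import Relation.Binary.Structures using (IsEquivalence; IsStrictTotalOrder)
open import Relation.Nullary.Decidable
  using (Dec; yes; no; True; toWitness; fromWitness; decidable-stable)
open import Relation.Nullary.Negation using (¬_; contradiction)
open import Relation.Unary using (Pred; _∈_; _⊆_; _≐_; _∪_; _∩_; ∅)

-- The obstacle throughout is that the coordinates of an element of 𝕄^eq are not determined by it:
-- an automorphism fixing `a` may move them. What holds for coordinates passes to `a`, because an
-- automorphism is determined on `a` by its values on them, but a hypothesis on `a` says little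
-- about its coordinates. AI, AIV and AVI get by with the easy direction, and AIII speaks of models,
-- which contain real coordinates for all their elements. AII and AV assume something about the type
-- or the independence of `a` alone, and this is why they take arguments of their own. A second
-- constraint is that members of 𝒦^eq are only copies of structures `A ^eq`, whose equality lives on
-- a higher universe level. The model underlying a copy is therefore recovered from the predicate
-- for real elements, and predicates are brought back to the required level by excluded middle.

private
  variable
    a b ℓ ℓ₁ ℓ₂ ℓ₃ p q s c r c₁ r₁ c₂ r₂ c₃ r₃ : Level
    m n : ℕ

-- Classical logic and the resizing of propositions.

module Classical (Z : ZermeloLogic) where
  open ZermeloLogic Z public

  em : (P : Set p) → Dec P
  em P = excludedMiddle

  -- Excluded middle makes every proposition equivalent to one of any given level.
  record Resize (ℓ : Level) (P : Set p) : Set ℓ where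
    constructor resized
    field truth : True (em P)

  shrink : {P : Set p} → P → Resize ℓ P
  shrink x = resized (fromWitness x)

  expand : {P : Set p} → Resize ℓ P → P
  expand (resized t) = toWitness t

  by-contradiction : {P : Set p} → ¬ ¬ P → P
  by-contradiction = decidable-stable (em _)

  ¬∀⇒∃¬ : {A : Set a} {P : Pred A p} → ¬ (∀ x → P x) → ∃[ x ] ¬ P x
  ¬∀⇒∃¬ ¬all = by-contradiction λ ¬some →
    ¬all λ x → by-contradiction λ ¬Px → ¬some (x , ¬Px)

-- Zorn's lemma for sets ordered by inclusion.

module Zorn (Z : ZermeloLogic) {T : Set a} {ℓ} (Good : Pred (Pred T ℓ) b) where
  open Classical Z

  -- Resizing keeps the union at level `ℓ`, and families have level zero, so that even the family of
  -- all members of the tower below has a union to which the construction applies again.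
  ⋃ : Pred (Pred T ℓ) lzero → Pred T ℓ
  ⋃ 𝒬 t = Resize ℓ (∃[ X ] 𝒬 X × X t)

  ∈⋃ : ∀ {𝒬 : Pred (Pred T ℓ) lzero} {X t} → 𝒬 X → X t → ⋃ 𝒬 t
  ∈⋃ q t∈X = shrink (_ , q , t∈X)

  Chain : Pred (Pred T ℓ) lzero → Set (a ⊔ lsuc ℓ)
  Chain 𝒬 = ∀ {X Y} → 𝒬 X → 𝒬 Y → X ⊆ Y ⊎ Y ⊆ X

  chain-common : ∀ {𝒬} → Chain 𝒬 → ∀ {t u} → ⋃ 𝒬 t → ⋃ 𝒬 u → ∃[ X ] 𝒬 X × X t × X u
  chain-common ch t∈ u∈ with expand t∈ | expand u∈
  ... | X , qX , t∈X | Y , qY , u∈Y with ch qX qY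
  ...   | inj₁ X⊆Y = Y , qY , X⊆Y t∈X , u∈Y
  ...   | inj₂ Y⊆X = X , qX , t∈X , Y⊆X u∈Y

  Maximal : Pred (Pred T ℓ) (a ⊔ lsuc ℓ ⊔ b)
  Maximal X = ∀ {Y} → Good Y → X ⊆ Y → Y ⊆ X

  module _
    (good-resp : ∀ {X Y} → X ≐ Y → Good X → Good Y)
    (base : Pred T ℓ) (base-good : Good base)
    (⋃-good : ∀ {𝒬} → 𝒬 base → (∀ {X} → 𝒬 X → Good X) → Chain 𝒬 → Good (⋃ 𝒬))
    where

    private
      sets : Setoid (a ⊔ lsuc ℓ) (a ⊔ ℓ)
      sets = record
        { Carrier = Pred T ℓ ; _≈_ = _≐_
        ; isEquivalence = record
          { refl  = (λ x → x) , (λ x → x)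
          ; sym   = λ (f , h) → h , f
          ; trans = λ (f , h) (f′ , h′) → (λ x → f′ (f x)) , (λ x → h (h′ x)) } }

      -- A single relation for both cases: `Y` properly enlarges `X` if some good set does, and `Y`
      -- can fall back into `X` only when `X` is maximal. It is total on all sets, good or not, as
      -- choice demands.
      Next : REL (Pred T ℓ) (Pred T ℓ) (a ⊔ lsuc ℓ ⊔ b)
      Next X Y = X ⊆ Y × (Good X → Good Y × (Y ⊆ X → Maximal X))

      next-resp : ∀ {X X′ Y Y′} → X ≐ X′ → Y ≡ Y′ → Next X Y → Next X′ Y′
      next-resp (f , h) ≡.refl (X⊆Y , G) = (λ x → X⊆Y (h x)) , λ good →
        let goodY , max = G (good-resp (h , f) good) in
        goodY , λ Y⊆X′ good′ X′⊆Z z →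
          f (max (λ y → h (Y⊆X′ y)) good′ (λ x → X′⊆Z (f x)) z)

      next-exists : ∀ X → ∃[ Y ] Next X Y
      next-exists X with em (∃[ Y ] Good Y × X ⊆ Y × ¬ (Y ⊆ X))
      ... | yes (Y , good , X⊆Y , Y⊈X) = Y , X⊆Y , λ _ → good , λ Y⊆X → ⊥-elim (Y⊈X Y⊆X)
      ... | no none = X , (λ x → x) , λ good → good , λ _ {Y} goodY X⊆Y →
        by-contradiction λ Y⊈X → none (Y , goodY , X⊆Y , Y⊈X)

      -- Extensional choice into the discrete setoid: sets with the same elements get the identical
      -- successor, which `next-mono` relies on.
      chosen = choice sets (≡.setoid (Pred T ℓ)) Next next-resp next-exists

      next : Pred T ℓ → Pred T ℓ
      next = Func.to (proj₁ chosen)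

      inflate : ∀ {X} → X ⊆ next X
      inflate {X} = proj₁ (proj₂ chosen X)

      data Tower : Pred (Pred T ℓ) (a ⊔ lsuc ℓ) where
        start : Tower base
        step  : ∀ {X} → Tower X → Tower (next X)
        limit : (𝒬 : Pred (Pred T ℓ) lzero) → 𝒬 base → (∀ {X} → 𝒬 X → Tower X) → Tower (⋃ 𝒬)

      base-least : ∀ {X} → Tower X → base ⊆ X
      base-least start x = x
      base-least (step t) x = inflate (base-least t x)
      base-least (limit 𝒬 q ts) x = ∈⋃ q x

      -- The extreme points in the proof of the Bourbaki-Witt theorem; showing that every member of
      -- the tower is one makes the tower a chain.
      Extreme : Pred (Pred T ℓ) (a ⊔ lsuc ℓ)
      Extreme X = ∀ {Y} → Tower Y → Y ⊆ X → ¬ (X ⊆ Y) → next Y ⊆ X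

      next-mono : ∀ {X Y} → X ⊆ Y → Y ⊆ X → next X ⊆ next Y
      next-mono X⊆Y Y⊆X {x} =
        ≡.subst (λ S → S x) (Func.cong (proj₁ chosen) ((λ x → X⊆Y x) , (λ x → Y⊆X x)))

      -- Induction on `Y`: extremality of `X` forbids the successor step to jump past `X`, and a
      -- union either has a member above `next X` or stays below `X`.
      gap : ∀ {X Y} → Tower X → Extreme X → Tower Y → Y ⊆ X ⊎ next X ⊆ Y
      gap tX ext start = inj₁ (base-least tX)
      gap {X} tX ext (step {Y} tY) with gap tX ext tY
      ... | inj₂ p = inj₂ (λ x → inflate (p x))
      ... | inj₁ Y⊆X with em (X ⊆ Y)
      ...   | yes X⊆Y = inj₂ (next-mono X⊆Y Y⊆X)
      ...   | no X⊈Y = inj₁ (ext tY Y⊆X X⊈Y)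
      gap {X} tX ext (limit 𝒬 q ts) with em (∃[ Y ] 𝒬 Y × next X ⊆ Y)
      ... | yes (Y , qY , p) = inj₂ (λ x → ∈⋃ qY (p x))
      ... | no none = inj₁ λ x∈ → below (expand x∈)
        where
        below : ∀ {x} → ∃[ Y ] 𝒬 Y × Y x → X x
        below (Y , qY , x∈Y) with gap tX ext (ts qY)
        ... | inj₁ Y⊆X = Y⊆X x∈Y
        ... | inj₂ p = contradiction (Y , qY , λ {x} → p {x}) none

      extreme : ∀ {X} → Tower X → Extreme X
      extreme start tY Y⊆X X⊈Y = ⊥-elim (X⊈Y (base-least tY))
      extreme (step {X} tX) {Y} tY Y⊆ ⊈Y with gap tX (extreme tX) tY
      ... | inj₂ p = ⊥-elim (⊈Y p)
      ... | inj₁ Y⊆X with em (X ⊆ Y)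
      ...   | yes X⊆Y = next-mono Y⊆X X⊆Y
      ...   | no X⊈Y = λ y → inflate (extreme tX tY Y⊆X X⊈Y y)
      extreme (limit 𝒬 q ts) {Y} tY Y⊆ ⊈Y with em (∃[ X ] 𝒬 X × ¬ (X ⊆ Y))
      ... | no none = ⊥-elim (⊈Y λ x∈ → let X , qX , x∈X = expand x∈ in
              by-contradiction λ x∉Y → none (X , qX , λ X⊆Y → x∉Y (X⊆Y x∈X)))
      ... | yes (X , qX , X⊈Y) with gap (ts qX) (extreme (ts qX)) tY
      ...   | inj₁ Y⊆X = λ y → ∈⋃ qX (extreme (ts qX) tY Y⊆X X⊈Y y)
      ...   | inj₂ p = ⊥-elim (X⊈Y λ x → p (inflate x))

      tower-chain : ∀ {X Y} → Tower X → Tower Y → X ⊆ Y ⊎ Y ⊆ X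
      tower-chain tX tY with gap tX (extreme tX) tY
      ... | inj₁ Y⊆X = inj₂ Y⊆X
      ... | inj₂ p = inj₁ (λ x → p (inflate x))

      tower-good : ∀ {X} → Tower X → Good X
      tower-good start = base-good
      tower-good (step {X} tX) = proj₁ (proj₂ (proj₂ chosen X) (tower-good tX))
      tower-good (limit 𝒬 q ts) = ⋃-good q (λ qX → tower-good (ts qX))
        (λ qX qY → tower-chain (ts qX) (ts qY))

      all : Pred (Pred T ℓ) lzero
      all X = Resize lzero (Tower X)

      top : Tower (⋃ all)
      top = limit all (shrink start) expand

    abstract
      -- The union of the whole tower is in the tower, hence so is its successor, which is then
      -- contained in it; by `Next` this happens only at a maximal set.
      zorn : ∃[ X ] Good X × base ⊆ X × Maximal X
      zorn = ⋃ all , tower-good top , base-least top ,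
        proj₂ (proj₂ (proj₂ chosen (⋃ all)) (tower-good top)) (∈⋃ (shrink (step top)))

-- Cardinal arithmetic: comparability, κ² = κ and the size of `A ^eq`.

module Cardinals (Z : ZermeloLogic) where
  open Classical Z
  open Injection using (to; injective) renaming (cong to to-cong)

  ≲-refl : {S : Setoid a ℓ} → S ≲ S
  ≲-refl {S = S} = Identity.injection S

  infixr 5 _⟫_
  _⟫_ : {S : Setoid a ℓ₁} {T : Setoid b ℓ₂} {U : Setoid p ℓ₃} → S ≲ T → T ≲ U → S ≲ U
  _⟫_ = Compose.injection

  module _ (S : Setoid a ℓ₁) (T : Setoid b ℓ₂) where
    private
      module S = Setoid S
      module T = Setoid T

    graph⇒≲ : (R : REL S.Carrier T.Carrier ℓ) →
      (∀ {x x′ y y′} → x S.≈ x′ → y T.≈ y′ → R x y → R x′ y′) →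
      (∀ x → ∃[ y ] R x y) → (∀ {x x′ y} → R x y → R x′ y → x S.≈ x′) →
      Σ[ i ∈ S ≲ T ] (∀ x → R x (to i x))
    graph⇒≲ R resp total inj with choice S T R resp total
    ... | f , Rf = record
      { to = Func.to f ; cong = Func.cong f
      ; injective = λ {x} {x′} p → inj (Rf x) (resp S.refl (T.sym p) (Rf x′)) } , Rf

  -- Equal elements get the identical representative, so a function applied to representatives
  -- respects equality even if by itself it does not.
  representatives : (S : Setoid a ℓ) →
    Σ[ f ∈ Func S (≡.setoid (Setoid.Carrier S)) ] (∀ x → Setoid._≈_ S x (Func.to f x))
  representatives S = choice S (≡.setoid _) _≈_
    (λ { p ≡.refl q → trans (sym p) q }) λ x → x , refl
    where open Setoid S

  restrict-mono : (S : Setoid a ℓ) {X : Pred (Setoid.Carrier S) p} {Y : Pred (Setoid.Carrier S) q} →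
    X ⊆ Y → restrict S X ≲ restrict S Y
  restrict-mono S X⊆Y = record { to = λ (x , x∈) → x , X⊆Y x∈ ; cong = id ; injective = id }

  restrict-≲ : (S : Setoid a ℓ) {X : Pred (Setoid.Carrier S) p} → restrict S X ≲ S
  restrict-≲ S = record { to = proj₁ ; cong = id ; injective = id }

  -- A maximal partial injection exhausts one of the two sides.
  module _ (S : Setoid a ℓ₁) (T : Setoid b ℓ₂) where
    private
      module S = Setoid S
      module T = Setoid T
      ℓ₀ = a ⊔ b ⊔ ℓ₁ ⊔ ℓ₂

      record PartialInjection (F : Pred (S.Carrier × T.Carrier) ℓ₀) : Set ℓ₀ where
        field
          resp       : ∀ {x x′ y y′} → x S.≈ x′ → y T.≈ y′ → F (x , y) → F (x′ , y′)
          functional : ∀ {x y y′} → F (x , y) → F (x , y′) → y T.≈ y′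
          injective  : ∀ {x x′ y} → F (x , y) → F (x′ , y) → x S.≈ x′
      open PartialInjection

      open Zorn Z PartialInjection

      maximal = zorn
        (λ (f , h) P → record
          { resp       = λ p q z → f (resp P p q (h z))
          ; functional = λ z z′ → functional P (h z) (h z′)
          ; injective  = λ z z′ → injective P (h z) (h z′) })
        (λ _ → Lift ℓ₀ ⊥)
        (record { resp = λ { _ _ () } ; functional = λ () ; injective = λ () })
        (λ _ good ch → record
          { resp = λ p q z → let X , qX , z∈X = expand z in ∈⋃ qX (resp (good qX) p q z∈X)
          ; functional = λ z z′ → let X , qX , u , v = chain-common ch z z′ in functional (good qX) u v
          ; injective  = λ z z′ → let X , qX , u , v = chain-common ch z z′ in injective (good qX) u v })

      module Maximal-Injection (F : Pred (S.Carrier × T.Carrier) ℓ₀) (pF : PartialInjection F)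
                               (F-max : Maximal F) where

        result : S ≲ T ⊎ T ≲ S
        result with em (∀ x → ∃[ y ] F (x , y)) | em (∀ y → ∃[ x ] F (x , y))
        ... | yes total | _ = inj₁ (proj₁ (graph⇒≲ S T (λ x y → F (x , y)) (resp pF) total (injective pF)))
        ... | no _ | yes onto = inj₂ (proj₁ (graph⇒≲ T S (λ y x → F (x , y)) (λ p q → resp pF q p) onto (functional pF)))
        ... | no ¬total | no ¬onto = ⊥-elim (x∉ (y₀ , F-max extended inj₁
                                                  (inj₂ (S.refl , T.refl))))
          where
          x₀ = proj₁ (¬∀⇒∃¬ ¬total)
          x∉ = proj₂ (¬∀⇒∃¬ ¬total)
          y₀ = proj₁ (¬∀⇒∃¬ ¬onto)
          y∉ = proj₂ (¬∀⇒∃¬ ¬onto)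
          F⁺ : Pred (S.Carrier × T.Carrier) ℓ₀
          F⁺ (x , y) = F (x , y) ⊎ (x₀ S.≈ x × y₀ T.≈ y)
          extended : PartialInjection F⁺
          extended .resp p q (inj₁ z) = inj₁ (resp pF p q z)
          extended .resp p q (inj₂ (u , v)) = inj₂ (S.trans u p , T.trans v q)
          extended .functional (inj₁ z) (inj₁ z′) = functional pF z z′
          extended .functional (inj₁ z) (inj₂ (u , v)) = ⊥-elim (x∉ (_ , resp pF (S.sym u) T.refl z))
          extended .functional (inj₂ (u , v)) (inj₁ z) = ⊥-elim (x∉ (_ , resp pF (S.sym u) T.refl z))
          extended .functional (inj₂ (_ , v)) (inj₂ (_ , v′)) = T.trans (T.sym v) v′
          extended .injective (inj₁ z) (inj₁ z′) = injective pF z z′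
          extended .injective (inj₁ z) (inj₂ (u , v)) = ⊥-elim (y∉ (_ , resp pF S.refl (T.sym v) z))
          extended .injective (inj₂ (u , v)) (inj₁ z) = ⊥-elim (y∉ (_ , resp pF S.refl (T.sym v) z))
          extended .injective (inj₂ (u , _)) (inj₂ (u′ , _)) = S.trans (S.sym u) u′

    abstract
      comparable : S ≲ T ⊎ T ≲ S
      comparable = Maximal-Injection.result (proj₁ maximal) (proj₁ (proj₂ maximal))
        (proj₂ (proj₂ (proj₂ maximal)))

  -- (m , n) ↦ 2ᵐ(2n+1)
  ℕ-pair : ℕ → ℕ → ℕ
  ℕ-pair zero    n = suc (2 * n)
  ℕ-pair (suc m) n = 2 * ℕ-pair m n

  ℕ-pair-injective : ∀ m n m′ n′ → ℕ-pair m n ≡ ℕ-pair m′ n′ → m ≡ m′ × n ≡ n′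
  ℕ-pair-injective zero n zero n′ eq = ≡.refl , ℕₚ.*-cancelˡ-≡ n n′ 2 (ℕₚ.suc-injective eq)
  ℕ-pair-injective zero n (suc m′) n′ eq = contradiction (≡.sym eq) (ℕₚ.even≢odd (ℕ-pair m′ n′) n)
  ℕ-pair-injective (suc m) n zero n′ eq = contradiction eq (ℕₚ.even≢odd (ℕ-pair m n) n′)
  ℕ-pair-injective (suc m) n (suc m′) n′ eq
    with ℕ-pair-injective m n m′ n′ (ℕₚ.*-cancelˡ-≡ (ℕ-pair m n) (ℕ-pair m′ n′) 2 eq)
  ... | ≡.refl , n≡n′ = ≡.refl , n≡n′

  Infinite : Setoid a ℓ → Set (a ⊔ ℓ)
  Infinite S = ≡.setoid ℕ ≲ S

  module _ {S : Setoid a ℓ} (inf : Infinite S) (square : (S ×ₛ S) ≲ S) where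
    private
      module S = Setoid S

    infinite-⊎ : (S ⊎ₛ S) ≲ S
    infinite-⊎ = tagged ⟫ square
      where
      tagged : (S ⊎ₛ S) ≲ (S ×ₛ S)
      tagged = record
        { to = λ { (inj₁ x) → to inf 0 , x ; (inj₂ x) → to inf 1 , x }
        ; cong = λ { (inj₁ p) → S.refl , p ; (inj₂ p) → S.refl , p }
        ; injective = λ
            { {inj₁ _} {inj₁ _} (_ , p) → inj₁ p
            ; {inj₁ _} {inj₂ _} (e , _) → contradiction (injective inf e) λ ()
            ; {inj₂ _} {inj₁ _} (e , _) → contradiction (injective inf e) λ ()
            ; {inj₂ _} {inj₂ _} (_ , p) → inj₂ p } }

  -- A maximal injection Y × Y → Y with Y ⊆ S infinite: if S ∖ Y embedded into
  -- Y then so would S, and otherwise S ∖ Y contains a copy Z of Y, which has room for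
  -- the new pairs of (Y ∪ Z) × (Y ∪ Z).
  module _ (S : Setoid a ℓ) (inf : Infinite S) where
    private
      module S = Setoid S
      C = S.Carrier
      -- The set Y and the graph of the pairing on it are coded as one subset of a sum, so that
      -- inclusion compares both at once.
      Point = C ⊎ (C × C × C)

      record Pairing (X : Pred Point (a ⊔ ℓ)) : Set (a ⊔ ℓ) where
        Y : Pred C (a ⊔ ℓ)
        Y x = X (inj₁ x)
        F : C → C → C → Set (a ⊔ ℓ)
        F x y z = X (inj₂ (x , y , z))
        field
          Y-resp     : ∀ {x x′} → x S.≈ x′ → Y x → Y x′
          F-resp     : ∀ {x x′ y y′ z z′} → x S.≈ x′ → y S.≈ y′ → z S.≈ z′ → F x y z → F x′ y′ z′
          total      : ∀ {x y} → Y x → Y y → ∃[ z ] F x y z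
          field₃     : ∀ {x y z} → F x y z → Y z
          functional : ∀ {x y z z′} → F x y z → F x y z′ → z S.≈ z′
          injective₂ : ∀ {x x′ y y′ z} → F x y z → F x′ y′ z → x S.≈ x′ × y S.≈ y′
          domain     : ∀ {x y z} → F x y z → Y x × Y y
      open Pairing

      open Zorn Z Pairing

      -- The copy of ℕ in `S` with the pairing function of ℕ. Starting from it makes every Y that
      -- contains it infinite, as `infinite-⊎` requires.
      base : Pred Point (a ⊔ ℓ)
      base (inj₁ x) = Lift a (∃[ n ] x S.≈ to inf n)
      base (inj₂ (x , y , z)) = Lift a (∃[ m ] ∃[ n ]
        x S.≈ to inf m × y S.≈ to inf n × z S.≈ to inf (ℕ-pair m n))

      base-good : Pairing base
      base-good .Y-resp p (lift (n , e)) = lift (n , S.trans (S.sym p) e)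
      base-good .F-resp p q r (lift (m , n , e , f , g)) = lift
        (m , n , S.trans (S.sym p) e , S.trans (S.sym q) f , S.trans (S.sym r) g)
      base-good .total (lift (m , e)) (lift (n , f)) = _ , lift (m , n , e , f , S.refl)
      base-good .field₃ (lift (m , n , _ , _ , g)) = lift (ℕ-pair m n , g)
      base-good .functional (lift (m , n , e , f , g)) (lift (m′ , n′ , e′ , f′ , g′))
        with injective inf (S.trans (S.sym e) e′) | injective inf (S.trans (S.sym f) f′)
      ... | ≡.refl | ≡.refl = S.trans g (S.sym g′)
      base-good .injective₂ (lift (m , n , e , f , g)) (lift (m′ , n′ , e′ , f′ , g′))
        with ℕ-pair-injective m n m′ n′ (injective inf (S.trans (S.sym g) g′))
      ... | ≡.refl , ≡.refl = S.trans e (S.sym e′) , S.trans f (S.sym f′)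
      base-good .domain (lift (m , n , e , f , _)) = lift (m , e) , lift (n , f)

      maximal = zorn
        (λ (f , h) P → record
          { Y-resp     = λ p y → f (Y-resp P p (h y))
          ; F-resp     = λ p q r z → f (F-resp P p q r (h z))
          ; total      = λ x y → let z , z∈ = total P (h x) (h y) in z , f z∈
          ; field₃     = λ z → f (field₃ P (h z))
          ; functional = λ z z′ → functional P (h z) (h z′)
          ; injective₂ = λ z z′ → injective₂ P (h z) (h z′)
          ; domain     = λ z → let u , v = domain P (h z) in f u , f v })
        base base-good
        (λ _ good ch → record
          { Y-resp     = λ p y → let X , qX , u = expand y in ∈⋃ qX (Y-resp (good qX) p u)
          ; F-resp     = λ p q r z → let X , qX , u = expand z in ∈⋃ qX (F-resp (good qX) p q r u)
          ; total      = λ x y → let X , qX , u , v = chain-common ch x y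
                                     z , z∈ = total (good qX) u v in z , ∈⋃ qX z∈
          ; field₃     = λ z → let X , qX , u = expand z in ∈⋃ qX (field₃ (good qX) u)
          ; functional = λ z z′ → let X , qX , u , v = chain-common ch z z′ in functional (good qX) u v
          ; injective₂ = λ z z′ → let X , qX , u , v = chain-common ch z z′ in injective₂ (good qX) u v
          ; domain     = λ z → let X , qX , u = expand z
                                   v , w = domain (good qX) u in ∈⋃ qX v , ∈⋃ qX w })

      module Maximal-Pairing (M : Pred Point (a ⊔ ℓ)) (P : Pairing M)
                             (base⊆M : base ⊆ M) (M-max : Maximal M) where
        Inside = restrict S (Y P)
        Outside = restrict S (λ x → ¬ Y P x)

        pairing-graph = graph⇒≲ (Inside ×ₛ Inside) Inside
          (λ ((x , _) , (y , _)) (z , _) → F P x y z)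
          (λ (p , q) r → F-resp P p q r)
          (λ ((_ , x∈) , (_ , y∈)) → let z , Fz = total P x∈ y∈ in (z , field₃ P Fz) , Fz)
          (injective₂ P)

        pairing : (Inside ×ₛ Inside) ≲ Inside
        pairing = proj₁ pairing-graph

        inf-Y : Infinite Inside
        inf-Y = record
          { to = λ n → to inf n , base⊆M {inj₁ _} (lift (n , S.refl))
          ; cong = to-cong inf ; injective = injective inf }

        split : S ≲ (Inside ⊎ₛ Outside)
        split = record { to = side ; cong = side-cong ; injective = side-inj }
          where
          open Setoid (Inside ⊎ₛ Outside) using () renaming (_≈_ to _∼_)
          side : C → Setoid.Carrier (Inside ⊎ₛ Outside)
          side x with em (Y P x)
          ... | yes x∈ = inj₁ (x , x∈)
          ... | no x∉ = inj₂ (x , x∉)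
          side-cong : ∀ {x y} → x S.≈ y → side x ∼ side y
          side-cong {x} {y} p with em (Y P x) | em (Y P y)
          ... | yes _ | yes _ = inj₁ p
          ... | no _ | no _ = inj₂ p
          ... | yes x∈ | no y∉ = contradiction (Y-resp P p x∈) y∉
          ... | no x∉ | yes y∈ = contradiction (Y-resp P (S.sym p) y∈) x∉
          side-inj : ∀ {x y} → side x ∼ side y → x S.≈ y
          side-inj {x} {y} p with em (Y P x) | em (Y P y) | p
          ... | yes _ | yes _ | inj₁ p′ = p′
          ... | no _ | no _ | inj₂ p′ = p′

        extend-into : Inside ≲ Outside → ∀ {x} → Y P x → ⊥
        extend-into j {x} x∈ = proj₂ (to j (x , x∈))
          -- The image of `x` under `j` lies outside Y, but the extended pairing has it inside.
          (M-max extended M⊆M⁺ {inj₁ (proj₁ (to j (x , x∈)))} (lift (inj₂ (x , x∈) , S.refl)))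
          where
          Both = Inside ⊎ₛ Inside
          open Setoid Both using () renaming (_≈_ to _∼_)
          module Both = Setoid Both

          val : Both.Carrier → C
          val (inj₁ (y , _)) = y
          val (inj₂ y) = proj₁ (to j y)

          val-cong : ∀ {v w} → v ∼ w → val v S.≈ val w
          val-cong (inj₁ p) = p
          val-cong (inj₂ p) = to-cong j p

          val-inj : ∀ {v w} → val v S.≈ val w → v ∼ w
          val-inj {inj₁ _} {inj₁ _} p = inj₁ p
          val-inj {inj₁ (_ , v∈)} {inj₂ w} p = contradiction (Y-resp P p v∈) (proj₂ (to j w))
          val-inj {inj₂ v} {inj₁ (_ , w∈)} p = contradiction (Y-resp P (S.sym p) w∈) (proj₂ (to j v))
          val-inj {inj₂ _} {inj₂ _} p = inj₂ (injective j p)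

          code : (Both ×ₛ Both) ≲ Inside
          code = (infinite-⊎ inf-Y pairing ×-injection infinite-⊎ inf-Y pairing) ⟫ pairing

          pair⁺ : (Both ×ₛ Both) ≲ Both
          pair⁺ = record { to = f ; cong = λ {u} {v} → f-cong u v ; injective = λ {u} {v} → f-inj u v }
            where
            open Setoid (Both ×ₛ Both) using () renaming (Carrier to B²; _≈_ to _≈²_)
            f : B² → Both.Carrier
            -- Old pairs keep their value in Y. All other pairs are coded into Y and then placed in
            -- the second copy, so that the two kinds of values never collide.
            f (inj₁ x , inj₁ y) = inj₁ (to pairing (x , y))
            f w@(inj₁ _ , inj₂ _) = inj₂ (to code w)
            f w@(inj₂ _ , _) = inj₂ (to code w)
            f-cong : ∀ u v → u ≈² v → f u ∼ f v
            f-cong (inj₁ _ , inj₁ _) (inj₁ _ , inj₁ _) (inj₁ p , inj₁ q) = inj₁ (to-cong pairing (p , q))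
            f-cong u@(inj₁ _ , inj₂ _) v@(inj₁ _ , inj₂ _) e = inj₂ (to-cong code {u} {v} e)
            f-cong u@(inj₂ _ , _) v@(inj₂ _ , _) e = inj₂ (to-cong code {u} {v} e)
            f-cong (inj₁ _ , inj₁ _) (inj₁ _ , inj₂ _) (_ , ())
            f-cong (inj₁ _ , inj₂ _) (inj₁ _ , inj₁ _) (_ , ())
            f-cong (inj₁ _ , _) (inj₂ _ , _) (() , _)
            f-cong (inj₂ _ , _) (inj₁ _ , _) (() , _)
            f-inj : ∀ u v → f u ∼ f v → u ≈² v
            f-inj (inj₁ _ , inj₁ _) (inj₁ _ , inj₁ _) (inj₁ e) =
              let p , q = injective pairing e in inj₁ p , inj₁ q
            f-inj u@(inj₁ _ , inj₂ _) v@(inj₁ _ , inj₂ _) (inj₂ e) = injective code {u} {v} e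
            f-inj u@(inj₁ _ , inj₂ _) v@(inj₂ _ , _) (inj₂ e) = injective code {u} {v} e
            f-inj u@(inj₂ _ , _) v@(inj₁ _ , inj₂ _) (inj₂ e) = injective code {u} {v} e
            f-inj u@(inj₂ _ , _) v@(inj₂ _ , _) (inj₂ e) = injective code {u} {v} e
            f-inj (inj₁ _ , inj₁ _) (inj₁ _ , inj₂ _) ()
            f-inj (inj₁ _ , inj₁ _) (inj₂ _ , _) ()
            f-inj (inj₁ _ , inj₂ _) (inj₁ _ , inj₁ _) ()
            f-inj (inj₂ _ , _) (inj₁ _ , inj₁ _) ()

          M⁺ : Pred Point (a ⊔ ℓ)
          M⁺ (inj₁ y) = Lift a (∃[ w ] y S.≈ val w)
          M⁺ (inj₂ (x , y , z)) = Lift a (∃[ v ] ∃[ w ]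
            x S.≈ val v × y S.≈ val w × z S.≈ val (to pair⁺ (v , w)))

          extended : Pairing M⁺
          extended .Y-resp p (lift (w , e)) = lift (w , S.trans (S.sym p) e)
          extended .F-resp p q r (lift (v , w , e , f , g)) = lift
            (v , w , S.trans (S.sym p) e , S.trans (S.sym q) f , S.trans (S.sym r) g)
          extended .total (lift (v , e)) (lift (w , f)) = _ , lift (v , w , e , f , S.refl)
          extended .field₃ (lift (v , w , _ , _ , g)) = lift (to pair⁺ (v , w) , g)
          extended .functional (lift (v , w , e , f , g)) (lift (v′ , w′ , e′ , f′ , g′)) =
            S.trans g (S.trans (val-cong (to-cong pair⁺ {v , w} {v′ , w′}
              (val-inj {v} {v′} (S.trans (S.sym e) e′) , val-inj {w} {w′} (S.trans (S.sym f) f′))))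
              (S.sym g′))
          extended .injective₂ (lift (v , w , e , f , g)) (lift (v′ , w′ , e′ , f′ , g′))
            with injective pair⁺ {v , w} {v′ , w′} (val-inj {to pair⁺ (v , w)} {to pair⁺ (v′ , w′)} (S.trans (S.sym g) g′))
          ... | p , q = S.trans e (S.trans (val-cong {v} {v′} p) (S.sym e′)) , S.trans f (S.trans (val-cong {w} {w′} q) (S.sym f′))
          extended .domain (lift (v , w , e , f , _)) = lift (v , e) , lift (w , f)

          M⊆M⁺ : M ⊆ M⁺
          M⊆M⁺ {inj₁ y} y∈ = lift (inj₁ (y , y∈) , S.refl)
          M⊆M⁺ {inj₂ (x , y , z)} Fz =
            let x∈ , y∈ = domain P Fz in
            lift (inj₁ (x , x∈) , inj₁ (y , y∈) , S.refl , S.refl ,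
                  functional P Fz (proj₂ pairing-graph ((x , x∈) , (y , y∈))))

        result : (S ×ₛ S) ≲ S
        result with comparable Outside Inside
        ... | inj₁ O≲I = (S≲I ×-injection S≲I) ⟫ pairing ⟫ restrict-≲ S
          where
          S≲I : S ≲ Inside
          S≲I = split ⟫ (≲-refl ⊎-injection O≲I) ⟫ infinite-⊎ inf-Y pairing
        ... | inj₂ I≲O = ⊥-elim (extend-into I≲O (base⊆M {inj₁ _} (lift (0 , S.refl))))

    abstract
      square : (S ×ₛ S) ≲ S
      square = Maximal-Pairing.result (proj₁ maximal) (proj₁ (proj₂ maximal))
        (proj₁ (proj₂ (proj₂ maximal))) (proj₂ (proj₂ (proj₂ maximal)))

  -- Each new element avoids the list of its predecessors; a list covering `S` would embed it into a
  -- finite set.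
  no-finite⇒infinite : (S : Setoid a ℓ) → (∀ n → ¬ (S ≲ ≡.setoid (Fin n))) → Infinite S
  no-finite⇒infinite {a} {ℓ} S no-finite = record
    { to = x ; cong = λ { ≡.refl → S.refl } ; injective = λ {m} {n} → x-injective m n }
    where
    module S = Setoid S
    fresh : (xs : List S.Carrier) → ∃[ y ] ¬ (∃[ i ] y S.≈ List.lookup xs i)
    fresh xs = ¬∀⇒∃¬ λ covered → no-finite (List.length xs)
      (proj₁ (graph⇒≲ S (≡.setoid _) (λ y i → y S.≈ List.lookup xs i)
        (λ { p ≡.refl q → S.trans (S.sym p) q }) covered λ p q → S.trans p (S.sym q)))
    initial : ℕ → List S.Carrier
    initial zero = List.[]
    initial (suc n) = proj₁ (fresh (initial n)) List.∷ initial n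
    x : ℕ → S.Carrier
    x n = proj₁ (fresh (initial n))
    earlier : ∀ {m n} → m ≤′ n → ∃[ i ] List.lookup (initial (suc n)) i ≡ x m
    earlier ≤′-refl = zero , ≡.refl
    earlier (≤′-step m≤n) = let i , e = earlier m≤n in suc i , e
    distinct : ∀ {m n} → m < n → ¬ (x n S.≈ x m)
    distinct {m} {suc n} m<n p = let i , e = earlier {m} {n} (ℕₚ.≤⇒≤′ (ℕₚ.≤-pred m<n)) in
      proj₂ (fresh (initial (suc n))) (i , S.trans p (S.reflexive (≡.sym e)))
    x-injective : ∀ m n → x m S.≈ x n → m ≡ n
    x-injective m n p with ℕₚ.<-cmp m n
    ... | tri< m<n _ _ = ⊥-elim (distinct m<n (S.sym p))
    ... | tri≈ _ m≡n _ = m≡n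
    ... | tri> _ _ n<m = ⊥-elim (distinct n<m p)

  module VectorCode {S : Setoid a ℓ} (inf : Infinite S) (sq : (S ×ₛ S) ≲ S) where
    open Setoid S

    -- Iterated pairing. The length is not recorded, since in `eq-cardinal` it is known from the
    -- symbol of the class.
    code : ∀ {n} → Vector Carrier n → Carrier
    code {zero}  xs = to inf 0
    code {suc n} xs = to sq (xs zero , code (tail xs))

    code-cong : ∀ {n} {xs ys : Vector Carrier n} → (∀ i → xs i ≈ ys i) → code xs ≈ code ys
    code-cong {zero}  p = refl
    code-cong {suc n} p = to-cong sq (p zero , code-cong (p ∘ suc))

    code-injective : ∀ {n} {xs ys : Vector Carrier n} → code xs ≈ code ys → ∀ i → xs i ≈ ys i
    code-injective {suc n} p zero = proj₁ (injective sq p)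
    code-injective {suc n} p (suc i) = code-injective (proj₂ (injective sq p)) i

  module _ {s c r k} {L : Signature s} {𝒦 : StructureClass L c r k} {𝕄 : Structure L c r} {Δ : Set c}
           (ℰ : Equivalences 𝒦 𝕄 Δ) where
    open Eq ℰ

    -- An element is coded through its chosen representative: a tag, 0 for a real element and the
    -- successor of the number of `e` for a class, paired with the code of its coordinates.
    eq-cardinal : (A : Structure L c r) {κ : Setoid a ℓ} → Infinite κ →
      Structure.setoid A ≲ κ → setoidᵉ A ≲ κ
    eq-cardinal A {κ} inf A≲κ = record
      { to = λ u → enc (Func.to rep u)
      ; cong = λ p → reflexive (≡.cong enc (Func.cong rep p))
      ; injective = λ {u} {v} p →
          ≈ᵉ-trans A (rep≈ u) (≈ᵉ-trans A (enc-injective _ _ p) (≈ᵉ-sym A (rep≈ v))) }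
      where
      open Setoid κ
      sq = square κ inf
      open VectorCode {S = κ} inf sq
      rep = proj₁ (representatives (setoidᵉ A))
      rep≈ = proj₂ (representatives (setoidᵉ A))
      enc : Elem A → Carrier
      enc (real x)    = to sq (to inf 0 , to A≲κ x)
      enc (class e a) = to sq (to inf (suc (to (Equivalences.countable ℰ) e)) , code (to A≲κ ∘ a))
      enc-injective : ∀ u v → enc u ≈ enc v → _≈ᵉ_ A u v
      enc-injective (real x) (real y) p = real≈ (injective A≲κ (proj₂ (injective sq p)))
      enc-injective (real x) (class e a) p = contradiction (injective inf (proj₁ (injective sq p))) λ ()
      enc-injective (class e a) (real x) p = contradiction (injective inf (proj₁ (injective sq p))) λ ()
      enc-injective (class e a) (class f b) p
        with injective (Equivalences.countable ℰ) (ℕₚ.suc-injective (injective inf (proj₁ (injective sq p))))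
      ... | ≡.refl = quotient-cong A (just e) λ i →
        injective A≲κ (code-injective {xs = to A≲κ ∘ a} {ys = to A≲κ ∘ b} (proj₂ (injective sq p)) i)

-- Concatenation of tuples.

module _ {X : Set a} where

  ++-map : {Y : Set b} (f : X → Y) (u : Vector X m) (v : Vector X n) →
           ∀ i → f ((u ++ v) i) ≡ ((f ∘ u) ++ (f ∘ v)) i
  ++-map {m = m} f u v i with splitAt m i
  ... | inj₁ _ = ≡.refl
  ... | inj₂ _ = ≡.refl

  ++-pointwise : {Y : Set b} {R : X → Y → Set ℓ} {u : Vector X m} {v : Vector X n}
    {u′ : Vector Y m} {v′ : Vector Y n} →
    (∀ i → R (u i) (u′ i)) → (∀ i → R (v i) (v′ i)) → ∀ i → R ((u ++ v) i) ((u′ ++ v′) i)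
  ++-pointwise {m = m} p q i with splitAt m i
  ... | inj₁ j = p j
  ... | inj₂ j = q j

  ++-all : {P : X → Set ℓ} {u : Vector X m} {v : Vector X n} →
    (∀ i → P (u i)) → (∀ i → P (v i)) → ∀ i → P ((u ++ v) i)
  ++-all {m = m} p q i with splitAt m i
  ... | inj₁ j = p j
  ... | inj₂ j = q j

  ++-left : (u : Vector X m) (v : Vector X n) → ∀ i → (u ++ v) (i ↑ˡ n) ≡ u i
  ++-left = Vecₚ.lookup-++ˡ

  ++-right : (u : Vector X m) (v : Vector X n) → ∀ i → (u ++ v) (m ↑ʳ i) ≡ v i
  ++-right = Vecₚ.lookup-++ʳ

-- Inverses and composites of isomorphisms.

module _ {L : Signature s} where

  idⁱ : (A : Structure L c r) → Isomorphism A A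
  idⁱ A = record { embedding = idᵉ A ; surjective = λ y → y , Structure.refl A }

  symⁱ : {A : Structure L c₁ r₁} {B : Structure L c₂ r₂} → Isomorphism A B → Isomorphism B A
  symⁱ {A = A} {B} f = record
    { embedding = record
      { to = back
      ; cong = λ p → f.injective (B.trans (f-back _) (B.trans p (B.sym (f-back _))))
      ; injective = λ p → B.trans (B.sym (f-back _)) (B.trans (f.cong p) (f-back _))
      ; rel-iff = λ R ys → mk⇔
          (λ z → Equivalence.from (f.rel-iff R _) (B.rel-resp R (λ i → B.sym (f-back _)) z))
          (λ z → B.rel-resp R (λ i → f-back _) (Equivalence.to (f.rel-iff R _) z))
      ; fun-hom = λ h ys → f.injective (B.trans (f-back _)
          (B.trans (B.fun-cong h (λ i → B.sym (f-back _))) (B.sym (f.fun-hom h _)))) }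
    ; surjective = λ x → f.to x , f.injective (f-back _) }
    where
    module A = Structure A
    module B = Structure B
    module f = Isomorphism f
    back : B.Carrier → A.Carrier
    back y = proj₁ (f.surjective y)
    f-back : ∀ y → f.to (back y) B.≈ y
    f-back y = proj₂ (f.surjective y)

  infixr 9 _∘ⁱ_
  _∘ⁱ_ : {A : Structure L c₁ r₁} {B : Structure L c₂ r₂} {C : Structure L c₃ r₃} →
         Isomorphism B C → Isomorphism A B → Isomorphism A C
  _∘ⁱ_ {C = C} g f = record
    { embedding = Isomorphism.embedding g ∘ᵉ Isomorphism.embedding f
    ; surjective = λ z →
        let y , gy≈z = Isomorphism.surjective g z
            x , fx≈y = Isomorphism.surjective f y in
        x , Structure.trans C (Isomorphism.cong g fx≈y) gy≈z }

  infix 20 _⁻¹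
  _⁻¹ : {A : Structure L c₁ r₁} {B : Structure L c₂ r₂} →
        Isomorphism A B → Structure.Carrier B → Structure.Carrier A
  f ⁻¹ = Isomorphism.to (symⁱ f)

  to-⁻¹ : {A : Structure L c₁ r₁} {B : Structure L c₂ r₂} (f : Isomorphism A B) →
          ∀ y → Structure._≈_ B (Isomorphism.to f ((f ⁻¹) y)) y
  to-⁻¹ f y = proj₂ (Isomorphism.surjective f y)

  ⁻¹-to : {A : Structure L c₁ r₁} {B : Structure L c₂ r₂} (f : Isomorphism A B) →
          ∀ x → Structure._≈_ A ((f ⁻¹) (Isomorphism.to f x)) x
  ⁻¹-to f x = proj₂ (Isomorphism.surjective (symⁱ f) x)

  underlying-≲ : {A : Structure L c₁ r₁} {B : Structure L c₂ r₂} → Embedding A B →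
    Structure.setoid A ≲ Structure.setoid B
  underlying-≲ f = record { to = to ; cong = cong ; injective = injective }
    where open Embedding f

  corestrict : {A : Structure L c₁ r₁} {B : Structure L c₂ r₂} (f : Embedding A B) (S : Substructure B) →
    (∀ x → Embedding.to f x ∈ mem S) → Embedding A (B ↾ S)
  corestrict f S f∈S = record
    { to = λ x → f.to x , f∈S x ; cong = f.cong ; injective = f.injective
    ; rel-iff = λ R xs → f.rel-iff R xs ; fun-hom = f.fun-hom }
    where module f = Embedding f

-- Images of embeddings as substructures.

module Images (Z : ZermeloLogic) where
  open Classical Z

  module _ {L : Signature s} {A : Structure L c₁ r₁} {B : Structure L c r} (f : Embedding A B) where
    private
      module A = Structure A
      module B = Structure B
      module f = Embedding f

    image : Substructure B
    image = record
      { mem = λ y → Resize c (∃[ x ] f.to x B.≈ y)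
      ; resp = λ p m → let x , e = expand m in shrink (x , B.trans e p)
      ; closed = λ h ys m → shrink (A.fun h (λ i → proj₁ (expand (m i))) ,
          B.trans (f.fun-hom h _) (B.fun-cong h λ i → proj₂ (expand (m i)))) }

    image-iso : Isomorphism A (B ↾ image)
    image-iso = record
      { embedding = corestrict f image λ x → shrink (x , B.refl)
      ; surjective = λ (y , m) → expand m }

-- Strong embeddings and Galois types in an AEC.

module AEC (Z : ZermeloLogic) {s c r k} {L : Signature s} (𝒦 : StructureClass L c r k) (isAEC : IsAEC 𝒦) where
  open StructureClass 𝒦
  open IsAEC isAEC
  open Embedding using (to)
  private
    variable
      A B C D : Structure L c r

  -- `Strong` is a predicate on embeddings taken with all their data; that only the values matter
  -- follows from closure under isomorphism, used with two identities.
  strong-resp : 𝕂 A → 𝕂 B → (f f′ : Embedding A B) →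
    (∀ x → Structure._≈_ B (to f′ x) (to f x)) → Strong f → Strong f′
  strong-resp {A} {B} kA kB f f′ p = strong-iso kA kB (idⁱ A) (idⁱ B) f f′ p

  iso-strong : 𝕂 A → (i : Isomorphism A B) → Strong (Isomorphism.embedding i)
  iso-strong {A} {B} kA i =
    strong-iso kA kA (idⁱ A) i (idᵉ A) (Isomorphism.embedding i) (λ _ → Structure.refl B) (strong-refl kA)

  module _ (amalgamate : AmalgamationProperty 𝒦) where
    private
      Sgt = SameGaloisType 𝒦

    sgt-strong : 𝕂 A → 𝕂 B → (f : Embedding A B) → Strong f →
      (u : Vector (Structure.Carrier A) n) → Sgt A B u (to f ∘ u)
    sgt-strong {A} {B} kA kB f sf u =
      B , kB , f , idᵉ B , sf , strong-refl kB , λ _ → Structure.refl B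

    sgt-sym : {u : Vector (Structure.Carrier A) n} {v : Vector (Structure.Carrier B) n} →
      Sgt A B u v → Sgt B A v u
    sgt-sym (C , kC , f , g , sf , sg , p) = C , kC , g , f , sg , sf , λ i → Structure.sym C (p i)

    sgt-resp : {u u′ : Vector (Structure.Carrier A) n} {v v′ : Vector (Structure.Carrier B) n} →
      Structure._≋_ A u u′ → Structure._≋_ B v v′ → Sgt A B u v → Sgt A B u′ v′
    sgt-resp {A} {B = B} p q (C , kC , f , g , sf , sg , e) = C , kC , f , g , sf , sg , λ i →
      Structure.trans C (Embedding.cong f (Structure.sym A (p i)))
        (Structure.trans C (e i) (Embedding.cong g (q i)))

    -- The two structures witnessing equality of types are amalgamated over the middle one.
    sgt-trans : 𝕂 A → 𝕂 B → 𝕂 D →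
      {u : Vector (Structure.Carrier A) n} {v : Vector (Structure.Carrier B) n}
      {w : Vector (Structure.Carrier D) n} → Sgt A B u v → Sgt B D v w → Sgt A D u w
    sgt-trans kA kB kD (C , kC , f , g , sf , sg , p) (C′ , kC′ , f′ , g′ , sf′ , sg′ , p′)
      with amalgamate kB kC kC′ g f′ sg sf′
    ... | E , kE , h , l , sh , sl , e = E , kE , h ∘ᵉ f , l ∘ᵉ g′ ,
      strong-trans kA kC kE h f sh sf , strong-trans kD kC′ kE l g′ sl sg′ , λ i →
      Structure.trans E (Embedding.cong h (p i)) (Structure.trans E (e _) (Embedding.cong l (p′ i)))

-- Countable sets.

module CountableSets (Z : ZermeloLogic) where
  open Cardinals Z

  ℕ-⊎ : (≡.setoid ℕ ⊎ₛ ≡.setoid ℕ) ≲ ≡.setoid ℕ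
  ℕ-⊎ = infinite-⊎ ≲-refl (square (≡.setoid ℕ) ≲-refl)

  ⊎-countable : {S : Setoid a ℓ₁} {T : Setoid b ℓ₂} →
    S ≲ ≡.setoid ℕ → T ≲ ≡.setoid ℕ → (S ⊎ₛ T) ≲ ≡.setoid ℕ
  ⊎-countable f g = (f ⊎-injection g) ⟫ ℕ-⊎

  Fin-countable : ≡.setoid (Fin n) ≲ ≡.setoid ℕ
  Fin-countable = record { to = toℕ ; cong = ≡.cong toℕ ; injective = Finₚ.toℕ-injective }

  module _ (S : Setoid a ℓ) where
    open Setoid S

    covered-≲ : {X : Pred Carrier p} {T : Setoid b ℓ₂} (f : Func T S) →
      (∀ x → X x → ∃[ t ] Func.to f t ≈ x) → restrict S X ≲ T
    covered-≲ {T = T} f onto = proj₁ (graph⇒≲ _ T (λ (x , _) t → Func.to f t ≈ x)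
      (λ p q e → trans (Func.cong f (Setoid.sym T q)) (trans e p))
      (λ (x , x∈) → onto x x∈) (λ e e′ → trans (sym e) e′))

    range-countable : {X : Pred Carrier p} (u : Vector Carrier n) →
      (∀ x → X x → ∃[ i ] x ≈ u i) → restrict S X ≲ ≡.setoid ℕ
    range-countable u X⊆u =
      covered-≲ {T = ≡.setoid (Fin _)} (record { to = u ; cong = λ { ≡.refl → refl } })
        (λ x x∈ → let i , e = X⊆u x x∈ in i , sym e)
      ⟫ Fin-countable

-- The monster model: extending embeddings and comparing Galois types.

module MonsterModel (Z : ZermeloLogic) {s c r k} {L : Signature s}
    (𝒦 : StructureClass L c r k) (𝕄 : Structure L c r) (Δ : Set c)
    (isAEC : IsAEC 𝒦) (isMonster : Monster.IsMonster 𝒦 𝕄 Δ) (ls : LöwenheimSkolem 𝒦 ℕ) where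
  open Classical Z
  open Cardinals Z
  open CountableSets Z
  open Images Z
  open StructureClass 𝒦
  open IsAEC isAEC
  open AEC Z 𝒦 isAEC
  open Monster 𝒦 𝕄 Δ
  open IsMonster isMonster
  open Structure 𝕄
  open Embedding using (to)
  open Model

  Aut : Set _
  Aut = Isomorphism 𝕄 𝕄

  countable⇒small : (A : Structure L c r) → Structure.setoid A ≲ ≡.setoid ℕ → Small A
  countable⇒small A A≲ℕ = A≲ℕ ⟫ proj₁ uncountable , λ Δ≲A → proj₂ uncountable (Δ≲A ⟫ A≲ℕ)

  small-resp : {A B : Structure L c r} → Isomorphism A B → Small A → Small B
  small-resp i (A≲Δ , Δ⋦A) = underlying-≲ (Isomorphism.embedding (symⁱ i)) ⟫ A≲Δ ,
    λ Δ≲B → Δ⋦A (Δ≲B ⟫ underlying-≲ (Isomorphism.embedding (symⁱ i)))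

  image-model : {A : Structure L c r} → 𝕂 A → Small A → (e : Embedding A 𝕄) → Strong e → Model
  image-model {A} kA small e se = record
    { sub = image e
    ; ∈𝕂 = 𝕂-iso (image-iso e) kA
    ; strong = strong-iso kA 𝕄∈𝕂 (image-iso e) (idⁱ 𝕄) e (inclusion (image e)) (λ _ → refl) se
    ; small = small-resp (image-iso e) small }

  -- Homogeneity is about isomorphisms between models inside 𝕄, and the image of `e` is such a
  -- model.
  extend : (A : Model) (e : Embedding (structure A) 𝕄) → Strong e →
    Σ[ σ ∈ Aut ] (∀ x → Isomorphism.to σ (proj₁ x) ≈ to e x)
  extend A e se = homogeneous A (image-model (∈𝕂 A) (small A) e se) (image-iso e)

  aut-strong : (σ : Aut) → Strong (Isomorphism.embedding σ)
  aut-strong = iso-strong 𝕄∈𝕂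

  _⟨_⟩ : Aut → Model → Model
  σ ⟨ A ⟩ = image-model (∈𝕂 A) (small A) (Isomorphism.embedding σ ∘ᵉ inclusion (sub A))
    (strong-trans (∈𝕂 A) 𝕄∈𝕂 𝕄∈𝕂 _ _ (aut-strong σ) (strong A))

  ⟨⟩-countable : ∀ σ A → Countable A → Countable (σ ⟨ A ⟩)
  ⟨⟩-countable σ A cA = underlying-≲ (Isomorphism.embedding (symⁱ (image-iso (Isomorphism.embedding σ ∘ᵉ inclusion (sub A))))) ⟫ cA

  countable-submodel : {A : Structure L c r} → 𝕂 A → {X : Pred (Structure.Carrier A) p} →
    restrict (Structure.setoid A) X ≲ ≡.setoid ℕ →
    Σ[ S ∈ Substructure A ] X ⊆ mem S × 𝕂 (A ↾ S) × Strong (inclusion S) ×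
      (Structure.setoid (A ↾ S) ≲ ≡.setoid ℕ)
  countable-submodel {A = A} kA {X} X≲ℕ with ls A kA (λ x → Resize c (X x))
  ... | S , X⊆S , kS , sS , S≲ = S , (λ x → X⊆S (shrink x)) , kS , sS ,
    (S≲ ⟫ ⊎-countable (restrict-mono (Structure.setoid A) expand ⟫ X≲ℕ) ≲-refl)

  module _ (amalgamate : AmalgamationProperty 𝒦) where

    -- A member of the class may be too large to embed into 𝕄, but a countable piece around `X` is
    -- small enough for universality.
    chart : {A : Structure L c r} → 𝕂 A → {X : Pred (Structure.Carrier A) p} →
      restrict (Structure.setoid A) X ≲ ≡.setoid ℕ →
      Σ[ S ∈ Substructure A ] X ⊆ mem S × 𝕂 (A ↾ S) × Strong (inclusion S) ×
        (Structure.setoid (A ↾ S) ≲ ≡.setoid ℕ) × Σ[ h ∈ Embedding (A ↾ S) 𝕄 ] Strong h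
    chart {A = A} kA X≲ℕ with countable-submodel kA X≲ℕ
    ... | S , X⊆S , kS , sS , S≲ = S , X⊆S , kS , sS , S≲ , universal kS (countable⇒small (A ↾ S) S≲)

    -- The structure `C` in which `u` and `v` are identified can be of any size. So a countable `S`
    -- around `u` and `v` is taken in 𝕄, and a countable `T` in `C` around both images of `S`. An
    -- embedding of `T` into 𝕄 turns the two maps on `S` into automorphisms `σ` and `τ` with `σ u` =
    -- `τ v`.
    sgt⇒≡ᵍ : {u v : Vector Carrier n} → SameGaloisType 𝒦 𝕄 𝕄 u v → u ≡ᵍ v over ∅
    sgt⇒≡ᵍ {u = u} {v} (C , kC , f , g , sf , sg , fu≋gv)
      with countable-submodel 𝕄∈𝕂 (range-countable setoid {X = range (u ++ v)} (u ++ v) λ _ x∈ → x∈)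
    ... | S , uv⊆S , kS , sS , S≲
      with chart kC {X = λ z → (∃[ x ] to f (proj₁ {B = mem S} x) C.≈ z) ⊎ (∃[ x ] to g (proj₁ {B = mem S} x) C.≈ z)}
        (covered-≲ C.setoid {T = restrict setoid (mem S) ⊎ₛ restrict setoid (mem S)}
          (record { to = λ { (inj₁ x) → to f (proj₁ x) ; (inj₂ x) → to g (proj₁ x) }
                  ; cong = λ { (inj₁ p) → Embedding.cong f p ; (inj₂ p) → Embedding.cong g p } })
          (λ { _ (inj₁ (x , e)) → inj₁ x , e ; _ (inj₂ (x , e)) → inj₂ x , e })
          ⟫ ⊎-countable S≲ S≲)
      where module C = Structure C
    ... | T , fg⊆T , kT , sT , T≲ , h , sh = (symⁱ τ ∘ⁱ σ) , (λ _ ()) , λ i →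
      trans (Isomorphism.cong (symⁱ τ) (trans (trans (σ-ext (u i , u∈ i)) (Embedding.cong h (fu≋gv i)))
        (sym (τ-ext (v i , v∈ i))))) (⁻¹-to τ (v i))
      where
      module C = Structure C
      u∈ : u inside mem S
      u∈ i = uv⊆S (i ↑ˡ _ , reflexive (≡.sym (++-left u v i)))
      v∈ : v inside mem S
      v∈ i = uv⊆S (_ ↑ʳ i , reflexive (≡.sym (++-right u v i)))
      piece : Model
      piece = record { sub = S ; ∈𝕂 = kS ; strong = sS ; small = countable⇒small (𝕄 ↾ S) S≲ }
      module _ (e : Embedding 𝕄 C) (se : Strong e) (e⊆T : ∀ (x : Σ Carrier (mem S)) → to e (proj₁ x) ∈ mem T) where
        part : Embedding (𝕄 ↾ S) (C ↾ T)
        part = corestrict (e ∘ᵉ inclusion S) T e⊆T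
        part-strong : Strong part
        -- The composite with the strong inclusion of `T` is a strong map into `C`.
        part-strong = coherence kS kT kC (inclusion T) part sT
          (strong-resp kS kC (e ∘ᵉ inclusion S) _ (λ _ → C.refl) (strong-trans kS 𝕄∈𝕂 kC e _ se sS))
        extension = extend piece (h ∘ᵉ part) (strong-trans kS kT 𝕄∈𝕂 h part sh part-strong)
      f∈ = λ x → fg⊆T (inj₁ (x , C.refl))
      g∈ = λ x → fg⊆T (inj₂ (x , C.refl))
      σ = proj₁ (extension f sf f∈)
      σ-ext = proj₂ (extension f sf f∈)
      τ = proj₁ (extension g sg g∈)
      τ-ext = proj₂ (extension g sg g∈)

-- Invariance of the relations in ℰ and lifting of strong embeddings.

module Lifting (Z : ZermeloLogic) {s c r k} {L : Signature s}
    (𝒦 : StructureClass L c r k) (𝕄 : Structure L c r) (Δ : Set c)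
    (fur : IsFURClass 𝒦 𝕄 Δ) (ℰ : Equivalences 𝒦 𝕄 Δ) where
  open CountableSets Z
  open StructureClass 𝒦
  module FUR = IsFURClass fur
  open AEC Z 𝒦 FUR.isAEC
  module 𝕄ₘ = MonsterModel Z 𝒦 𝕄 Δ FUR.isAEC FUR.isMonster FUR.LS≡ω
  open Monster.IsMonster FUR.isMonster using (𝕄∈𝕂)
  open Eq ℰ
  open Equivalences ℰ using (Index; relation)
  private
    module M = Structure 𝕄
    variable
      A B : Structure L c r

  module _ (e : Index) where
    open InvariantEquivalence (relation e)

    G-sgt : {u v : Vector M.Carrier (arity + arity)} → SameGaloisType 𝒦 𝕄 𝕄 u v → u ∈ G → v ∈ G
    G-sgt uv = invariant (𝕄ₘ.sgt⇒≡ᵍ FUR.ap uv)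

    G-resp : {u v : Vector M.Carrier (arity + arity)} → u M.≋ v → u ∈ G → v ∈ G
    G-resp p = invariant (idⁱ 𝕄 , (λ _ _ → M.refl) , p)

    -- A strong `h` realizes in 𝕄 the type of the concatenated tuple, and `G` is closed under
    -- equality of Galois types in 𝕄.
    related⇔E : 𝕂 A → (h : Embedding A 𝕄) → Strong h → ∀ a b →
      Related A e a b ⇔ E (Embedding.to h ∘ a) (Embedding.to h ∘ b)
    related⇔E kA h sh a b = mk⇔
      (λ (v , v∈G , ab~v) → G-resp (λ i → M.reflexive (++-map (Embedding.to h) a b i))
        (G-sgt (sgt-trans FUR.ap 𝕄∈𝕂 kA 𝕄∈𝕂 (sgt-sym FUR.ap ab~v)
          (sgt-strong FUR.ap kA 𝕄∈𝕂 h sh (a ++ b))) v∈G))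
      (λ E-ab → _ , G-resp (λ i → M.sym (M.reflexive (++-map (Embedding.to h) a b i))) E-ab ,
        sgt-strong FUR.ap kA 𝕄∈𝕂 h sh (a ++ b))

    related-strong : 𝕂 A → 𝕂 B → (f : Embedding A B) → Strong f → ∀ a b →
      Related A e a b ⇔ Related B e (Embedding.to f ∘ a) (Embedding.to f ∘ b)
    related-strong {A} {B} kA kB f sf a b = mk⇔
      (λ (v , v∈G , ab~v) → v , v∈G , sgt-resp FUR.ap f-ab (λ _ → M.refl)
        (sgt-trans FUR.ap kB kA 𝕄∈𝕂 (sgt-sym FUR.ap f~) ab~v))
      (λ (v , v∈G , ab~v) → v , v∈G , sgt-trans FUR.ap kA kB 𝕄∈𝕂 f~
        (sgt-resp FUR.ap (λ i → Structure.sym B (f-ab i)) (λ _ → M.refl) ab~v))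
      where
      f~ = sgt-strong FUR.ap kA kB f sf (a ++ b)
      f-ab = λ i → Structure.reflexive B (++-map (Embedding.to f) a b i)

    module _ (kA : 𝕂 A) where
      private
        module A = Structure A
        Tuple = Vector A.Carrier arity

      -- Three tuples of A lie in a countable piece of A that embeds into 𝕄, so
      -- Related inherits the laws of an equivalence relation from E.
      private
        module Triple (a b d : Tuple) where
          w = a ++ (b ++ d)
          R : Pred A.Carrier r
          R x = ∃[ i ] x A.≈ w i
          piece = 𝕄ₘ.chart FUR.ap kA (range-countable A.setoid {X = R} w λ _ x∈ → x∈)
          S = proj₁ piece
          R⊆S = proj₁ (proj₂ piece)
          kS = proj₁ (proj₂ (proj₂ piece))
          sS = proj₁ (proj₂ (proj₂ (proj₂ piece)))
          h = proj₁ (proj₂ (proj₂ (proj₂ (proj₂ (proj₂ piece)))))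
          sh = proj₂ (proj₂ (proj₂ (proj₂ (proj₂ (proj₂ piece)))))
          a′ b′ d′ : Vector (Structure.Carrier (A ↾ S)) arity
          a′ i = a i , R⊆S (i ↑ˡ _ , A.reflexive (≡.sym (++-left a _ i)))
          b′ i = b i , R⊆S (arity ↑ʳ (i ↑ˡ _) , A.reflexive (≡.sym
            (≡.trans (++-right a _ (i ↑ˡ _)) (++-left b d i))))
          d′ i = d i , R⊆S (arity ↑ʳ (arity ↑ʳ i) , A.reflexive (≡.sym
            (≡.trans (++-right a _ (arity ↑ʳ i)) (++-right b d i))))
          into : ∀ u v → Related A e (proj₁ ∘ u) (proj₁ ∘ v) →
            E (Embedding.to h ∘ u) (Embedding.to h ∘ v)
          into u v uv = Equivalence.to (related⇔E kS h sh u v)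
            (Equivalence.from (related-strong kS kA (inclusion S) sS u v) uv)
          back : ∀ u v → E (Embedding.to h ∘ u) (Embedding.to h ∘ v) →
            Related A e (proj₁ ∘ u) (proj₁ ∘ v)
          back u v uv = Equivalence.to (related-strong kS kA (inclusion S) sS u v)
            (Equivalence.from (related⇔E kS h sh u v) uv)

      related-isEquivalence : IsEquivalence (Related A e)
      related-isEquivalence = record
        { refl = λ {a} → let open Triple a a a in back a′ a′ (IsEquivalence.refl isEquivalence)
        ; sym = λ {a} {b} p → let open Triple a b b in
            back b′ a′ (IsEquivalence.sym isEquivalence (into a′ b′ p))
        ; trans = λ {a} {b} {d} p q → let open Triple a b d in
            back a′ d′ (IsEquivalence.trans isEquivalence (into a′ b′ p) (into b′ d′ q)) }

      related-resp : {a b d : Tuple} → b A.≋ d → Related A e a b → Related A e a d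
      related-resp {a} {b} {d} p (v , v∈G , q) = v , v∈G , sgt-resp FUR.ap
        (++-pointwise {R = A._≈_} {u = a} {v = b} {u′ = a} {v′ = d} (λ _ → A.refl) p) (λ _ → M.refl) q

      sameClass⇒related : ∀ {a b} → SameClass A e a b → Related A e a b
      sameClass⇒related = EqClosure.fold related-isEquivalence λ
        { (inj₁ p) → related-resp p (IsEquivalence.refl related-isEquivalence) ; (inj₂ q) → q }

  related⇒sameClass : ∀ {A e a b} → Related A e a b → SameClass A e a b
  related⇒sameClass p = EqClosure.return (inj₂ p)

  module _ {A B : Structure L c r} (kA : 𝕂 A) (kB : 𝕂 B) (g : Embedding A B) (sg : Strong g) where
    private
      module A = Structure A
      module B = Structure B
      module g = Embedding g

    liftElem : Elem A → Elem B
    liftElem (real x) = real (g.to x)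
    liftElem (class e a) = class e (g.to ∘ a)

    liftElem-cong : ∀ {u v} → _≈ᵉ_ A u v → _≈ᵉ_ B (liftElem u) (liftElem v)
    liftElem-cong (real≈ p) = real≈ (g.cong p)
    liftElem-cong (class≈ {e} {a} {b} p) = class≈ (EqClosure.gmap (g.to ∘_) (λ
      { (inj₁ q) → inj₁ (g.cong ∘ q)
      ; (inj₂ q) → inj₂ (Equivalence.to (related-strong e kA kB g sg _ _) q) }) p)

    liftElem-injective : ∀ {u v} → _≈ᵉ_ B (liftElem u) (liftElem v) → _≈ᵉ_ A u v
    liftElem-injective {real _} {real _} (real≈ p) = real≈ (g.injective p)
    liftElem-injective {class e a} {class _ b} (class≈ p) = class≈ (related⇒sameClass
      (Equivalence.from (related-strong e kA kB g sg a b) (sameClass⇒related e kB p)))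

    liftElem-quotient : ∀ e a → liftElem (quotient A e a) ≡ quotient B e (g.to ∘ a)
    liftElem-quotient nothing a = ≡.refl
    liftElem-quotient (just e) a = ≡.refl

    reals-lift : ∀ {n} (us : Vector (Elem A) n) →
      Pointwise B._≋_ (Maybe.map (g.to ∘_) (reals A us)) (reals B (liftElem ∘ us))
    reals-lift {zero} us = just λ ()
    reals-lift {suc n} us with us zero
    ... | class _ _ = nothing
    ... | real x with reals A (tail us) | reals B (liftElem ∘ tail us) | reals-lift (tail us)
    ...   | nothing | nothing | nothing = nothing
    ...   | just xs | just ys | just p = just λ { zero → B.refl ; (suc i) → p i }

    -- Lifting preserves and reflects being real. So either both sides apply the function to real
    -- tuples, or both take the first argument as default value.
    extend-lift : ∀ {n} {h : Vector A.Carrier n → Elem A} {h′ : Vector B.Carrier n → Elem B} →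
      (∀ {xs ys} → g.to ∘ xs B.≋ ys → _≈ᵉ_ B (liftElem (h xs)) (h′ ys)) →
      ∀ us → _≈ᵉ_ B (liftElem (extend A h us)) (extend B h′ (liftElem ∘ us))
    extend-lift {zero} h~h′ us = h~h′ λ ()
    extend-lift {suc n} h~h′ us with reals A us | reals B (liftElem ∘ us) | reals-lift us
    ... | just xs | just ys | just p = h~h′ p
    ... | nothing | nothing | nothing = ≈ᵉ-refl B

    _^ᵉ : Embedding (A ^eq) (B ^eq)
    _^ᵉ = record
      { to = liftElem
      ; cong = liftElem-cong
      ; injective = liftElem-injective
      ; rel-iff = λ
        { (inj₁ R) us → mk⇔
            (λ (xs , p , Rxs) → g.to ∘ xs , liftElem-cong ∘ p , Equivalence.to (g.rel-iff R xs) Rxs)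
            (λ (ys , p , Rys) → let xs = λ i → proj₁ (real-preimage (p i)) in
              xs , (λ i → proj₁ (proj₂ (real-preimage (p i)))) ,
              Equivalence.from (g.rel-iff R xs)
                (B.rel-resp R (λ i → B.sym (proj₂ (proj₂ (real-preimage (p i))))) Rys))
        ; (inj₂ e) us → mk⇔
            (λ (a , p) → g.to ∘ a ,
              ≡.subst (_≈ᵉ_ B (liftElem (us zero))) (liftElem-quotient e a) (liftElem-cong p))
            (λ (b , p) → quotient-preimage e (us zero) p) }
      ; fun-hom = λ
        { (inj₁ f) → extend-lift λ p → real≈ (B.trans (g.fun-hom f _) (B.fun-cong f p))
        ; (inj₂ e) → extend-lift λ {xs} p →
            ≡.subst (λ z → _≈ᵉ_ B z _) (≡.sym (liftElem-quotient e xs)) (quotient-cong B e p) } }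
      where
      real-preimage : ∀ {u y} → _≈ᵉ_ B (liftElem u) (real y) → ∃[ x ] _≈ᵉ_ A u (real x) × g.to x B.≈ y
      real-preimage {real x} (real≈ p) = x , ≈ᵉ-refl A , p
      quotient-preimage : ∀ e u {b} → _≈ᵉ_ B (liftElem u) (quotient B e b) → ∃[ a ] _≈ᵉ_ A u (quotient A e a)
      quotient-preimage nothing (real x) p = (λ _ → x) , ≈ᵉ-refl A
      quotient-preimage (just e) (class _ a) (class≈ _) = a , ≈ᵉ-refl A

  liftIso : {A B : Structure L c r} → 𝕂 A → 𝕂 B → Isomorphism A B → Isomorphism (A ^eq) (B ^eq)
  liftIso {A} {B} kA kB i = record
    { embedding = _^ᵉ kA kB (Isomorphism.embedding i) (iso-strong kA i)
    ; surjective = λ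
      { (real y) → real ((i ⁻¹) y) , real≈ (to-⁻¹ i y)
      ; (class e b) → class e ((i ⁻¹) ∘ b) , quotient-cong B (just e) (λ j → to-⁻¹ i (b j)) } }

-- The model underlying a member of 𝒦^eq.

module RealParts (Z : ZermeloLogic) {s c r k} {L : Signature s}
    (𝒦 : StructureClass L c r k) (𝕄 : Structure L c r) (Δ : Set c)
    (fur : IsFURClass 𝒦 𝕄 Δ) (ℰ : Equivalences 𝒦 𝕄 Δ) where
  open StructureClass 𝒦
  open Lifting Z 𝒦 𝕄 Δ fur ℰ public
  open IsAEC FUR.isAEC
  open Eq ℰ
  open StructureClass 𝒦ᵉ using () renaming (𝕂 to 𝕂ᵉ; Strong to Strongᵉ)
  private
    variable
      A B : Structure L c r
      N N′ : Structure Lᵉ c rᵉ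

  IsReal : (N : Structure Lᵉ c rᵉ) → Structure.Carrier N → Set rᵉ
  IsReal N u = Structure.rel N (inj₂ nothing) (λ _ → u)

  isReal-resp : (N : Structure Lᵉ c rᵉ) → ∀ {u v} → Structure._≈_ N u v → IsReal N u → IsReal N v
  isReal-resp N p = Structure.rel-resp N (inj₂ nothing) (λ _ → p)

  -- `B` is identified with the set of elements of `N` satisfying the predicate of the identity
  -- relation. This refers to `N` alone and not to a presentation of it as some `A ^eq`.
  record RealPart (B : Structure L c r) (N : Structure Lᵉ c rᵉ) : Set (s ⊔ c ⊔ rᵉ) where
    private
      module B = Structure B
      module N = Structure N
    field
      ρ         : B.Carrier → N.Carrier
      cong      : ∀ {x y} → x B.≈ y → ρ x N.≈ ρ y
      injective : ∀ {x y} → ρ x N.≈ ρ y → x B.≈ y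
      isReal    : ∀ x → IsReal N (ρ x)
      onto      : ∀ u → IsReal N u → ∃[ x ] ρ x N.≈ u
      rel-iff   : ∀ R xs → B.rel R xs ⇔ N.rel (inj₁ R) (ρ ∘ xs)
      fun-hom   : ∀ f xs → ρ (B.fun f xs) N.≈ N.fun (inj₁ f) (ρ ∘ xs)
  open RealPart public using (ρ)

  reals-real : ∀ (A : Structure L c r) {n} (xs : Vector (Structure.Carrier A) n) →
    Pointwise (Structure._≋_ A) (just xs) (reals A (real ∘ xs))
  reals-real A {zero} xs = just λ ()
  reals-real A {suc n} xs with reals A (real ∘ tail xs) | reals-real A (tail xs)
  ... | just ys | just p = just λ { zero → Structure.refl A ; (suc i) → p i }

  extend-real : ∀ (A : Structure L c r) {n} {h : Vector (Structure.Carrier A) n → Elem A} →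
    (∀ {xs ys} → Structure._≋_ A xs ys → _≈ᵉ_ A (h xs) (h ys)) →
    ∀ xs → _≈ᵉ_ A (h xs) (extend A h (real ∘ xs))
  extend-real A {zero} h-cong xs = h-cong λ ()
  extend-real A {suc n} {h} h-cong xs with reals A (real ∘ xs) | reals-real A xs
  ... | just ys | just p = h-cong p

  realPart : (A : Structure L c r) → RealPart A (A ^eq)
  realPart A = record
    { ρ = real
    ; cong = real≈
    ; injective = λ { (real≈ p) → p }
    ; isReal = λ x → (λ _ → x) , real≈ A.refl
    ; onto = λ { u (a , p) → a zero , ≈ᵉ-sym A p }
    ; rel-iff = λ R xs → mk⇔ (λ z → xs , (λ _ → real≈ A.refl) , z)
        (λ (ys , p , z) → A.rel-resp R (λ i → A.sym (real≈-inv (p i))) z)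
    ; fun-hom = λ f xs → extend-real A (λ p → real≈ (A.fun-cong f p)) xs }
    where
    module A = Structure A
    real≈-inv : ∀ {x y} → _≈ᵉ_ A (real x) (real y) → x A.≈ y
    real≈-inv (real≈ p) = p

  transport : RealPart A N → Isomorphism N N′ → RealPart A N′
  transport {N = N} {N′} P i = record
    { ρ = i.to ∘ P.ρ
    ; cong = i.cong ∘ P.cong
    ; injective = P.injective ∘ i.injective
    ; isReal = λ x → Equivalence.to (i.rel-iff _ _) (P.isReal x)
    ; onto = λ u u-real →
        let v , iv≈u = i.surjective u
            x , e = P.onto v (Equivalence.from (i.rel-iff _ _) (isReal-resp N′ (N′.sym iv≈u) u-real))
        in x , N′.trans (i.cong e) iv≈u
    ; rel-iff = λ R xs → mk⇔
        (λ z → Equivalence.to (i.rel-iff _ _) (Equivalence.to (P.rel-iff R xs) z))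
        (λ z → Equivalence.from (P.rel-iff R xs) (Equivalence.from (i.rel-iff _ _) z))
    ; fun-hom = λ f xs → N′.trans (i.cong (P.fun-hom f xs)) (i.fun-hom _ _) }
    where
    module N′ = Structure N′
    module i = Isomorphism i
    module P = RealPart P

  -- An embedding preserves the predicate of real elements, so it maps one real part into the other.
  restrictᵉ : (P : RealPart A N) (Q : RealPart B N′) (f : Embedding N N′) →
    Σ[ g ∈ Embedding A B ] (∀ x → Structure._≈_ N′ (Embedding.to f (ρ P x)) (ρ Q (Embedding.to g x)))
  restrictᵉ {A} {N} {B} {N′} P Q f = record
    { to = g
    ; cong = λ p → Q.injective (N′.trans (g≈ _) (N′.trans (f.cong (P.cong p)) (N′.sym (g≈ _))))
    ; injective = λ p → P.injective (f.injective
        (N′.trans (N′.sym (g≈ _)) (N′.trans (Q.cong p) (g≈ _))))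
    ; rel-iff = λ R xs → mk⇔
        (λ z → Equivalence.from (Q.rel-iff R _) (N′.rel-resp _ (λ _ → N′.sym (g≈ _))
          (Equivalence.to (f.rel-iff _ _) (Equivalence.to (P.rel-iff R xs) z))))
        (λ z → Equivalence.from (P.rel-iff R xs) (Equivalence.from (f.rel-iff _ _)
          (N′.rel-resp _ (λ _ → g≈ _) (Equivalence.to (Q.rel-iff R _) z))))
    ; fun-hom = λ h xs → Q.injective (N′.trans (g≈ _) (N′.trans (f.cong (P.fun-hom h xs))
        (N′.trans (f.fun-hom _ _) (N′.trans (N′.fun-cong _ (λ _ → N′.sym (g≈ _)))
          (N′.sym (Q.fun-hom h _)))))) } , λ x → N′.sym (g≈ x)
    where
    module N′ = Structure N′
    module f = Embedding f
    module P = RealPart P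
    module Q = RealPart Q
    preimage = λ x → Q.onto (f.to (P.ρ x)) (Equivalence.to (f.rel-iff _ _) (P.isReal x))
    g = λ x → proj₁ (preimage x)
    g≈ : ∀ x → Q.ρ (g x) N′.≈ f.to (P.ρ x)
    g≈ x = proj₂ (preimage x)

  restrictⁱ : (P : RealPart A N) (Q : RealPart B N′) (f : Isomorphism N N′) →
    Σ[ g ∈ Isomorphism A B ] (∀ x → Structure._≈_ N′ (Isomorphism.to f (ρ P x)) (ρ Q (Isomorphism.to g x)))
  restrictⁱ {N = N} {N′ = N′} P Q f = record
    { embedding = proj₁ restricted
    ; surjective = λ y →
        let u , fu≈ = Isomorphism.surjective f (ρ Q y)
            x , e = RealPart.onto P u (Equivalence.from (Isomorphism.rel-iff f _ _)
                      (isReal-resp N′ (Structure.sym N′ fu≈) (RealPart.isReal Q y)))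
        in x , RealPart.injective Q (Structure.trans N′ (Structure.sym N′ (proj₂ restricted x))
                 (Structure.trans N′ (Isomorphism.cong f e) fu≈)) } , proj₂ restricted
    where restricted = restrictᵉ P Q (Isomorphism.embedding f)

  -- The identity of `N` restricts to an isomorphism. Hence neither membership in 𝕂 nor strength
  -- depends on the real part chosen.
  realPart-unique : (P : RealPart A N) (Q : RealPart B N) →
    Σ[ i ∈ Isomorphism A B ] (∀ x → Structure._≈_ N (ρ P x) (ρ Q (Isomorphism.to i x)))
  realPart-unique {N = N} P Q = restrictⁱ P Q (idⁱ N)

  realPart∈𝕂 : 𝕂ᵉ N → RealPart B N → 𝕂 B
  realPart∈𝕂 (A , kA , i) Q = 𝕂-iso (proj₁ (realPart-unique (transport (realPart A) i) Q)) kA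

  module _ (N∈ : 𝕂ᵉ N) (Q : RealPart B N) where
    private
      i = proj₂ (proj₂ N∈)
      unique = realPart-unique (transport (realPart (proj₁ N∈)) i) Q
      j = proj₁ unique

    -- Membership in 𝒦^eq comes with a presentation of its own; this replaces it by one over any
    -- prescribed real part.
    present : Isomorphism (B ^eq) N
    present = i ∘ⁱ symⁱ (liftIso (proj₁ (proj₂ N∈)) (realPart∈𝕂 N∈ Q) j)

    present-real : ∀ x → Structure._≈_ N (Isomorphism.to present (real x)) (ρ Q x)
    present-real x = Structure.trans N (proj₂ unique ((j ⁻¹) x)) (RealPart.cong Q (to-⁻¹ j x))

  -- Strength in 𝒦^eq is witnessed between structures `A₀` and `B₀` that need not be the given ones;
  -- uniqueness of real parts carries the witness over.
  strongᵉ⇒strong : (f : Embedding N N′) → Strongᵉ f → (P : RealPart A N) (Q : RealPart B N′)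
    (g : Embedding A B) → (∀ x → Structure._≈_ N′ (Embedding.to f (ρ P x)) (ρ Q (Embedding.to g x))) →
    Strong g
  strongᵉ⇒strong {N} {N′} {A} {B} f (A₀ , B₀ , kA₀ , kB₀ , i , j , g₀ , sg₀ , e) P Q g e′
    with realPart-unique (transport (realPart A₀) i) P | realPart-unique (transport (realPart B₀) j) Q
  ... | i₀ , p | j₀ , q = strong-iso kA₀ kB₀ i₀ j₀ g₀ g
    (λ x → RealPart.injective Q (N′.trans (N′.sym (e′ _)) (N′.trans (Embedding.cong f (N.sym (p x)))
      (N′.trans (e x) (q _))))) sg₀
    where
    module N = Structure N
    module N′ = Structure N′

  strong⇒strongᵉ : ((A , kA , i) : 𝕂ᵉ N) ((B , kB , j) : 𝕂ᵉ N′) (f : Embedding N N′)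
    (g : Embedding A B) → Strong g →
    (∀ x → Structure._≈_ N′ (Embedding.to f (Isomorphism.to i (real x)))
                            (Isomorphism.to j (real (Embedding.to g x)))) → Strongᵉ f
  strong⇒strongᵉ (A , kA , i) (B , kB , j) f g sg e = A , B , kA , kB , i , j , g , sg , e

  module Presented (N∈ : 𝕂ᵉ N) where
    Real : Structure L c r
    Real = proj₁ N∈
    Real∈𝕂 : 𝕂 Real
    Real∈𝕂 = proj₁ (proj₂ N∈)
    iso : Isomorphism (Real ^eq) N
    iso = proj₂ (proj₂ N∈)
    part : RealPart Real N
    part = transport (realPart Real) iso

  strongᴿ : (N∈ : 𝕂ᵉ N) (N′∈ : 𝕂ᵉ N′) (f : Embedding N N′) → Strongᵉ f →
    (g : Embedding (Presented.Real N∈) (Presented.Real N′∈)) →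
    (∀ x → Structure._≈_ N′ (Embedding.to f (ρ (Presented.part N∈) x))
                            (ρ (Presented.part N′∈) (Embedding.to g x))) → Strong g
  strongᴿ N∈ N′∈ f sf = strongᵉ⇒strong f sf (Presented.part N∈) (Presented.part N′∈)

  𝕂ᵉ-^eq : 𝕂 A → 𝕂ᵉ (A ^eq)
  𝕂ᵉ-^eq {A} kA = A , kA , idⁱ (A ^eq)

  class≈fun : (A : Structure L c r) → ∀ e a →
    _≈ᵉ_ A (class e a) (Structure.fun (A ^eq) (inj₂ (just e)) (real ∘ a))
  class≈fun A e a = extend-real A (quotient-cong A (just e)) a

  -- `A ^eq` is generated by its real elements under the functions F_E, by `class≈fun`.
  embedding-determined : (i : Isomorphism (A ^eq) N) (f : Embedding (A ^eq) N′) (g : Embedding N N′) →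
    (∀ x → Structure._≈_ N′ (Embedding.to f (real x)) (Embedding.to g (Isomorphism.to i (real x)))) →
    ∀ u → Structure._≈_ N′ (Embedding.to f u) (Embedding.to g (Isomorphism.to i u))
  embedding-determined i f g p (real x) = p x
  embedding-determined {A} {N} {N′} i f g p (class e a) =
    N′.trans (f.cong (class≈fun A e a)) (N′.trans (f.fun-hom F (real ∘ a)) (N′.trans (N′.fun-cong F (p ∘ a))
      (N′.sym (N′.trans (g.cong (i.cong (class≈fun A e a)))
        (N′.trans (g.cong (i.fun-hom F (real ∘ a))) (g.fun-hom F _))))))
    where
    module N′ = Structure N′
    module f = Embedding f
    module g = Embedding g
    module i = Isomorphism i
    F = inj₂ (just e)

-- Unions of chains in 𝒦^eq.

module EqAEC (Z : ZermeloLogic) {s c r k} {L : Signature s}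
    (𝒦 : StructureClass L c r k) (𝕄 : Structure L c r) (Δ : Set c)
    (fur : IsFURClass 𝒦 𝕄 Δ) (ℰ : Equivalences 𝒦 𝕄 Δ) where
  open Classical Z
  open StructureClass 𝒦
  open RealParts Z 𝒦 𝕄 Δ fur ℰ public
  open IsAEC FUR.isAEC
  open Eq ℰ
  open StructureClass 𝒦ᵉ using () renaming (𝕂 to 𝕂ᵉ; Strong to Strongᵉ)
  private
    variable
      A B : Structure L c r
      N N′ N″ : Structure Lᵉ c rᵉ

  preimage : RealPart B N → Substructure N → Substructure B
  preimage {B} {N} P S = record
    { mem = λ x → mem S (ρ P x)
    ; resp = λ p → Substructure.resp S (RealPart.cong P p)
    ; closed = λ f xs xs∈ → Substructure.resp S (Structure.sym N (RealPart.fun-hom P f xs))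
        (Substructure.closed S (inj₁ f) _ xs∈) }

  restrict-part : (P : RealPart B N) (S : Substructure N) → RealPart (B ↾ preimage P S) (N ↾ S)
  restrict-part {N = N} P S = record
    { ρ = λ (x , x∈) → ρ P x , x∈
    ; cong = P.cong ; injective = P.injective
    ; isReal = λ (x , _) → P.isReal x
    ; onto = λ (u , u∈) u-real → let x , e = P.onto u u-real in
        (x , Substructure.resp S (Structure.sym N e) u∈) , e
    ; rel-iff = λ R xs → P.rel-iff R _ ; fun-hom = λ f xs → P.fun-hom f _ }
    where module P = RealPart P

  real-closed : RealPart A N → ∀ f us → (∀ i → IsReal N (us i)) → IsReal N (Structure.fun N (inj₁ f) us)
  real-closed {A} {N} P f us us-real = isReal-resp N
    (Structure.trans N (P.fun-hom f _) (Structure.fun-cong N _ λ i → proj₂ (P.onto (us i) (us-real i))))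
    (P.isReal (Structure.fun A f λ i → proj₁ (P.onto (us i) (us-real i))))
    where module P = RealPart P

  module _ (N : Structure Lᵉ c rᵉ)
           (closed : ∀ f us → (∀ i → IsReal N (us i)) → IsReal N (Structure.fun N (inj₁ f) us)) where
    private module N = Structure N

    -- The union of a chain has no presentation yet, so its real part is formed from the real
    -- elements themselves, resized to the levels of 𝒦.
    realStructure : Structure L c r
    realStructure = record
      { setoid = record
        { Carrier = Σ[ u ∈ N.Carrier ] Resize c (IsReal N u)
        ; _≈_ = λ (u , _) (v , _) → Resize r (u N.≈ v)
        ; isEquivalence = record
          { refl = shrink N.refl ; sym = λ p → shrink (N.sym (expand p))
          ; trans = λ p q → shrink (N.trans (expand p) (expand q)) } }
      ; rel = λ R xs → Resize r (N.rel (inj₁ R) (proj₁ ∘ xs))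
      ; rel-resp = λ R p z → shrink (N.rel-resp (inj₁ R) (λ i → expand (p i)) (expand z))
      ; fun = λ f xs → N.fun (inj₁ f) (proj₁ ∘ xs) , shrink (closed f _ (λ i → expand (proj₂ (xs i))))
      ; fun-cong = λ f p → shrink (N.fun-cong (inj₁ f) λ i → expand (p i)) }

    realStructure-part : RealPart realStructure N
    realStructure-part = record
      { ρ = proj₁ ; cong = expand ; injective = shrink
      ; isReal = λ (u , u-real) → expand u-real
      ; onto = λ u u-real → (u , shrink u-real) , N.refl
      ; rel-iff = λ R xs → mk⇔ expand shrink ; fun-hom = λ f xs → N.refl }

  module _ {X N : Structure Lᵉ c rᵉ} (f : Structure.Carrier X → Structure.Carrier N)
    (local : ∀ {n} (us : Vector (Structure.Carrier X) n) →
      Σ[ W ∈ Structure Lᵉ c rᵉ ] Σ[ l ∈ Embedding W X ] Σ[ h ∈ Embedding W N ]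
      (∀ w → Structure._≈_ N (f (Embedding.to l w)) (Embedding.to h w)) ×
      Σ[ ws ∈ Vector (Structure.Carrier W) n ] (∀ i → us i ≡ Embedding.to l (ws i))) where
    private
      module X = Structure X
      module N = Structure N

      module Local {n} (us : Vector X.Carrier n) where
        found = local us
        W = proj₁ found
        module W = Structure W
        module l = Embedding (proj₁ (proj₂ found))
        module h = Embedding (proj₁ (proj₂ (proj₂ found)))
        fl≈h = proj₁ (proj₂ (proj₂ (proj₂ found)))
        ws = proj₁ (proj₂ (proj₂ (proj₂ (proj₂ found))))
        us≡ : ∀ i → us i ≡ l.to (ws i)
        us≡ = proj₂ (proj₂ (proj₂ (proj₂ (proj₂ found))))
        f-us : ∀ i → f (us i) N.≈ h.to (ws i)
        f-us i = N.trans (N.reflexive (≡.cong f (us≡ i))) (fl≈h (ws i))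
        us≈ : ∀ i → us i X.≈ l.to (ws i)
        us≈ i = X.reflexive (us≡ i)

    -- Each condition on an embedding involves finitely many elements and can be checked in a `W`
    -- containing them. The entries are given as images under `l` up to propositional equality
    -- because `f` is not yet known to respect equality in `X`.
    locally-embedding : Embedding X N
    locally-embedding = record
      { to = f ; cong = f-cong ; injective = f-injective
      ; rel-iff = λ R us → let open Local us in mk⇔
          (λ z → N.rel-resp R (λ i → N.sym (f-us i)) (Equivalence.to (h.rel-iff R ws)
            (Equivalence.from (l.rel-iff R ws) (X.rel-resp R us≈ z))))
          (λ z → X.rel-resp R (λ i → X.sym (us≈ i)) (Equivalence.to (l.rel-iff R ws)
            (Equivalence.from (h.rel-iff R ws) (N.rel-resp R f-us z))))
      ; fun-hom = λ g us → let open Local us in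
          N.trans (f-cong (X.trans (X.fun-cong g us≈) (X.sym (l.fun-hom g ws))))
            (N.trans (fl≈h (W.fun g ws)) (N.trans (h.fun-hom g ws) (N.fun-cong g (λ i → N.sym (f-us i))))) }
      where
      f-cong : ∀ {u v} → u X.≈ v → f u N.≈ f v
      f-cong {u} {v} p = N.trans (f-us zero) (N.trans (h.cong (l.injective
          (X.trans (X.sym (us≈ zero)) (X.trans p (us≈ (suc zero))))))
        (N.sym (f-us (suc zero))))
        where open Local (u ∷ v ∷ [])
      f-injective : ∀ {u v} → f u N.≈ f v → u X.≈ v
      f-injective {u} {v} p = X.trans (us≈ zero) (X.trans (l.cong (h.injective
          (N.trans (N.sym (f-us zero)) (N.trans p (f-us (suc zero))))))
        (X.sym (us≈ (suc zero))))
        where open Local (u ∷ v ∷ [])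

  module Chain {I : Set c} (_<_ : Rel I c) (sto : IsStrictTotalOrder _≡_ _<_) (i₀ : I)
    (U : Structure Lᵉ c rᵉ) (S : I → Substructure U)
    (cover : ∀ x → ∃[ i ] x ∈ mem (S i)) (S∈𝕂ᵉ : ∀ i → 𝕂ᵉ (U ↾ S i))
    (S-mono : ∀ {i j} → i < j → mem (S i) ⊆ mem (S j)) where
    private module U = Structure U

    join : ∀ i j → ∃[ l ] mem (S i) ⊆ mem (S l) × mem (S j) ⊆ mem (S l)
    join i j with IsStrictTotalOrder.compare sto i j
    ... | tri< i<j _ _ = j , S-mono i<j , id
    ... | tri≈ _ ≡.refl _ = i , id , id
    ... | tri> _ _ j<i = i , id , S-mono j<i

    bound : ∀ {n} (i : Fin n → I) → ∃[ l ] (∀ j → mem (S (i j)) ⊆ mem (S l))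
    bound {zero} i = i₀ , λ ()
    bound {suc n} i with bound (i ∘ suc)
    ... | l , p with join (i zero) l
    ...   | l′ , q , q′ = l′ , λ { zero → q ; (suc j) x∈ → q′ (p j x∈) }

    common : ∀ {n} (us : Vector U.Carrier n) → ∃[ l ] (∀ j → us j ∈ mem (S l))
    common us with bound (λ j → proj₁ (cover (us j)))
    ... | l , p = l , λ j → p j (proj₂ (cover (us j)))

    closed : ∀ f us → (∀ i → IsReal U (us i)) → IsReal U (U.fun (inj₁ f) us)
    closed f us us-real = let l , us∈ = common us in
      real-closed (Presented.part (S∈𝕂ᵉ l)) f (λ j → us j , us∈ j) us-real

    R = realStructure U closed
    P = realStructure-part U closed
    module R = Structure R

    T : I → Substructure R
    T i = preimage P (S i)

    T-mono : ∀ {i j} → i < j → mem (T i) ⊆ mem (T j)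
    T-mono i<j x∈ = S-mono i<j x∈

    partᵢ : ∀ i → RealPart (R ↾ T i) (U ↾ S i)
    partᵢ i = restrict-part P (S i)

    T∈𝕂 : ∀ i → 𝕂 (R ↾ T i)
    T∈𝕂 i = realPart∈𝕂 (S∈𝕂ᵉ i) (partᵢ i)

    module _ (strong-mono : ∀ {i j} (i<j : i < j) → Strongᵉ (inclusion₂ (S i) (S j) (S-mono i<j)))
             (wf : WellFounded _<_) where

      R-chain = chain _<_ sto wf i₀ R T (λ (u , _) → cover u) T∈𝕂 (λ i<j {x} → T-mono i<j {x})
        (λ {i} {j} i<j → strongᵉ⇒strong (inclusion₂ (S i) (S j) (S-mono i<j)) (strong-mono i<j)
          (partᵢ i) (partᵢ j) (inclusion₂ (T i) (T j) (λ {x} → T-mono i<j {x})) (λ _ → U.refl))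
      R∈𝕂 = proj₁ R-chain
      T-strong = proj₁ (proj₂ R-chain)

      -- `U` already interprets F_E, which dictates where a class has to go.
      reify : Elem R → U.Carrier
      reify (real x) = ρ P x
      reify (class e a) = U.fun (inj₂ (just e)) (ρ P ∘ a)

      liftᵢ : ∀ i → Embedding ((R ↾ T i) ^eq) (R ^eq)
      liftᵢ i = _^ᵉ (T∈𝕂 i) R∈𝕂 (inclusion (T i)) (T-strong i)

      reify-local : ∀ i w →
        reify (Embedding.to (liftᵢ i) w) U.≈ proj₁ (Isomorphism.to (present (S∈𝕂ᵉ i) (partᵢ i)) w)
      reify-local i (real x) = U.sym (present-real (S∈𝕂ᵉ i) (partᵢ i) x)
      reify-local i (class e a) = U.sym (U.trans (h.cong (class≈fun (R ↾ T i) e a))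
        (U.trans (h.fun-hom (inj₂ (just e)) (real ∘ a))
          (U.fun-cong (inj₂ (just e)) (λ j → present-real (S∈𝕂ᵉ i) (partᵢ i) (a j)))))
        where module h = Isomorphism (present (S∈𝕂ᵉ i) (partᵢ i))

      -- An element of `R ^eq` has finitely many coordinates and so comes from some stage. The
      -- statement covers all larger stages, so that finitely many elements can share one.
      lower-elem : ∀ u → ∃[ i ] (∀ {l} → mem (S i) ⊆ mem (S l) → ∃[ w ] u ≡ Embedding.to (liftᵢ l) w)
      lower-elem (real x) = let i , x∈ = cover (ρ P x) in i , λ q → real (x , q x∈) , ≡.refl
      lower-elem (class e a) = let i , a∈ = common (ρ P ∘ a) in
        i , λ q → class e (λ j → a j , q (a∈ j)) , ≡.refl

      reifyᵉ : Embedding (R ^eq) U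
      reifyᵉ = locally-embedding reify λ us →
        let l , p = bound (λ j → proj₁ (lower-elem (us j))) in
        _ , liftᵢ l , inclusion (S l) ∘ᵉ Isomorphism.embedding (present (S∈𝕂ᵉ l) (partᵢ l)) , reify-local l ,
        (λ j → proj₁ (proj₂ (lower-elem (us j)) (p j))) , λ j → proj₂ (proj₂ (lower-elem (us j)) (p j))

      reifyⁱ : Isomorphism (R ^eq) U
      reifyⁱ = record
        { embedding = reifyᵉ
        ; surjective = λ y → let i , y∈ = cover y
                                 w , e = Isomorphism.surjective (present (S∈𝕂ᵉ i) (partᵢ i)) (y , y∈) in
            Embedding.to (liftᵢ i) w , U.trans (reify-local i w) e }

      chainᵉ : 𝕂ᵉ U × (∀ i → Strongᵉ (inclusion (S i))) ×
        (∀ {N} → 𝕂ᵉ N → (h : Embedding U N) → (∀ i → Strongᵉ (h ∘ᵉ inclusion (S i))) → Strongᵉ h)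
      chainᵉ = U∈ ,
        (λ i → strong⇒strongᵉ (R ↾ T i , T∈𝕂 i , present (S∈𝕂ᵉ i) (partᵢ i)) U∈ (inclusion (S i)) (inclusion (T i))
          (T-strong i) (present-real (S∈𝕂ᵉ i) (partᵢ i))) ,
        λ N∈ h h-strong →
          let g , e = restrictᵉ P (Presented.part N∈) h in
          strong⇒strongᵉ U∈ N∈ h g
            (proj₂ (proj₂ R-chain) (Presented.Real∈𝕂 N∈) g λ i →
              strongᵉ⇒strong (h ∘ᵉ inclusion (S i)) (h-strong i) (partᵢ i) (Presented.part N∈)
                (g ∘ᵉ inclusion (T i)) (λ x → e (proj₁ x))) e
        where U∈ = R , R∈𝕂 , reifyⁱ

-- Löwenheim-Skolem, amalgamation and the remaining class axioms for 𝒦^eq.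

module EqAxioms (Z : ZermeloLogic) {s c r k} {L : Signature s}
    (𝒦 : StructureClass L c r k) (𝕄 : Structure L c r) (Δ : Set c)
    (fur : IsFURClass 𝒦 𝕄 Δ) (ℰ : Equivalences 𝒦 𝕄 Δ) where
  open Classical Z
  open Cardinals Z
  open Images Z
  open StructureClass 𝒦
  open EqAEC Z 𝒦 𝕄 Δ fur ℰ public
  open IsAEC FUR.isAEC
  open Eq ℰ
  open StructureClass 𝒦ᵉ using () renaming (𝕂 to 𝕂ᵉ; Strong to Strongᵉ)
  private
    variable
      A B : Structure L c r
      N N′ N″ : Structure Lᵉ c rᵉ

  𝕂-infinite : 𝕂 A → Infinite (Structure.setoid A)
  𝕂-infinite {A} kA = no-finite⇒infinite (Structure.setoid A) (FUR.infinite kA)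

  module Hull (kA : 𝕂 A) (i : Isomorphism (A ^eq) N)
              (S : Substructure A) (kS : 𝕂 (A ↾ S)) (sS : Strong (inclusion S)) where

    hull-embedding : Embedding ((A ↾ S) ^eq) N
    hull-embedding = Isomorphism.embedding i ∘ᵉ _^ᵉ kS kA (inclusion S) sS

    hull : Substructure N
    hull = image hull-embedding

    hull-iso : Isomorphism ((A ↾ S) ^eq) (N ↾ hull)
    hull-iso = image-iso hull-embedding

    hull∈𝕂ᵉ : 𝕂ᵉ (N ↾ hull)
    hull∈𝕂ᵉ = A ↾ S , kS , hull-iso

    hull-strong : Strongᵉ (inclusion hull)
    hull-strong = strong⇒strongᵉ hull∈𝕂ᵉ (A , kA , i) (inclusion hull) (inclusion S) sS (λ _ → Structure.refl N)

  module _ (A : Structure L c r) where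
    private module A = Structure A

    -- Positions are natural numbers and not elements of a `Fin`, so that the coordinates of all
    -- elements of a set X are counted together by X × ℕ.
    data At : Elem A → ℕ → A.Carrier → Set (c ⊔ r) where
      real  : ∀ {x y} → y A.≈ x → At (real x) 0 y
      class : ∀ {e a y} i → y A.≈ a i → At (class e a) (toℕ i) y

    at-resp : ∀ {u l y y′} → y A.≈ y′ → At u l y → At u l y′
    at-resp p (real q) = real (A.trans (A.sym p) q)
    at-resp p (class i q) = class i (A.trans (A.sym p) q)

    at-unique : ∀ {u l y y′} → At u l y → At u l y′ → y A.≈ y′
    at-unique (real p) (real q) = A.trans p (A.sym q)
    at-unique {class e a} (class i p) q = go q ≡.refl
      where
      go : ∀ {l y′} → At (class e a) l y′ → l ≡ toℕ i → _ A.≈ y′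
      go (class j q) l≡ = A.trans p (A.trans (A.reflexive (≡.cong a (≡.sym (Finₚ.toℕ-injective l≡)))) (A.sym q))

    from-parts : (S : Substructure A) (u : Elem A) → (∀ l y → At u l y → y ∈ mem S) →
      (kS : 𝕂 (A ↾ S)) (kA : 𝕂 A) (sS : Strong (inclusion S)) →
      ∃[ w ] liftElem kS kA (inclusion S) sS w ≡ u
    from-parts S (real x) p kS kA sS = real (x , p 0 x (real A.refl)) , ≡.refl
    from-parts S (class e a) p kS kA sS = class e (λ i → a i , p (toℕ i) (a i) (class i A.refl)) , ≡.refl

  module LS {N : Structure Lᵉ c rᵉ} {A : Structure L c r} (kA : 𝕂 A) (i : Isomorphism (A ^eq) N)
            (X : Pred (Structure.Carrier N) c) where
    private
      module A = Structure A
      module N = Structure N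
      module i = Isomorphism i
      rep = representatives (setoidᵉ A)

      -- One representative is fixed for each element of `N`. Taking the coordinates of these alone
      -- keeps their number below |X| · ω, while the coordinates of all representatives could be far
      -- too many.
      u : N.Carrier → Elem A
      u x = Func.to (proj₁ rep) ((i ⁻¹) x)

      i-u : ∀ x → i.to (u x) N.≈ x
      i-u x = N.trans (i.cong (≈ᵉ-sym A (proj₂ rep ((i ⁻¹) x)))) (to-⁻¹ i x)

      u-cong : ∀ {x y} → x N.≈ y → u x ≡ u y
      u-cong p = Func.cong (proj₁ rep) (Isomorphism.cong (symⁱ i) p)

      parts : Pred A.Carrier c
      parts y = Resize c (∃[ x ] X x × ∃[ l ] At A (u x) l y)

      κ = restrict N.setoid X ⊎ₛ ≡.setoid ℕ

      κ-infinite : Infinite κ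
      κ-infinite = record { to = inj₂ ; cong = inj₂ ; injective = λ { (inj₂ p) → p } }

      κ-square = square κ κ-infinite

      parts-≲ : restrict A.setoid parts ≲ κ
      parts-≲ = proj₁ (graph⇒≲ (restrict A.setoid parts) (restrict N.setoid X ×ₛ ≡.setoid ℕ)
          (λ (y , _) ((x , _) , l) → At A (u x) l y)
          (λ { p (q , ≡.refl) z → ≡.subst (λ v → At A v _ _) (u-cong q) (at-resp A p z) })
          (λ (y , y∈) → let x , x∈ , l , z = expand y∈ in ((x , x∈) , l) , z)
          (at-unique A))
        ⟫ (record { to = inj₁ ; cong = inj₁ ; injective = λ { (inj₁ p) → p } } ×-injection κ-infinite)
        ⟫ κ-square

      submodel = FUR.LS≡ω A kA parts
      S = proj₁ submodel
      parts⊆S = proj₁ (proj₂ submodel)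
      kS = proj₁ (proj₂ (proj₂ submodel))
      sS = proj₁ (proj₂ (proj₂ (proj₂ submodel)))
      S≲ = proj₂ (proj₂ (proj₂ (proj₂ submodel)))
      open Hull kA i S kS sS

    result : Σ[ S ∈ Substructure N ] X ⊆ mem S × 𝕂ᵉ (N ↾ S) × Strongᵉ (inclusion S) ×
      (Structure.setoid (N ↾ S) ≲ κ)
    result = hull ,
      (λ {x} x∈ →
        let w , e = from-parts A S (u x) (λ l y z → parts⊆S (shrink (x , x∈ , l , z))) kS kA sS in
        shrink (w , N.trans (N.reflexive (≡.cong i.to e)) (i-u x))) ,
      hull∈𝕂ᵉ , hull-strong ,
      (underlying-≲ (Isomorphism.embedding (symⁱ hull-iso)) ⟫
       eq-cardinal ℰ (A ↾ S) κ-infinite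
         (S≲ ⟫ (parts-≲ ⊎-injection κ-infinite) ⟫ infinite-⊎ κ-infinite κ-square))

  lsᵉ : LöwenheimSkolem 𝒦ᵉ ℕ
  lsᵉ N (A , kA , i) X = LS.result kA i X

  strong-transᵉ : 𝕂ᵉ N → 𝕂ᵉ N′ → 𝕂ᵉ N″ → (g : Embedding N′ N″) (f : Embedding N N′) →
    Strongᵉ g → Strongᵉ f → Strongᵉ (g ∘ᵉ f)
  strong-transᵉ {N″ = N″} N∈ N′∈ N″∈ g f sg sf =
    let rf , f≈ = restrictᵉ (Presented.part N∈) (Presented.part N′∈) f
        rg , g≈ = restrictᵉ (Presented.part N′∈) (Presented.part N″∈) g in
    strong⇒strongᵉ N∈ N″∈ (g ∘ᵉ f) (rg ∘ᵉ rf)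
      (strong-trans (Presented.Real∈𝕂 N∈) (Presented.Real∈𝕂 N′∈) (Presented.Real∈𝕂 N″∈) rg rf
        (strongᴿ N′∈ N″∈ g sg rg g≈) (strongᴿ N∈ N′∈ f sf rf f≈))
      (λ x → Structure.trans N″ (Embedding.cong g (f≈ x)) (g≈ _))

  coherenceᵉ : 𝕂ᵉ N → 𝕂ᵉ N′ → 𝕂ᵉ N″ → (g : Embedding N′ N″) (f : Embedding N N′) →
    Strongᵉ g → Strongᵉ (g ∘ᵉ f) → Strongᵉ f
  coherenceᵉ {N″ = N″} N∈ N′∈ N″∈ g f sg sgf =
    let rf , f≈ = restrictᵉ (Presented.part N∈) (Presented.part N′∈) f
        rg , g≈ = restrictᵉ (Presented.part N′∈) (Presented.part N″∈) g in
    strong⇒strongᵉ N∈ N′∈ f rf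
      (coherence (Presented.Real∈𝕂 N∈) (Presented.Real∈𝕂 N′∈) (Presented.Real∈𝕂 N″∈) rg rf
        (strongᴿ N′∈ N″∈ g sg rg g≈)
        (strongᴿ N∈ N″∈ (g ∘ᵉ f) sgf (rg ∘ᵉ rf)
          (λ x → Structure.trans N″ (Embedding.cong g (f≈ x)) (g≈ _)))) f≈

  isAECᵉ : IsAEC 𝒦ᵉ
  isAECᵉ = record
    { 𝕂-iso = λ i (A , kA , j) → A , kA , i ∘ⁱ j
    ; strong-iso = λ {_} {_} {_} {B′} _ _ i j f f′ f′i≈jf (A₀ , B₀ , kA₀ , kB₀ , i₀ , j₀ , g , sg , e) →
        A₀ , B₀ , kA₀ , kB₀ , i ∘ⁱ i₀ , j ∘ⁱ j₀ , g , sg ,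
        λ x → Structure.trans B′ (f′i≈jf _) (Isomorphism.cong j (e x))
    ; strong-refl = λ {N} (A , kA , i) →
        strong⇒strongᵉ (A , kA , i) (A , kA , i) (idᵉ N) (idᵉ A) (strong-refl kA) (λ _ → Structure.refl N)
    ; strong-trans = strong-transᵉ
    ; coherence = coherenceᵉ
    ; chain = λ _<_ sto wf i₀ U S cover S∈ S-mono strong-mono →
        Chain.chainᵉ _<_ sto i₀ U S cover S∈ S-mono strong-mono wf
    ; löwenheim-skolem = Lift c ℕ , λ A kA X →
        let S , X⊆S , kS , sS , S≲ = lsᵉ A kA X in
        S , X⊆S , kS , sS , S≲ ⟫ (≲-refl ⊎-injection
          record { to = lift ; cong = ≡.cong lift ; injective = ≡.cong lower }) }

  module _ {D : Structure L c r} (kD : 𝕂 D) (N∈ : 𝕂ᵉ N)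
           (h : Embedding (Presented.Real N∈) D) (sh : Strong h) where
    open Presented N∈

    into-^eq : Embedding N (D ^eq)
    into-^eq = _^ᵉ Real∈𝕂 kD h sh ∘ᵉ Isomorphism.embedding (symⁱ iso)

    into-^eq-real : ∀ x → _≈ᵉ_ D (Embedding.to into-^eq (Isomorphism.to iso (real x))) (real (Embedding.to h x))
    into-^eq-real x = Embedding.cong (_^ᵉ Real∈𝕂 kD h sh) (⁻¹-to iso (real x))

    into-^eq-strong : Strongᵉ into-^eq
    into-^eq-strong = strong⇒strongᵉ N∈ (𝕂ᵉ-^eq kD) into-^eq h sh into-^eq-real

  apᵉ : AmalgamationProperty 𝒦ᵉ
  apᵉ {N} {N₁} {N₂} N∈ N₁∈ N₂∈ f g sf sg
    with restrictᵉ (Presented.part N∈) (Presented.part N₁∈) f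
       | restrictᵉ (Presented.part N∈) (Presented.part N₂∈) g
  ... | rf , f≈ | rg , g≈
    with FUR.ap (Presented.Real∈𝕂 N∈) (Presented.Real∈𝕂 N₁∈) (Presented.Real∈𝕂 N₂∈) rf rg
           (strongᴿ N∈ N₁∈ f sf rf f≈) (strongᴿ N∈ N₂∈ g sg rg g≈)
  ... | D , kD , h , l , sh , sl , hf≈lg =
    D ^eq , 𝕂ᵉ-^eq kD , hᵉ , lᵉ ,
    into-^eq-strong kD N₁∈ h sh , into-^eq-strong kD N₂∈ l sl , λ x →
      D.trans (Embedding.cong (hᵉ ∘ᵉ f) (N.sym (to-⁻¹ iso x)))
        -- Amalgamation in 𝒦 gives agreement on real elements, which generate the copy `N`.
        (D.trans (embedding-determined iso (hᵉ ∘ᵉ f ∘ᵉ Isomorphism.embedding iso) (lᵉ ∘ᵉ g)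
            (λ y → D.trans (Embedding.cong hᵉ (f≈ y)) (D.trans (into-^eq-real kD N₁∈ h sh _)
              (D.trans (real≈ (hf≈lg y)) (D.sym (D.trans (Embedding.cong lᵉ (g≈ y))
                (into-^eq-real kD N₂∈ l sl _)))))) ((iso ⁻¹) x))
          (Embedding.cong (lᵉ ∘ᵉ g) (to-⁻¹ iso x)))
    where
    open Presented N∈ using (iso)
    module N = Structure N
    module D = Structure (D ^eq)
    hᵉ = into-^eq kD N₁∈ h sh
    lᵉ = into-^eq kD N₂∈ l sl

  jepᵉ : JointEmbeddingProperty 𝒦ᵉ
  jepᵉ N∈ N′∈ with FUR.jep (Presented.Real∈𝕂 N∈) (Presented.Real∈𝕂 N′∈)
  ... | D , kD , h , l , sh , sl =
    D ^eq , 𝕂ᵉ-^eq kD , into-^eq kD N∈ h sh , into-^eq kD N′∈ l sl ,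
    into-^eq-strong kD N∈ h sh , into-^eq-strong kD N′∈ l sl

  real-≲ : (A : Structure L c r) → Structure.setoid A ≲ Structure.setoid (A ^eq)
  real-≲ A = record { to = real ; cong = real≈ ; injective = λ { (real≈ p) → p } }

  real-part-≲ : (N∈ : 𝕂ᵉ N) → Structure.setoid (Presented.Real N∈) ≲ Structure.setoid N
  real-part-≲ N∈ = real-≲ _ ⟫ underlying-≲ (Isomorphism.embedding (Presented.iso N∈))

  largeᵉ : ArbitrarilyLarge 𝒦ᵉ
  largeᵉ X = let A , kA , X≲A = FUR.large X in A ^eq , 𝕂ᵉ-^eq kA , X≲A ⟫ real-≲ A

  infiniteᵉ : NoFiniteModels 𝒦ᵉ
  infiniteᵉ N∈ n N≲n = FUR.infinite (Presented.Real∈𝕂 N∈) n (real-part-≲ N∈ ⟫ N≲n)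

-- Models and automorphisms of 𝕄^eq.

module EqMonster (Z : ZermeloLogic) {s c r k} {L : Signature s}
    (𝒦 : StructureClass L c r k) (𝕄 : Structure L c r) (Δ : Set c)
    (fur : IsFURClass 𝒦 𝕄 Δ) (ℰ : Equivalences 𝒦 𝕄 Δ) where
  open Classical Z
  open Cardinals Z
  open EqAxioms Z 𝒦 𝕄 Δ fur ℰ public
  open Eq ℰ
  module Mon = Monster 𝒦 𝕄 Δ
  module Monᵉ = Monster 𝒦ᵉ 𝕄ᵉ Δ
  module 𝕄 = Structure 𝕄
  module 𝕄ᵉ = Structure 𝕄ᵉ
  open Mon using (Model) public
  open Monᵉ using () renaming (Model to Modelᵉ) public
  open Mon.Model
  open Monᵉ.Model using () renaming (sub to subᵉ; ∈𝕂 to ∈𝕂ᵉ; strong to strongᵉ; small to smallᵉ; structure to structureᵉ; ∣_∣ to ∥_∥)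
  open Mon.IsMonster FUR.isMonster
  open 𝕄ₘ using (Aut; aut-strong)

  realPart-≲ : {B : Structure L c r} {N : Structure Lᵉ c rᵉ} → RealPart B N →
    Structure.setoid B ≲ Structure.setoid N
  realPart-≲ P = record
    { to = ρ P ; cong = λ {x} {y} → RealPart.cong P {x} {y} ; injective = λ {x} {y} → RealPart.injective P {x} {y} }

  part : (N : Modelᵉ) → RealPart (𝕄 ↾ preimage (realPart 𝕄) (subᵉ N)) (structureᵉ N)
  part N = restrict-part (realPart 𝕄) (subᵉ N)

  realModel : Modelᵉ → Model
  realModel N = record
    { sub = preimage (realPart 𝕄) (subᵉ N)
    ; ∈𝕂 = realPart∈𝕂 (∈𝕂ᵉ N) (part N)
    ; strong = strongᵉ⇒strong (inclusion (subᵉ N)) (strongᵉ N) (part N) (realPart 𝕄)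
        (inclusion (preimage (realPart 𝕄) (subᵉ N))) (λ _ → 𝕄ᵉ.refl)
    ; small = realPart-≲ (part N) ⟫ proj₁ (smallᵉ N) , λ Δ≲ → proj₂ (smallᵉ N) (Δ≲ ⟫ realPart-≲ (part N)) }

  realModel-countable : ∀ N → Monᵉ.Countable N → Mon.Countable (realModel N)
  realModel-countable N cN = realPart-≲ (part N) ⟫ cN

  module EqModel (A : Model) where
    open Hull 𝕄∈𝕂 (idⁱ 𝕄ᵉ) (sub A) (∈𝕂 A) (strong A)

    eqModel-≲ : {κ : Setoid a ℓ} → Infinite κ → Structure.setoid (structure A) ≲ κ →
      Structure.setoid (𝕄ᵉ ↾ hull) ≲ κ
    eqModel-≲ inf A≲κ = underlying-≲ (Isomorphism.embedding (symⁱ hull-iso)) ⟫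
      eq-cardinal ℰ (structure A) inf A≲κ

    eqModel : Modelᵉ
    eqModel = record
      { sub = hull ; ∈𝕂 = hull∈𝕂ᵉ ; strong = hull-strong
      -- Models are infinite, so passing to the eq-structure does not raise the cardinality.
      ; small = eqModel-≲ (𝕂-infinite (∈𝕂 A)) ≲-refl ⟫ proj₁ (small A) ,
          λ Δ≲ → proj₂ (small A) (Δ≲ ⟫ eqModel-≲ (𝕂-infinite (∈𝕂 A)) ≲-refl) }

    eqModel-countable : Mon.Countable A → Monᵉ.Countable eqModel
    eqModel-countable = eqModel-≲ ≲-refl
  open EqModel public using (eqModel; eqModel-countable)

  parts : Elem 𝕄 → ∃ (Vector 𝕄.Carrier)
  parts (real x)    = 1 , λ _ → x
  parts (class e a) = _ , a

  -- Only some representative of `u` is asked to have its entries in `P`; other representatives of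
  -- the same class may lie elsewhere.
  Over : Pred 𝕄.Carrier p → Pred (Elem 𝕄) (p ⊔ c ⊔ rᵉ)
  Over P u = ∃[ v ] v 𝕄ᵉ.≈ u × (∀ i → P (proj₂ (parts v) i))

  over-resp : {P : Pred 𝕄.Carrier p} → ∀ {u u′} → u 𝕄ᵉ.≈ u′ → Over P u → Over P u′
  over-resp p (v , q , P-v) = v , 𝕄ᵉ.trans q p , P-v

  over-real : {P : Pred 𝕄.Carrier p} → ∀ {x} → P x → Over P (real x)
  over-real {x = x} Px = real x , 𝕄ᵉ.refl , λ _ → Px

  real≈⁻¹ : ∀ {x y} → real x 𝕄ᵉ.≈ real y → x 𝕄.≈ y
  real≈⁻¹ (real≈ p) = p

  over⇒∈eqModel : ∀ A {u} → Over ∣ A ∣ u → u ∈ ∥ eqModel A ∥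
  over⇒∈eqModel A (real x , p , x∈) = shrink (real (x , x∈ zero) , p)
  over⇒∈eqModel A (class e a , p , a∈) = shrink (class e (λ i → a i , a∈ i) , p)

  ∈eqModel⇒over : ∀ A {u} → u ∈ ∥ eqModel A ∥ → Over ∣ A ∣ u
  ∈eqModel⇒over A u∈ with expand u∈
  ... | real (x , x∈) , p = real x , p , λ _ → x∈
  ... | class e a , p = class e (proj₁ ∘ a) , p , λ i → proj₂ (a i)


  over⇒∈ : ∀ N {u} → Over ∣ realModel N ∣ u → u ∈ ∥ N ∥
  over⇒∈ N (real x , p , x∈) = Substructure.resp (subᵉ N) p (x∈ zero)
  over⇒∈ N (class e a , p , a∈) = Substructure.resp (subᵉ N) (𝕄ᵉ.trans (𝕄ᵉ.sym (class≈fun 𝕄 e a)) p)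
    (Substructure.closed (subᵉ N) (inj₂ (just e)) (real ∘ a) a∈)

  -- A representative is found in the presentation of `N`. Its entries name real elements of `N`,
  -- and F_E is computed in `N` as in 𝕄^eq.
  ∈⇒over : ∀ N {u} → u ∈ ∥ N ∥ → Over ∣ realModel N ∣ u
  ∈⇒over N {u} u∈ with Isomorphism.surjective iso (u , u∈)
    where open Presented (∈𝕂ᵉ N)
  ... | v , v↦u = over v v↦u
    where
    open Presented (∈𝕂ᵉ N) renaming (part to partᴾ)
    at : ∀ x → ∃[ y ] real (proj₁ y) 𝕄ᵉ.≈ proj₁ (Isomorphism.to iso (real x))
    at x = RealPart.onto (part N) (Isomorphism.to iso (real x)) (RealPart.isReal partᴾ x)
    over : ∀ v → proj₁ (Isomorphism.to iso v) 𝕄ᵉ.≈ u → Over ∣ realModel N ∣ u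
    over (real x) p = let y , e = at x in real (proj₁ y) , 𝕄ᵉ.trans e p , λ _ → proj₂ y
    over (class e a) p = class e (λ i → proj₁ (proj₁ (at (a i)))) ,
      𝕄ᵉ.trans (class≈fun 𝕄 e _) (𝕄ᵉ.trans (𝕄ᵉ.fun-cong F (λ i → proj₂ (at (a i))))
        (𝕄ᵉ.trans (𝕄ᵉ.sym (Isomorphism.fun-hom iso F (real ∘ a)))
          (𝕄ᵉ.trans (𝕄ᵉ.sym (Isomorphism.cong iso (class≈fun Real e a))) p))) ,
      λ i → proj₂ (proj₁ (at (a i)))
      where F = inj₂ (just e)

  _ᴱ : Aut → Isomorphism 𝕄ᵉ 𝕄ᵉ
  _ᴱ = liftIso 𝕄∈𝕂 𝕄∈𝕂

  act : Aut → Elem 𝕄 → Elem 𝕄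
  act σ = liftElem 𝕄∈𝕂 𝕄∈𝕂 (Isomorphism.embedding σ) (aut-strong σ)

  act-cong : ∀ σ {u v} → u 𝕄ᵉ.≈ v → act σ u 𝕄ᵉ.≈ act σ v
  act-cong σ = Isomorphism.cong (σ ᴱ)

  act-id : ∀ u → act (idⁱ 𝕄) u ≡ u
  act-id (real _) = ≡.refl
  act-id (class _ _) = ≡.refl

  act-∘ : ∀ σ τ u → act (σ ∘ⁱ τ) u ≡ act σ (act τ u)
  act-∘ σ τ (real _) = ≡.refl
  act-∘ σ τ (class _ _) = ≡.refl

  act-parts : ∀ σ τ v → (∀ i → Isomorphism.to σ (proj₂ (parts v) i) 𝕄.≈ Isomorphism.to τ (proj₂ (parts v) i)) →
    act σ v 𝕄ᵉ.≈ act τ v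
  act-parts σ τ (real x) p = real≈ (p zero)
  act-parts σ τ (class e a) p = quotient-cong 𝕄 (just e) p

  act-inverse : ∀ σ u → act (symⁱ σ) (act σ u) 𝕄ᵉ.≈ u
  act-inverse σ u = 𝕄ᵉ.trans (𝕄ᵉ.reflexive (≡.sym (act-∘ (symⁱ σ) σ u)))
    (𝕄ᵉ.trans (act-parts (symⁱ σ ∘ⁱ σ) (idⁱ 𝕄) u (λ i → ⁻¹-to σ _)) (𝕄ᵉ.reflexive (act-id u)))

  act-inverseʳ : ∀ σ u → act σ (act (symⁱ σ) u) 𝕄ᵉ.≈ u
  act-inverseʳ σ u = 𝕄ᵉ.trans (𝕄ᵉ.reflexive (≡.sym (act-∘ σ (symⁱ σ) u)))
    (𝕄ᵉ.trans (act-parts (σ ∘ⁱ symⁱ σ) (idⁱ 𝕄) u (λ i → to-⁻¹ σ _)) (𝕄ᵉ.reflexive (act-id u)))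

  act-over : {P : Pred 𝕄.Carrier p} {Q : Pred 𝕄.Carrier q} → ∀ σ → (∀ {x} → P x → Q (Isomorphism.to σ x)) →
    ∀ {u} → Over P u → Over Q (act σ u)
  act-over σ P⇒Q (real x , p , P-v) = real _ , act-cong σ p , P⇒Q ∘ P-v
  act-over σ P⇒Q (class e a , p , P-v) = class e _ , act-cong σ p , P⇒Q ∘ P-v

  induced : (τ : Isomorphism 𝕄ᵉ 𝕄ᵉ) → Σ[ σ ∈ Aut ] (∀ u → Isomorphism.to τ u 𝕄ᵉ.≈ act σ u)
  induced τ = let σ , e = restrictⁱ (realPart 𝕄) (realPart 𝕄) τ in
    σ , embedding-determined (idⁱ 𝕄ᵉ) (Isomorphism.embedding τ) (Isomorphism.embedding (σ ᴱ)) e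

  isMonsterᵉ : Monᵉ.IsMonster
  isMonsterᵉ = record
    { 𝕄∈𝕂 = 𝕂ᵉ-^eq 𝕄∈𝕂
    ; uncountable = uncountable
    -- The isomorphism is restricted to real models and extended there; the lift of the extension
    -- agrees with `f` because real elements generate.
    ; homogeneous = λ A B f →
        let open Presented (∈𝕂ᵉ A) renaming (part to partᴾ)
            g , f≈g = restrictⁱ (part A) (part B) f
            σ , σ≈g = homogeneous (realModel A) (realModel B) g in
        (σ ᴱ) , λ u → 𝕄ᵉ.trans (act-cong σ (𝕄ᵉ.sym (to-⁻¹ iso u)))
          (𝕄ᵉ.trans (embedding-determined iso
            (Isomorphism.embedding (σ ᴱ) ∘ᵉ inclusion (subᵉ A) ∘ᵉ Isomorphism.embedding iso)
            (inclusion (subᵉ B) ∘ᵉ Isomorphism.embedding f)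
            (λ x → let y , e = RealPart.onto (part A) (Isomorphism.to iso (real x)) (RealPart.isReal partᴾ x) in
              𝕄ᵉ.trans (act-cong σ (𝕄ᵉ.sym e)) (𝕄ᵉ.trans (real≈ (σ≈g y))
                (𝕄ᵉ.trans (𝕄ᵉ.sym (f≈g y)) (Isomorphism.cong f e))))
            ((iso ⁻¹) u))
          (Isomorphism.cong f (to-⁻¹ iso u)))
    ; universal = λ {N} N∈ (N≲Δ , Δ⋦N) →
        let h , sh = universal (Presented.Real∈𝕂 N∈)
              (real-part-≲ N∈ ⟫ N≲Δ , λ Δ≲ → Δ⋦N (Δ≲ ⟫ real-part-≲ N∈)) in
        into-^eq 𝕄∈𝕂 N∈ h sh , into-^eq-strong 𝕄∈𝕂 N∈ h sh }

-- Types, coordinates and nonsplitting in 𝕄^eq.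

module EqTypes (Z : ZermeloLogic) {s c r k} {L : Signature s}
    (𝒦 : StructureClass L c r k) (𝕄 : Structure L c r) (Δ : Set c)
    (fur : IsFURClass 𝒦 𝕄 Δ) (ℰ : Equivalences 𝒦 𝕄 Δ) where
  open Classical Z
  open Cardinals Z
  open CountableSets Z
  open Images Z
  open EqMonster Z 𝒦 𝕄 Δ fur ℰ public
  open IsAEC FUR.isAEC
  open Eq ℰ
  open Mon using (range; _inside_)
  open Mon.Model
  open Monᵉ.Model using () renaming (∣_∣ to ∥_∥)
  open Mon.IsMonster FUR.isMonster using (𝕄∈𝕂)
  open 𝕄ₘ using (Aut)
  private
    variable
      I : Set ℓ
      l : ℕ

  record Maps {I : Set ℓ} (σ : Aut) (u v : I → Elem 𝕄) : Set (ℓ ⊔ rᵉ) where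
    constructor maps
    field at : ∀ i → act σ (u i) 𝕄ᵉ.≈ v i
  open Maps public

  Fixes : {I : Set ℓ} → Aut → (I → Elem 𝕄) → Set (ℓ ⊔ rᵉ)
  Fixes σ A = Maps σ A A

  infix 4 _∼[_]_
  -- The common form of types in 𝒦 and in 𝒦^eq, by automorphisms of 𝕄 acting on 𝕄^eq. Over a finite
  -- set weak and Galois types coincide, so one automorphism is enough.
  _∼[_]_ : {I : Set ℓ} → (I → Elem 𝕄) → Vector (Elem 𝕄) m → (I → Elem 𝕄) → Set (ℓ ⊔ s ⊔ c ⊔ r ⊔ rᵉ)
  u ∼[ A ] v = Σ[ σ ∈ Aut ] Fixes σ A × Maps σ u v

  maps-id : {u : I → Elem 𝕄} → Maps (idⁱ 𝕄) u u
  maps-id = maps λ i → 𝕄ᵉ.reflexive (act-id _)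

  maps-∘ : ∀ σ τ {u v w : I → Elem 𝕄} → Maps σ v w → Maps τ u v → Maps (σ ∘ⁱ τ) u w
  maps-∘ σ τ p q = maps λ i →
    𝕄ᵉ.trans (𝕄ᵉ.reflexive (act-∘ σ τ _)) (𝕄ᵉ.trans (act-cong σ (at q i)) (at p i))

  maps-inverse : ∀ σ {u v : I → Elem 𝕄} → Maps σ u v → Maps (symⁱ σ) v u
  maps-inverse σ p = maps λ i → 𝕄ᵉ.trans (act-cong (symⁱ σ) (𝕄ᵉ.sym (at p i))) (act-inverse σ _)

  maps-act : ∀ σ {u : I → Elem 𝕄} → Maps σ u (act σ ∘ u)
  maps-act σ = maps λ _ → 𝕄ᵉ.refl

  maps-++ : ∀ σ {u u′ : Vector (Elem 𝕄) m} {v v′ : Vector (Elem 𝕄) n} →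
    Maps σ u u′ → Maps σ v v′ → Maps σ (u ++ v) (u′ ++ v′)
  maps-++ σ {u} {u′} {v} {v′} p q = maps
    (++-pointwise {R = λ x y → act σ x 𝕄ᵉ.≈ y} {u = u} {v = v} {u′ = u′} {v′ = v′} (at p) (at q))

  maps-left : ∀ σ (u u′ : Vector (Elem 𝕄) m) {v v′ : Vector (Elem 𝕄) n} →
    Maps σ (u ++ v) (u′ ++ v′) → Maps σ u u′
  maps-left {n = n} σ u u′ {v} {v′} p = maps λ i → ≡.subst₂ (λ x y → act σ x 𝕄ᵉ.≈ y)
    (++-left u v i) (++-left u′ v′ i) (at p (i ↑ˡ n))

  maps-right : ∀ σ (u u′ : Vector (Elem 𝕄) m) {v v′ : Vector (Elem 𝕄) n} →
    Maps σ (u ++ v) (u′ ++ v′) → Maps σ v v′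
  maps-right {m = m} σ u u′ {v} {v′} p = maps λ i → ≡.subst₂ (λ x y → act σ x 𝕄ᵉ.≈ y)
    (++-right u v i) (++-right u′ v′ i) (at p (m ↑ʳ i))

  ∼-sym : {A : Vector (Elem 𝕄) m} {u v : I → Elem 𝕄} → u ∼[ A ] v → v ∼[ A ] u
  ∼-sym (σ , f , p) = symⁱ σ , maps-inverse σ f , maps-inverse σ p

  ≡ᵗ⇒∼ : {u v : I → Elem 𝕄} {P : Pred (Elem 𝕄) p} → u Monᵉ.≡ᵗ v over P →
    (B : Vector (Elem 𝕄) n) → (∀ i → P (B i)) → u ∼[ B ] v
  ≡ᵗ⇒∼ t B B∈P = let τ , fix , move = t B B∈P
                     σ , τ≈σ = induced τ in
    σ , maps (λ i → 𝕄ᵉ.trans (𝕄ᵉ.sym (τ≈σ _)) (fix _ (i , 𝕄ᵉ.refl))) ,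
    maps (λ j → 𝕄ᵉ.trans (𝕄ᵉ.sym (τ≈σ _)) (move j))

  ∼⇒≡ᵗ : {u v : I → Elem 𝕄} {P : Pred (Elem 𝕄) p} →
    (∀ {n} (B : Vector (Elem 𝕄) n) → (∀ i → P (B i)) → u ∼[ B ] v) → u Monᵉ.≡ᵗ v over P
  ∼⇒≡ᵗ t B B∈P = let σ , fix , move = t B B∈P in
    (σ ᴱ) , (λ x (i , x≈) → 𝕄ᵉ.trans (act-cong σ x≈) (𝕄ᵉ.trans (at fix i) (𝕄ᵉ.sym x≈))) , at move

  ≡ᵗ-range⇒∼ : {u v : I → Elem 𝕄} (A : Vector (Elem 𝕄) n) → u Monᵉ.≡ᵗ v over Monᵉ.range A → u ∼[ A ] v
  ≡ᵗ-range⇒∼ A t = ≡ᵗ⇒∼ {P = Monᵉ.range A} t A λ i → i , 𝕄ᵉ.refl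

  ∼⇒≡ᵗ-range : {u v : I → Elem 𝕄} (A : Vector (Elem 𝕄) n) → u ∼[ A ] v → u Monᵉ.≡ᵗ v over Monᵉ.range A
  ∼⇒≡ᵗ-range A (σ , fix , move) = ∼⇒≡ᵗ {P = Monᵉ.range A} λ B B∈A → σ ,
    maps (λ i → let j , e = B∈A i in 𝕄ᵉ.trans (act-cong σ e) (𝕄ᵉ.trans (at fix j) (𝕄ᵉ.sym e))) , move

  ≡ᵗ⇒∼ʳ : {x y : I → 𝕄.Carrier} {P : Pred 𝕄.Carrier p} → x Mon.≡ᵗ y over P →
    (B : Vector 𝕄.Carrier n) → B inside P → real ∘ x ∼[ real ∘ B ] real ∘ y
  ≡ᵗ⇒∼ʳ t B B∈P = let σ , fix , move = t B B∈P in
    σ , maps (λ i → real≈ (fix _ (i , 𝕄.refl))) , maps (λ j → real≈ (move j))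

  ∼⇒≡ᵗʳ : {x y : I → 𝕄.Carrier} {P : Pred 𝕄.Carrier p} →
    (∀ {n} (B : Vector 𝕄.Carrier n) → B inside P → real ∘ x ∼[ real ∘ B ] real ∘ y) → x Mon.≡ᵗ y over P
  ∼⇒≡ᵗʳ t B B∈P = let σ , fix , move = t B B∈P in
    σ , (λ x (i , x≈) → 𝕄.trans (Isomorphism.cong σ x≈) (𝕄.trans (real≈⁻¹ (at fix i)) (𝕄.sym x≈))) ,
    λ j → real≈⁻¹ (at move j)

  ≡ᵗ-range⇒∼ʳ : {x y : I → 𝕄.Carrier} (A : Vector 𝕄.Carrier n) →
    x Mon.≡ᵗ y over range A → real ∘ x ∼[ real ∘ A ] real ∘ y
  ≡ᵗ-range⇒∼ʳ A t = ≡ᵗ⇒∼ʳ {P = range A} t A λ i → i , 𝕄.refl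

  ∼⇒≡ᵗ-rangeʳ : {x y : I → 𝕄.Carrier} (A : Vector 𝕄.Carrier n) →
    real ∘ x ∼[ real ∘ A ] real ∘ y → x Mon.≡ᵗ y over range A
  ∼⇒≡ᵗ-rangeʳ A (σ , fix , move) = ∼⇒≡ᵗʳ {P = range A} λ B B∈A → σ ,
    maps (λ i → let j , e = B∈A i in
      𝕄ᵉ.trans (act-cong σ (real≈ e)) (𝕄ᵉ.trans (at fix j) (𝕄ᵉ.sym (real≈ e)))) , move

  maps-real-++ : ∀ σ (x x′ : Vector 𝕄.Carrier m) {y y′ : Vector 𝕄.Carrier n} →
    Maps σ (real ∘ (x ++ y)) (real ∘ (x′ ++ y′)) →
    Maps σ (real ∘ x) (real ∘ x′) × Maps σ (real ∘ y) (real ∘ y′)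
  maps-real-++ {m} {n} σ x x′ {y} {y′} p =
    maps (λ i → ≡.subst₂ (λ x y → act σ (real x) 𝕄ᵉ.≈ real y)
      (++-left x y i) (++-left x′ y′ i) (at p (i ↑ˡ n))) ,
    maps (λ i → ≡.subst₂ (λ x y → act σ (real x) 𝕄ᵉ.≈ real y)
      (++-right x y i) (++-right x′ y′ i) (at p (m ↑ʳ i)))

  maps-++-real : ∀ σ {x x′ : Vector 𝕄.Carrier m} {y y′ : Vector 𝕄.Carrier n} →
    Maps σ (real ∘ x) (real ∘ x′) → Maps σ (real ∘ y) (real ∘ y′) →
    Maps σ (real ∘ (x ++ y)) (real ∘ (x′ ++ y′))
  maps-++-real σ {x} {x′} {y} {y′} p q = maps (++-pointwise
    {R = λ x y → act σ (real x) 𝕄ᵉ.≈ real y} {u = x} {v = y} {u′ = x′} {v′ = y′} (at p) (at q))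

  -- Every entry of u is definable over the finitely many real elements coord.
  record Coordinates {n} (u : Vector (Elem 𝕄) n) (P : Pred 𝕄.Carrier p) : Set (p ⊔ c ⊔ rᵉ) where
    field
      {size}  : ℕ
      coord   : Vector 𝕄.Carrier size
      coord∈  : coord inside P
      reps    : Vector (Elem 𝕄) n
      reps≈   : ∀ i → reps i 𝕄ᵉ.≈ u i
      located : ∀ i l → ∃[ j ] proj₂ (parts (reps i)) l ≡ coord j

    determined : ∀ σ τ {w} → Maps σ (real ∘ coord) w → Maps τ (real ∘ coord) w →
      ∀ i → act σ (u i) 𝕄ᵉ.≈ act τ (u i)
    determined σ τ p q i = 𝕄ᵉ.trans (act-cong σ (𝕄ᵉ.sym (reps≈ i)))
      (𝕄ᵉ.trans (act-parts σ τ (reps i) λ l → let j , e = located i l in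
        ≡.subst (λ x → Isomorphism.to σ x 𝕄.≈ Isomorphism.to τ x) (≡.sym e)
          (real≈⁻¹ (𝕄ᵉ.trans (at p j) (𝕄ᵉ.sym (at q j)))))
      (act-cong τ (reps≈ i)))

    -- `σ ∘ⁱ ρ` and `ρ′` agree on the coordinates, hence on `u`. This passes equality of types from
    -- conjugates of the coordinates to the conjugates of `u` that they define.
    carried : ∀ σ ρ ρ′ {w w′ : Vector (Elem 𝕄) size} {u₁ u₂} →
      Maps ρ (real ∘ coord) w → Maps ρ u u₁ → Maps ρ′ (real ∘ coord) w′ → Maps ρ′ u u₂ →
      Maps σ w w′ → Maps σ u₁ u₂
    carried σ ρ ρ′ ρw ρu ρ′w′ ρ′u σw = maps λ i → 𝕄ᵉ.trans (act-cong σ (𝕄ᵉ.sym (at ρu i)))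
      (𝕄ᵉ.trans (𝕄ᵉ.reflexive (≡.sym (act-∘ σ ρ (u i))))
        (𝕄ᵉ.trans (determined (σ ∘ⁱ ρ) ρ′ (maps-∘ σ ρ σw ρw) ρ′w′ i) (at ρ′u i)))

    fixed : ∀ {σ} → Fixes σ (real ∘ coord) → Fixes σ u
    fixed {σ} p = maps λ i → 𝕄ᵉ.trans (determined σ (idⁱ 𝕄) p maps-id i) (𝕄ᵉ.reflexive (act-id (u i)))

    moved : ∀ σ {Q : Pred 𝕄.Carrier q} → (∀ j → Q (Isomorphism.to σ (coord j))) → ∀ i → Over Q (act σ (u i))
    moved σ {Q} Qσ i = act-over {P = λ x → ∃[ j ] x ≡ coord j} {Q = Q} σ (λ { (j , ≡.refl) → Qσ j })
      (reps i , reps≈ i , located i)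

  coordinates : {P : Pred 𝕄.Carrier p} (u : Vector (Elem 𝕄) n) → (∀ i → Over P (u i)) → Coordinates u P
  coordinates {n = zero} u u∈ = record
    { size = 0 ; coord = λ () ; coord∈ = λ () ; reps = u ; reps≈ = λ () ; located = λ () }
  coordinates {n = suc n} {P = P} u u∈ with u∈ zero | coordinates {P = P} (tail u) (u∈ ∘ suc)
  ... | v , v≈u , v∈ | C = record
    { coord = x ++ C.coord
    ; coord∈ = ++-all {P = P} {u = x} {v = C.coord} v∈ C.coord∈
    ; reps = v ∷ C.reps
    ; reps≈ = λ { zero → v≈u ; (suc i) → C.reps≈ i }
    ; located = λ
      { zero l → l ↑ˡ _ , ≡.sym (++-left x C.coord l)
      ; (suc i) l → let j , e = C.located i l in
          _ ↑ʳ j , ≡.trans e (≡.sym (++-right x C.coord j)) } }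
    where
    module C = Coordinates C
    x = proj₂ (parts v)

  -- a ++ b and a ++ d have the same type over A iff b and d have the same type over A and a.
  NonSplitting : Vector (Elem 𝕄) n → Pred (Elem 𝕄) p → Vector (Elem 𝕄) m → Set (p ⊔ c ⊔ r ⊔ s ⊔ rᵉ)
  NonSplitting a P A = ∀ {l} (b d : Vector (Elem 𝕄) l) → (∀ i → P (b i)) → (∀ i → P (d i)) →
    b ∼[ A ] d → Σ[ σ ∈ Aut ] Fixes σ A × Fixes σ a × Maps σ b d

  NonSplittingʳ : Vector (Elem 𝕄) n → Pred 𝕄.Carrier p → Vector (Elem 𝕄) m → Set (p ⊔ c ⊔ r ⊔ s ⊔ rᵉ)
  NonSplittingʳ a P A = ∀ {l} (b d : Vector 𝕄.Carrier l) → b inside P → d inside P →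
    real ∘ b ∼[ A ] real ∘ d → Σ[ σ ∈ Aut ] Fixes σ A × Fixes σ a × Maps σ (real ∘ b) (real ∘ d)

  ¬splits⇒nonSplitting : {a : Vector (Elem 𝕄) n} {P : Pred (Elem 𝕄) p} {A : Vector (Elem 𝕄) m} →
    ¬ Monᵉ.SplitsOver a P A → NonSplitting a P A
  ¬splits⇒nonSplitting {a = a} {A = A} ns b d b∈ d∈ b∼d =
    let σ , fix , move = ≡ᵗ-range⇒∼ A (by-contradiction λ ≢ → ns (_ , b , d , b∈ , d∈ , ∼⇒≡ᵗ-range A b∼d , ≢)) in
    σ , fix , maps-left σ a a move , maps-right σ a a move

  nonSplitting⇒¬splits : {a : Vector (Elem 𝕄) n} {P : Pred (Elem 𝕄) p} {A : Vector (Elem 𝕄) m} →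
    NonSplitting a P A → ¬ Monᵉ.SplitsOver a P A
  nonSplitting⇒¬splits {A = A} ns (_ , b , d , b∈ , d∈ , b∼d , ≢) =
    let σ , fix , fix-a , move = ns b d b∈ d∈ (≡ᵗ-range⇒∼ A b∼d) in
    ≢ (∼⇒≡ᵗ-range A (σ , fix , maps-++ σ fix-a move))

  ¬splits⇒nonSplittingʳ : {a : Vector 𝕄.Carrier n} {P : Pred 𝕄.Carrier p} {A : Vector 𝕄.Carrier m} →
    ¬ Mon.SplitsOver a P A → NonSplittingʳ (real ∘ a) P (real ∘ A)
  ¬splits⇒nonSplittingʳ {a = a} {A = A} ns b d b∈ d∈ b∼d =
    let σ , fix , move = ≡ᵗ-range⇒∼ʳ A (by-contradiction λ ≢ → ns (_ , b , d , b∈ , d∈ , ∼⇒≡ᵗ-rangeʳ A b∼d , ≢))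
        fix-a , move-b = maps-real-++ σ a a move in
    σ , fix , fix-a , move-b

  nonSplittingʳ⇒¬splits : {a : Vector 𝕄.Carrier n} {P : Pred 𝕄.Carrier p} {A : Vector 𝕄.Carrier m} →
    NonSplittingʳ (real ∘ a) P (real ∘ A) → ¬ Mon.SplitsOver a P A
  nonSplittingʳ⇒¬splits {A = A} ns (_ , b , d , b∈ , d∈ , b∼d , ≢) =
    let σ , fix , fix-a , move = ns b d b∈ d∈ (≡ᵗ-range⇒∼ʳ A b∼d) in
    ≢ (∼⇒≡ᵗ-rangeʳ A (σ , fix , maps-++-real σ fix-a move))

  -- The new base is appended to the tuples compared: `b` and `d` have the same type over `A′` when
  -- `A′ ++ b` and `A′ ++ d` have the same type over `A` by an automorphism fixing `A′`.
  nonSplitting-base : {a : Vector (Elem 𝕄) n} {P : Pred (Elem 𝕄) p} {A : Vector (Elem 𝕄) m} →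
    NonSplitting a P A → (A′ : Vector (Elem 𝕄) l) → (∀ i → P (A′ i)) →
    (∀ σ → Fixes σ A′ → Fixes σ A) → NonSplitting a P A′
  nonSplitting-base {P = P} ns A′ A′∈ fix b d b∈ d∈ (σ , σA′ , σb) =
    let τ , _ , τa , τA′b = ns (A′ ++ b) (A′ ++ d) (++-all {P = P} {u = A′} {v = b} A′∈ b∈) (++-all {P = P} {u = A′} {v = d} A′∈ d∈)
          (σ , fix σ σA′ , maps-++ σ σA′ σb) in
    τ , maps-left τ A′ A′ τA′b , τa , maps-right τ A′ A′ τA′b

  submodel : (A : Model) (u : Vector 𝕄.Carrier n) → u inside ∣ A ∣ →
    Σ[ B ∈ Model ] Mon.Countable B × u inside ∣ B ∣ × ∣ B ∣ ⊆ ∣ A ∣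
  submodel A u u∈ with 𝕄ₘ.countable-submodel (∈𝕂 A) {X = λ x → ∃[ i ] proj₁ x 𝕄.≈ u i}
    (range-countable (Structure.setoid (structure A)) (λ i → u i , u∈ i) λ _ x∈ → x∈)
  ... | S , u⊆S , kS , sS , S≲ =
    𝕄ₘ.image-model kS (𝕄ₘ.countable⇒small (structure A ↾ S) S≲) e (strong-trans kS (∈𝕂 A) 𝕄∈𝕂 _ _ (strong A) sS) ,
    (underlying-≲ (Isomorphism.embedding (symⁱ (image-iso e))) ⟫ S≲) ,
    (λ i → shrink (((u i , u∈ i) , u⊆S (i , 𝕄.refl)) , 𝕄.refl)) ,
    λ y∈ → let ((x , x∈) , _) , p = expand y∈ in Substructure.resp (sub A) p x∈
    where e = inclusion (sub A) ∘ᵉ inclusion S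

  -- AI speaks of countable models; a countable submodel around the parameters brings any model
  -- under it.
  saturated : (A : Model) (b : Vector 𝕄.Carrier n) (B : Vector 𝕄.Carrier m) → B inside ∣ A ∣ →
    Σ[ a ∈ Vector 𝕄.Carrier n ] a inside ∣ A ∣ × (real ∘ a ∼[ real ∘ B ] real ∘ b)
  saturated A b B B∈ =
    let A₀ , cA₀ , B∈A₀ , A₀⊆A = submodel A B B∈
        a , a∈ , t = FUR.AI A₀ cA₀ b B B∈A₀ in
    a , (λ i → A₀⊆A (a∈ i)) , ≡ᵗ-range⇒∼ʳ B t

  -- Given b ∼[A] d in N, the coordinates of b are moved, over A and the coordinates of d, to
  -- coordinates of d inside N.
  real-test : (N : Modelᵉ) {a : Vector (Elem 𝕄) n} (A : Vector 𝕄.Carrier m) → A inside ∣ realModel N ∣ →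
    NonSplittingʳ a ∣ realModel N ∣ (real ∘ A) → NonSplitting a ∥ N ∥ (real ∘ A)
  real-test N A A∈ ns b d b∈ d∈ (σ , σA , σb) =
    let ρ , ρA , ρa , ρb = ns B.coord x B.coord∈ x∈
          (σ′ , maps-∘ (symⁱ τ) σ (maps-inverse τ τA) σA , σ′B) in
    ρ , ρA , ρa , maps λ i → 𝕄ᵉ.trans (B.determined ρ σ′ ρb σ′B i)
      (at (maps-∘ (symⁱ τ) σ (maps-inverse τ τd) σb) i)
    where
    module B = Coordinates (coordinates {P = ∣ realModel N ∣} b (λ i → ∈⇒over N (b∈ i)))
    module D = Coordinates (coordinates {P = ∣ realModel N ∣} d (λ i → ∈⇒over N (d∈ i)))
    found = saturated (realModel N) (Isomorphism.to σ ∘ B.coord) (A ++ D.coord)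
      (++-all {P = ∣ realModel N ∣} {u = A} {v = D.coord} A∈ D.coord∈)
    x = proj₁ found
    x∈ = proj₁ (proj₂ found)
    τ = proj₁ (proj₂ (proj₂ found))
    τx = proj₂ (proj₂ (proj₂ (proj₂ found)))
    τAD = maps-real-++ τ A A (proj₁ (proj₂ (proj₂ (proj₂ found))))
    τA = proj₁ τAD
    τd : Fixes τ d
    τd = D.fixed (proj₂ τAD)
    σ′ = symⁱ τ ∘ⁱ σ
    σ′B : Maps σ′ (real ∘ B.coord) (real ∘ x)
    σ′B = maps-∘ (symⁱ τ) σ (maps-inverse τ τx) (maps-act σ)

-- The axioms AI, AIV and AII.

module Games (Z : ZermeloLogic) {s c r k} {L : Signature s}
    (𝒦 : StructureClass L c r k) (𝕄 : Structure L c r) (Δ : Set c)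
    (fur : IsFURClass 𝒦 𝕄 Δ) (ℰ : Equivalences 𝒦 𝕄 Δ) where
  open Classical Z
  open Cardinals Z
  open CountableSets Z
  open EqTypes Z 𝒦 𝕄 Δ fur ℰ public
  open Eq ℰ
  open Mon using (range; _inside_)
  open Mon.Model
  open Monᵉ.Model using () renaming (∣_∣ to ∥_∥)
  open 𝕄ₘ using (Aut)

  Anything : Pred 𝕄.Carrier c
  Anything _ = Lift c ⊤

  coordinates-𝕄 : (u : Vector (Elem 𝕄) n) → Coordinates u Anything
  coordinates-𝕄 u = coordinates {P = Anything} u λ i → u i , 𝕄ᵉ.refl , _

  coordinates-in : ∀ N (u : Vector (Elem 𝕄) n) → (∀ i → u i ∈ ∥ N ∥) → Coordinates u ∣ realModel N ∣
  coordinates-in N u u∈ = coordinates {P = ∣ realModel N ∣} u λ i → ∈⇒over N (u∈ i)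

  -- The coordinates of `b` are realized in the real part over those of `A`, and the automorphism
  -- witnessing this carries `b` into `N`.
  AIᵉ : (N : Modelᵉ) → Monᵉ.Countable N → ∀ {n m} (b : Vector (Elem 𝕄) n) (A : Vector (Elem 𝕄) m) →
    (∀ i → A i ∈ ∥ N ∥) → Σ[ a ∈ Vector (Elem 𝕄) n ] (∀ i → a i ∈ ∥ N ∥) × (a Monᵉ.≡ᵗ b over Monᵉ.range A)
  AIᵉ N cN b A A∈ =
    let x , x∈ , t = FUR.AI (realModel N) (realModel-countable N cN) B.coord A*.coord A*.coord∈
        τ , τA , τx = ≡ᵗ-range⇒∼ʳ A*.coord t
        σx = maps-inverse τ τx in
    act (symⁱ τ) ∘ b ,
    (λ i → over⇒∈ N (B.moved (symⁱ τ) {Q = ∣ realModel N ∣}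
      (λ j → Substructure.resp (sub (realModel N)) (𝕄.sym (real≈⁻¹ (at σx j))) (x∈ j)) i)) ,
    ∼⇒≡ᵗ-range A (∼-sym (symⁱ τ , A*.fixed (maps-inverse τ τA) , maps-act (symⁱ τ)))
    where
    module B = Coordinates (coordinates-𝕄 b)
    module A* = Coordinates (coordinates-in N A A∈)

  real-range : ∀ {A : Vector 𝕄.Carrier m} {B : Vector 𝕄.Carrier n} → range A ⊆ range B →
    ∀ {σ} → Fixes σ (real ∘ B) → Fixes σ (real ∘ A)
  real-range A⊆B {σ} fix = maps λ i → let j , e = A⊆B (i , 𝕄.refl) in
    𝕄ᵉ.trans (act-cong σ (real≈ e)) (𝕄ᵉ.trans (at fix j) (𝕄ᵉ.sym (real≈ e)))

  range-left : (A : Vector 𝕄.Carrier m) (B : Vector 𝕄.Carrier n) → range A ⊆ range (A ++ B)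
  range-left A B (i , e) = i ↑ˡ _ , 𝕄.trans e (𝕄.reflexive (≡.sym (++-left A B i)))

  range-right : (A : Vector 𝕄.Carrier m) (B : Vector 𝕄.Carrier n) → range B ⊆ range (A ++ B)
  range-right A B (i , e) = _ ↑ʳ i , 𝕄.trans e (𝕄.reflexive (≡.sym (++-right A B i)))

  range-leftᵉ : (A : Vector (Elem 𝕄) m) (B : Vector (Elem 𝕄) n) → Monᵉ.range A ⊆ Monᵉ.range (A ++ B)
  range-leftᵉ A B (i , e) = i ↑ˡ _ , 𝕄ᵉ.trans e (𝕄ᵉ.reflexive (≡.sym (++-left A B i)))

  moveI-transport : ∀ σ (𝒜 ℬ : Model) → (∀ {y} → y ∈ ∣ ℬ ∣ → (σ ⁻¹) y ∈ ∣ 𝒜 ∣) →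
    ∀ {n m l} {a b : Vector 𝕄.Carrier n} {A B : Vector 𝕄.Carrier m} →
    Maps σ (real ∘ a) (real ∘ b) → Maps σ (real ∘ A) (real ∘ B) →
    ∀ b′ (B′ : Vector 𝕄.Carrier l) → Mon.MoveI ℬ b B b′ B′ → Mon.MoveI 𝒜 a A ((σ ⁻¹) ∘ b′) ((σ ⁻¹) ∘ B′)
  moveI-transport σ 𝒜 ℬ back {A = A} {B} σa σA b′ B′ (b′~b , B′∈ , B⊆B′ , b′≁b) =
    (let ρ , ρB , ρb = ≡ᵗ-range⇒∼ʳ B b′~b in
      ∼⇒≡ᵗ-rangeʳ A (τ ∘ⁱ ρ ∘ⁱ σ ,
        maps-∘ τ (ρ ∘ⁱ σ) (maps-inverse σ σA) (maps-∘ ρ σ ρB σA) ,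
        maps-∘ τ (ρ ∘ⁱ σ) (maps-inverse σ σa) (maps-∘ ρ σ ρb (στ b′)))) ,
    (λ i → back (B′∈ i)) ,
    (λ (i , e) → let j , e′ = B⊆B′ (i , 𝕄.refl) in
      j , 𝕄.trans e (𝕄.trans (𝕄.sym (⁻¹-to σ (A i))) (Isomorphism.cong τ (𝕄.trans (real≈⁻¹ (at σA i)) e′)))) ,
    λ t → let ρ , ρB′ , ρb′ = ≡ᵗ-range⇒∼ʳ ((σ ⁻¹) ∘ B′) t in
      b′≁b (∼⇒≡ᵗ-rangeʳ B′ (σ ∘ⁱ ρ ∘ⁱ τ ,
        maps-∘ σ (ρ ∘ⁱ τ) (στ B′) (maps-∘ ρ τ ρB′ (maps-act τ)) ,
        maps-∘ σ (ρ ∘ⁱ τ) σa (maps-∘ ρ τ ρb′ (maps-act τ))))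
    where
    τ = symⁱ σ
    στ : ∀ {l} (w : Vector 𝕄.Carrier l) → Maps σ (real ∘ (σ ⁻¹) ∘ w) (real ∘ w)
    στ w = maps λ i → real≈ (to-⁻¹ σ (w i))

  -- AIV bounds the game for one tuple, but in every countable model. A conjugate of the tuple is
  -- treated by moving the model instead.
  winsII-transport : ∀ q σ (𝒜 ℬ : Model) → (∀ {x} → x ∈ ∣ 𝒜 ∣ → Isomorphism.to σ x ∈ ∣ ℬ ∣) →
    (∀ {y} → y ∈ ∣ ℬ ∣ → (σ ⁻¹) y ∈ ∣ 𝒜 ∣) →
    ∀ {n m} {a b : Vector 𝕄.Carrier n} {A B : Vector 𝕄.Carrier m} →
    Maps σ (real ∘ a) (real ∘ b) → Maps σ (real ∘ A) (real ∘ B) →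
    Mon.WinsII q 𝒜 a A → Mon.WinsII q ℬ b B
  winsII-transport zero σ 𝒜 ℬ into back σa σA wins b′ B′ move =
    wins _ _ (moveI-transport σ 𝒜 ℬ back σa σA b′ B′ move)
  winsII-transport (suc q) σ 𝒜 ℬ into back σa σA wins b′ B′ move =
    let _ , A″ , A″∈ , A′⊆A″ , wins′ = wins _ _ (moveI-transport σ 𝒜 ℬ back σa σA b′ B′ move) in
    _ , Isomorphism.to σ ∘ A″ , (λ i → into (A″∈ i)) ,
    (λ (i , e) → let j , e′ = A′⊆A″ (i , 𝕄.refl) in
      j , 𝕄.trans e (𝕄.trans (𝕄.sym (to-⁻¹ σ (B′ i))) (Isomorphism.cong σ e′))) ,
    winsII-transport q σ 𝒜 ℬ into back (maps λ i → real≈ (to-⁻¹ σ (b′ i))) (maps-act σ) wins′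

  -- A play on eq-elements is shadowed by a play on real coordinates, provided that the parameters of
  -- the two positions are interdefinable.
  module Shadow (N : Modelᵉ) {n} (u₀ : Vector (Elem 𝕄) n) where
    private
      𝒩 = realModel N
      module C = Coordinates (coordinates-𝕄 u₀)
      x : Aut → Vector 𝕄.Carrier C.size
      x ρ = Isomorphism.to ρ ∘ C.coord

    -- The automorphism taking `u` to `u′` over `A` also moves the coordinates, and it does so over
    -- `A*`, which is fixed together with `A`. The move is legal: equal types of old and new
    -- coordinates over the coordinates of `A′` would give equal types of `u` and `u′` over `A′`.
    shadow-move : ∀ ρ {u : Vector (Elem 𝕄) n} → Maps ρ u₀ u →
      ∀ {m m*} (A : Vector (Elem 𝕄) m) (A* : Vector 𝕄.Carrier m*) → A* inside ∣ 𝒩 ∣ →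
      (∀ {σ} → Fixes σ A → Fixes σ (real ∘ A*)) →
      ∀ {l} u′ (A′ : Vector (Elem 𝕄) l) → Monᵉ.MoveI N u A u′ A′ →
      Σ[ σ ∈ Aut ] Maps (σ ∘ⁱ ρ) u₀ u′ × Σ[ C′ ∈ Coordinates A′ ∣ 𝒩 ∣ ]
        Mon.MoveI 𝒩 (x ρ) A* (x (σ ∘ⁱ ρ)) (A* ++ Coordinates.coord C′)
    shadow-move ρ ρu A A* A*∈ A⇒A* u′ A′ (u′~u , A′∈ , A⊆A′ , u′≁u) =
      let τ , τA , τu′ = ≡ᵗ-range⇒∼ A u′~u
          σ = symⁱ τ
          σu = maps-∘ σ ρ (maps-inverse τ τu′) ρu
          C′ = coordinates-in N A′ A′∈
          module C′ = Coordinates C′ in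
      σ , σu , C′ ,
      ∼⇒≡ᵗ-rangeʳ A* (∼-sym (σ , A⇒A* (maps-inverse τ τA) , maps-act σ)) ,
      ++-all {P = ∣ 𝒩 ∣} {u = A*} {v = C′.coord} A*∈ C′.coord∈ ,
      range-left A* C′.coord ,
      λ t → let μ , μA , μx = ≡ᵗ-range⇒∼ʳ (A* ++ C′.coord) t in
        u′≁u (∼⇒≡ᵗ-range A′ (μ ,
          C′.fixed (real-range (range-right A* C′.coord) μA) ,
          C.carried μ (σ ∘ⁱ ρ) ρ (maps-act (σ ∘ⁱ ρ)) σu (maps-act ρ) ρu μx))

    shadow-wins : ∀ q ρ {u : Vector (Elem 𝕄) n} → Maps ρ u₀ u →
      ∀ {m m*} (A : Vector (Elem 𝕄) m) (A* : Vector 𝕄.Carrier m*) → A* inside ∣ 𝒩 ∣ →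
      (∀ {σ} → Fixes σ A → Fixes σ (real ∘ A*)) →
      Mon.WinsII q 𝒩 (x ρ) A* → Monᵉ.WinsII q N u A
    shadow-wins zero ρ ρu A A* A*∈ A⇒A* wins u′ A′ move =
      let _ , _ , _ , move* = shadow-move ρ ρu A A* A*∈ A⇒A* u′ A′ move in wins _ _ move*
    shadow-wins (suc q) ρ ρu A A* A*∈ A⇒A* wins u′ A′ move@(_ , A′∈ , _) =
      let σ , σu , C′ , move* = shadow-move ρ ρu A A* A*∈ A⇒A* u′ A′ move
          _ , A″ , A″∈ , _ , wins′ = wins _ _ move* in
      -- The real reply is adjoined to the parameters, so that fixing them again fixes the
      -- parameters of the shadow game.
      _ , A′ ++ (real ∘ A″) ,
      ++-all {P = ∥ N ∥} {u = A′} {v = real ∘ A″} A′∈ A″∈ ,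
      range-leftᵉ A′ (real ∘ A″) ,
      shadow-wins q (σ ∘ⁱ ρ) σu (A′ ++ (real ∘ A″)) A″ A″∈ (λ {τ} → maps-right τ A′ A′) wins′

  -- The first reply of II replaces the parameters by real ones; I may by then have moved a to a
  -- conjugate, for which the same number of moves suffices.
  AIVᵉ : ∀ {n} (a : Vector (Elem 𝕄) n) → ∃[ q ] (∀ (N : Modelᵉ) → Monᵉ.Countable N →
    ∀ {m} (A : Vector (Elem 𝕄) m) → (∀ i → A i ∈ ∥ N ∥) → Monᵉ.WinsII q N a A)
  AIVᵉ a = suc moves , λ N cN A A∈ u′ A′ (u′~a , A′∈ , _) →
    let open Shadow N a
        module C′ = Coordinates (coordinates-in N A′ A′∈)
        τ , _ , τu′ = ≡ᵗ-range⇒∼ A u′~a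
        σ = symⁱ τ
        𝒩 = realModel N
        wins : Mon.WinsII moves 𝒩 (Isomorphism.to σ ∘ C.coord) C′.coord
        wins = winsII-transport moves σ (τ 𝕄ₘ.⟨ 𝒩 ⟩) 𝒩
          (λ y∈ → let (x , x∈) , e = expand y∈ in
            Substructure.resp (sub 𝒩) (𝕄.trans (𝕄.sym (⁻¹-to τ x)) (Isomorphism.cong σ e)) x∈)
          (λ {y} y∈ → shrink ((y , y∈) , 𝕄.refl))
          (maps-act σ) (maps λ i → real≈ (⁻¹-to τ (C′.coord i)))
          (wins-real (τ 𝕄ₘ.⟨ 𝒩 ⟩) (𝕄ₘ.⟨⟩-countable τ 𝒩 (realModel-countable N cN))
            (Isomorphism.to τ ∘ C′.coord) λ i → shrink ((C′.coord i , C′.coord∈ i) , 𝕄.refl)) in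
    _ , A′ ++ (real ∘ C′.coord) , ++-all {P = ∥ N ∥} {u = A′} {v = real ∘ C′.coord} A′∈ C′.coord∈ ,
    range-leftᵉ A′ (real ∘ C′.coord) ,
    shadow-wins moves σ (maps-inverse τ τu′) (A′ ++ (real ∘ C′.coord)) C′.coord C′.coord∈
      (λ {τ} → maps-right τ A′ A′) wins
    where
    module C = Coordinates (coordinates-𝕄 a)
    moves = proj₁ (FUR.AIV C.coord)
    wins-real = proj₂ (FUR.AIV C.coord)

  over-mono : {P : Pred 𝕄.Carrier p} {Q : Pred 𝕄.Carrier q} → P ⊆ Q → ∀ {u} → Over P u → Over Q u
  over-mono P⊆Q (v , e , v∈) = v , e , λ i → P⊆Q (v∈ i)

  bounded : ∀ {n} (f : Fin n → ℕ) → ∃[ N ] (∀ i → f i ≤ N)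
  bounded {zero} f = 0 , λ ()
  bounded {suc n} f = let N , p = bounded (f ∘ suc) in
    f zero ⊔ℕ N , λ { zero → ℕₚ.m≤m⊔n _ N ; (suc i) → ℕₚ.≤-trans (p i) (ℕₚ.m≤n⊔m (f zero) N) }

  enumeration : (S : Setoid a ℓ) → S ≲ ≡.setoid ℕ → Setoid.Carrier S →
    Σ[ e ∈ (ℕ → Setoid.Carrier S) ] (∀ x → ∃[ i ] Setoid._≈_ S x (e i))
  enumeration S S≲ℕ x₀ = (λ i → e i (em _)) , λ x → Injection.to S≲ℕ x , onto x (em _)
    where
    e : ∀ i → Dec (∃[ x ] Injection.to S≲ℕ x ≡ i) → Setoid.Carrier S
    e i (yes (x , _)) = x
    -- Numbers coding no element get a default; repetitions do no harm to an enumeration.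
    e i (no _) = x₀
    onto : ∀ x d → Setoid._≈_ S x (e (Injection.to S≲ℕ x) d)
    onto x (yes (y , p)) = Injection.injective S≲ℕ (≡.sym p)
    onto x (no none) = contradiction (x , ≡.refl) none

  module AII {n} (a : Vector (Elem 𝕄) n) (N : Modelᵉ) (cN : Monᵉ.Countable N) where
    private
      𝒩 = realModel N
      module C = Coordinates (coordinates-𝕄 a)

      coords : Aut → Vector 𝕄.Carrier C.size
      coords ρ = Isomorphism.to ρ ∘ C.coord

      -- t(x/N) follows from its restriction to A together with a.
      Isolated : Aut → Vector 𝕄.Carrier m → Set _
      Isolated ρ A = ∀ σ → Fixes σ a → Fixes σ (real ∘ A) → ∀ {l} (B : Vector 𝕄.Carrier l) →
        B inside ∣ 𝒩 ∣ → real ∘ coords (σ ∘ⁱ ρ) ∼[ real ∘ B ] real ∘ coords ρ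

      -- If it is not isolated, then the coordinates of a leave room for a move of player I.
      isolate : ∀ q ρ → Fixes ρ a → (A : Vector 𝕄.Carrier m) → A inside ∣ 𝒩 ∣ →
        Mon.WinsII q 𝒩 (coords ρ) A →
        ∃[ ρ′ ] Fixes ρ′ a × ∃[ m′ ] Σ[ A′ ∈ Vector 𝕄.Carrier m′ ] A′ inside ∣ 𝒩 ∣ × Isolated ρ′ A′
      isolate q ρ ρa A A∈ wins
        with em (∃[ σ ] Fixes σ a × Fixes σ (real ∘ A) × ∃[ l ] Σ[ B ∈ Vector 𝕄.Carrier l ]
                   B inside ∣ 𝒩 ∣ × ¬ (real ∘ coords (σ ∘ⁱ ρ) ∼[ real ∘ B ] real ∘ coords ρ))
      ... | no none = ρ , ρa , _ , A , A∈ , λ σ σa σA B B∈ →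
              by-contradiction λ ≁ → none (σ , σa , σA , _ , B , B∈ , ≁)
      ... | yes (σ , σa , σA , _ , B , B∈ , ≁) = continue q wins
        where
        move : Mon.MoveI 𝒩 (coords ρ) A (coords (σ ∘ⁱ ρ)) (A ++ B)
        move = ∼⇒≡ᵗ-rangeʳ A (∼-sym (σ , σA , maps-act σ)) ,
          ++-all {P = ∣ 𝒩 ∣} {u = A} {v = B} A∈ B∈ , range-left A B ,
          λ t → ≁ (let τ , τAB , τx = ≡ᵗ-range⇒∼ʳ (A ++ B) t in τ , real-range (range-right A B) τAB , τx)
        continue : ∀ q → Mon.WinsII q 𝒩 (coords ρ) A → _
        continue zero wins = ⊥-elim (wins _ _ move)
        continue (suc q) wins = let _ , A″ , A″∈ , _ , wins′ = wins _ _ move in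
          isolate q (σ ∘ⁱ ρ) (maps-∘ σ ρ σa ρa) A″ A″∈ wins′

      isolated = isolate {m = 0} (proj₁ (FUR.AIV C.coord)) (idⁱ 𝕄) maps-id (λ ()) (λ ())
        (proj₂ (FUR.AIV C.coord) 𝒩 (realModel-countable N cN) (λ ()) (λ ()))
      ρ₀ = proj₁ isolated
      ρ₀a = proj₁ (proj₂ isolated)
      A* = proj₁ (proj₂ (proj₂ (proj₂ isolated)))
      A*∈ = proj₁ (proj₂ (proj₂ (proj₂ (proj₂ isolated))))
      A*-isolates = proj₂ (proj₂ (proj₂ (proj₂ (proj₂ isolated))))
      x = coords ρ₀

      primary = FUR.AII x 𝒩 (realModel-countable N cN)
      ℬ = proj₁ primary
      f = proj₁ (proj₂ primary)
      ℬ≐ = proj₁ (proj₂ (proj₂ primary))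
      f-primary = proj₂ (proj₂ (proj₂ primary))

      ℬ-countable : Mon.Countable ℬ
      ℬ-countable = covered-≲ 𝕄.setoid
          {T = Structure.setoid (structure 𝒩) ⊎ₛ (≡.setoid (Fin C.size) ⊎ₛ ≡.setoid ℕ)}
          (record
            { to = λ { (inj₁ (y , _)) → y ; (inj₂ (inj₁ i)) → x i ; (inj₂ (inj₂ i)) → f i }
            ; cong = λ { (inj₁ p) → p ; (inj₂ (inj₁ ≡.refl)) → 𝕄.refl ; (inj₂ (inj₂ ≡.refl)) → 𝕄.refl } })
          (λ y y∈ → cover y (proj₁ ℬ≐ y∈))
        ⟫ ⊎-countable (realModel-countable N cN) (⊎-countable Fin-countable ≲-refl)
        where
        cover : ∀ y → (∣ 𝒩 ∣ ∪ range x ∪ (λ y → ∃[ i ] y 𝕄.≈ f i)) y → _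
        cover y (inj₁ y∈) = inj₁ (y , y∈) , 𝕄.refl
        cover y (inj₂ (inj₁ (i , e))) = inj₂ (inj₁ i) , 𝕄.sym e
        cover y (inj₂ (inj₂ (i , e))) = inj₂ (inj₂ i) , 𝕄.sym e

      ℬᵉ = eqModel ℬ

      -- The sequence of an s-primary model may repeat what is already there, so all of the eq-model
      -- is listed, `a` and the elements of `N` included.
      enum = enumeration (Structure.setoid (Monᵉ.Model.structure ℬᵉ)) (eqModel-countable ℬ ℬ-countable)
        (real (f 0) , over⇒∈eqModel ℬ (over-real {P = ∣ ℬ ∣} (proj₂ ℬ≐ (inj₂ (inj₂ (0 , 𝕄.refl))))))

      e : ℕ → Elem 𝕄
      e i = proj₁ (proj₁ enum i)

      a∈ℬ : ∀ i → a i ∈ ∥ ℬᵉ ∥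
      a∈ℬ i = over⇒∈eqModel ℬ (over-resp {P = ∣ ℬ ∣} (at ρ₀a i)
        (C.moved ρ₀ {Q = ∣ ℬ ∣} (λ j → proj₂ ℬ≐ (inj₂ (inj₁ (j , 𝕄.refl)))) i))

      ≐ᵉ : ∥ ℬᵉ ∥ ≐ ∥ N ∥ ∪ Monᵉ.range a ∪ (λ u → ∃[ i ] u 𝕄ᵉ.≈ e i)
      ≐ᵉ = (λ {u} u∈ → inj₂ (inj₂ (proj₂ enum (u , u∈)))) , λ
        { (inj₁ u∈) → over⇒∈eqModel ℬ (over-mono {P = ∣ 𝒩 ∣} {Q = ∣ ℬ ∣} (λ y∈ → proj₂ ℬ≐ (inj₁ y∈)) (∈⇒over N u∈))
        ; (inj₂ (inj₁ (i , p))) → Substructure.resp (Monᵉ.Model.sub ℬᵉ) (𝕄ᵉ.sym p) (a∈ℬ i)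
        ; (inj₂ (inj₂ (i , p))) → Substructure.resp (Monᵉ.Model.sub ℬᵉ) (𝕄ᵉ.sym p) (proj₂ (proj₁ enum i)) }

      -- An initial segment of the enumeration has finitely many coordinates in `ℬ`, each of them an
      -- element of `𝒩`, an entry of `x` or some `f i`. `K` bounds the indices `i` that occur.
      module Segment (k : ℕ) where
        d : Vector (Elem 𝕄) (suc k)
        d i = e (toℕ i)

        module D = Coordinates (coordinates {P = ∣ ℬ ∣} d λ i → ∈eqModel⇒over ℬ (proj₂ (proj₁ enum (toℕ i))))

        y₀ : Structure.Carrier (structure 𝒩)
        y₀ = Injection.to (𝕂-infinite (∈𝕂 𝒩)) 0

        Source : 𝕄.Carrier → Set _
        Source y = (∣ 𝒩 ∣ ∪ range x ∪ (λ y → ∃[ i ] y 𝕄.≈ f i)) y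

        index : ∀ {y} → Source y → ℕ
        index (inj₂ (inj₂ (i , _))) = i
        index _ = 0

        source : ∀ j → Source (D.coord j)
        source j = proj₁ ℬ≐ (D.coord∈ j)

        bound = bounded (λ j → index (source j))
        K = proj₁ bound

        g : Vector 𝕄.Carrier (suc K)
        g i = f (toℕ i)

        -- A coordinate obtained from `x` or `f` contributes the arbitrary `y₀`, which keeps
        -- `constants` indexed by the coordinates themselves.
        constant : ∀ {y} → Source y → Structure.Carrier (structure 𝒩)
        constant {y} (inj₁ y∈) = y , y∈
        constant (inj₂ _) = y₀

        constants : Vector 𝕄.Carrier D.size
        constants j = proj₁ (constant (source j))

        base-K = f-primary K
        A_K = proj₁ (proj₂ base-K)
        A_K∈ = proj₁ (proj₂ (proj₂ base-K))
        K-primary = proj₂ (proj₂ (proj₂ base-K))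

        -- `A*` makes the type of `x` over `𝒩` follow from `a`, `A_K` then makes that of `x ++ g`
        -- follow, and `constants` holds the coordinates of `d` that lie in `𝒩`.
        base : Vector 𝕄.Carrier _
        base = A* ++ (A_K ++ constants)

        base∈ : base inside ∣ 𝒩 ∣
        base∈ = ++-all {P = ∣ 𝒩 ∣} {u = A*} {v = A_K ++ constants} A*∈
          (++-all {P = ∣ 𝒩 ∣} {u = A_K} {v = constants} A_K∈ λ j → proj₂ (constant (source j)))

        -- σ : (x , g) ↦ (x″ , g″) and τ : (x″ , g″) ↦ (x , g) fixing the constants are inverse to each
        -- other on the coordinates of d.
        return : ∀ σ τ → Fixes σ (real ∘ constants) → Fixes τ (real ∘ constants) →
          Maps τ (act σ ∘ real ∘ x) (real ∘ x) → Maps τ (act σ ∘ real ∘ g) (real ∘ g) →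
          ∀ j → act τ (act σ (real (D.coord j))) 𝕄ᵉ.≈ real (D.coord j)
        return σ τ σc τc τx τg j = go (source j) (proj₂ bound j) ≡.refl
          where
          transfer : ∀ {y z} → y 𝕄.≈ z → act τ (act σ (real z)) 𝕄ᵉ.≈ real z →
            act τ (act σ (real y)) 𝕄ᵉ.≈ real y
          transfer y≈z p = 𝕄ᵉ.trans (act-cong τ (act-cong σ (real≈ y≈z))) (𝕄ᵉ.trans p (real≈ (𝕄.sym y≈z)))
          go : (s : Source (D.coord j)) → index s ≤ K → s ≡ source j →
            act τ (act σ (real (D.coord j))) 𝕄ᵉ.≈ real (D.coord j)
          go (inj₁ y∈) _ eq = transfer (𝕄.reflexive (≡.cong (λ s → proj₁ (constant s)) eq))
            (𝕄ᵉ.trans (act-cong τ (at σc j)) (at τc j))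
          go (inj₂ (inj₁ (i , p))) _ _ = transfer p (at τx i)
          go (inj₂ (inj₂ (i , p))) i≤K _ = transfer
            (𝕄.trans p (𝕄.reflexive (≡.cong f (≡.sym (Finₚ.toℕ-fromℕ< (s≤s i≤K)))))) (at τg (fromℕ< (s≤s i≤K)))

        -- Some `σ` takes `a` and `d` to `a′` and `d′` over the base. Once `σ x` and `σ g` have the
        -- type of `x` and `g` over `𝒩`, any automorphism undoing `σ` on them and fixing the
        -- constants also takes `a′` and `d′` back.
        over-base : ∀ (a′ : Vector (Elem 𝕄) n) (d′ : Vector (Elem 𝕄) (suc k)) → a′ Monᵉ.≡ᵗ a over ∥ N ∥ →
          a′ ++ d′ Monᵉ.≡ᵗ a ++ d over Monᵉ.range (real ∘ base) → a′ ++ d′ Monᵉ.≡ᵗ a ++ d over ∥ N ∥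
        over-base a′ d′ a′~a a′d′~ad = ∼⇒≡ᵗ {P = ∥ N ∥} λ B B∈ →
          let module B = Coordinates (coordinates-in N B B∈)
              τ , τBc , τxg = ≡ᵗ⇒∼ʳ {P = ∣ 𝒩 ∣} x″g″~xg (B.coord ++ constants)
                (++-all {P = ∣ 𝒩 ∣} {u = B.coord} {v = constants} B.coord∈ λ j → proj₂ (constant (source j)))
              τB , τc = maps-real-++ τ B.coord B.coord τBc
              τx , τg = maps-real-++ τ x″ x τxg in
          τ , B.fixed τB , maps-++ τ
            (C.carried τ (σ ∘ⁱ ρ₀) ρ₀ (maps-act (σ ∘ⁱ ρ₀)) (maps-∘ σ ρ₀ σa ρ₀a) (maps-act ρ₀) ρ₀a τx)
            (D.carried τ σ (idⁱ 𝕄) (maps-act σ) σd maps-id maps-id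
              (maps (return σ τ (proj₂ σKc) τc (maps (at τx)) (maps (at τg)))))
          where
          σ⁻ = ≡ᵗ-range⇒∼ (real ∘ base) a′d′~ad
          σ = symⁱ (proj₁ σ⁻)
          σa : Maps σ a a′
          σa = maps-inverse (proj₁ σ⁻) (maps-left (proj₁ σ⁻) a′ a (proj₂ (proj₂ σ⁻)))
          σd : Maps σ d d′
          σd = maps-inverse (proj₁ σ⁻) (maps-right (proj₁ σ⁻) a′ a (proj₂ (proj₂ σ⁻)))
          σbase = maps-real-++ σ A* A* (maps-inverse (proj₁ σ⁻) (proj₁ (proj₂ σ⁻)))
          σKc = maps-real-++ σ A_K A_K (proj₂ σbase)
          x″ = Isomorphism.to σ ∘ x
          g″ = Isomorphism.to σ ∘ g
          x″~x : x″ Mon.≡ᵗ x over ∣ 𝒩 ∣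
          -- `τ` returns `a′` to `a` over `A*` and `B`, so `τ ∘ⁱ σ` fixes `a` and `A*`, and
          -- isolation applies to it.
          x″~x = ∼⇒≡ᵗʳ {P = ∣ 𝒩 ∣} λ B B∈ →
            let τ , τA*B , τa = ≡ᵗ⇒∼ {P = ∥ N ∥} a′~a (real ∘ (A* ++ B))
                  (++-all {P = ∣ 𝒩 ∣} {u = A*} {v = B} A*∈ B∈)
                τA* , τB = maps-real-++ τ A* A* τA*B
                μ , μB , μx = A*-isolates (τ ∘ⁱ σ) (maps-∘ τ σ τa σa) (maps-∘ τ σ τA* (proj₁ σbase)) B B∈ in
            μ ∘ⁱ τ , maps-∘ μ τ μB τB , maps-∘ μ τ μx (maps-act τ)
          x″g″~xg : x″ ++ g″ Mon.≡ᵗ x ++ g over ∣ 𝒩 ∣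
          x″g″~xg = K-primary x″ g″ x″~x (∼⇒≡ᵗ-rangeʳ A_K (∼-sym (σ , proj₁ σKc ,
            maps-++-real σ {x} {x″} {g} {g″} (maps-act σ) (maps-act σ))))

    result : Σ[ ℬ ∈ Modelᵉ ] Monᵉ.IsSPrimary N a ℬ
    result = ℬᵉ , e , ≐ᵉ , λ k → let open Segment k in
      _ , real ∘ base , base∈ , over-base

-- Transfer of independence, and the axioms AV and AVI.

module Independence (Z : ZermeloLogic) {s c r k} {L : Signature s}
    (𝒦 : StructureClass L c r k) (𝕄 : Structure L c r) (Δ : Set c)
    (fur : IsFURClass 𝒦 𝕄 Δ) (ℰ : Equivalences 𝒦 𝕄 Δ) where
  open Cardinals Z
  open CountableSets Z
  open Games Z 𝒦 𝕄 Δ fur ℰ public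
  open Eq ℰ
  open Mon using (range; _inside_)
  open Mon.Model
  open Mon.IsMonster FUR.isMonster using (𝕄∈𝕂)
  open Monᵉ.Model using () renaming (∣_∣ to ∥_∥)
  open 𝕄ₘ using (Aut)

  nonSplitting-mono : {a : Vector (Elem 𝕄) n} {P : Pred (Elem 𝕄) p} {Q : Pred (Elem 𝕄) q}
    {A : Vector (Elem 𝕄) m} → Q ⊆ P → NonSplitting a P A → NonSplitting a Q A
  nonSplitting-mono Q⊆P ns b d b∈ d∈ = ns b d (λ i → Q⊆P (b∈ i)) (λ i → Q⊆P (d∈ i))

  -- An automorphism fixing the coordinates of `a` fixes `a`, so nonsplitting of the coordinates is
  -- inherited; `real-test` extends it from real tuples to all tuples of `N`.
  raise-⇓ : (B N : Modelᵉ) → ∥ B ∥ ⊆ ∥ N ∥ → {X : Pred 𝕄.Carrier p} {Y : Pred (Elem 𝕄) q} →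
    (∀ {u} → Y u → Over X u) → X Mon.⇓[ ∣ realModel B ∣ ] ∣ realModel N ∣ → Y Monᵉ.⇓[ ∥ B ∥ ] ∥ N ∥
  raise-⇓ B N B⊆N {X} Y⇒X X⇓N a a∈ =
    let module C = Coordinates (coordinates {P = X} a (λ i → Y⇒X (a∈ i)))
        _ , A , A∈ , ns = X⇓N C.coord C.coord∈
        ns-C = real-test N A (λ i → B⊆N (A∈ i)) λ b d b∈ d∈ →
          ¬splits⇒nonSplittingʳ {P = ∣ realModel B ∣ ∪ ∣ realModel N ∣} ns b d
            (λ i → inj₂ (b∈ i)) (λ i → inj₂ (d∈ i)) in
    _ , real ∘ A , A∈ , nonSplitting⇒¬splits {P = ∥ B ∥ ∪ ∥ N ∥} λ b d b∈ d∈ b~d →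
      let σ , σA , σC , σb = ns-C b d (λ i → absorb (b∈ i)) (λ i → absorb (d∈ i)) b~d in
      σ , σA , C.fixed σC , σb
    where
    absorb : ∥ B ∥ ∪ ∥ N ∥ ⊆ ∥ N ∥
    absorb (inj₁ u∈) = B⊆N u∈
    absorb (inj₂ u∈) = u∈

  nonSplitting-real-base : (N : Modelᵉ) {a : Vector (Elem 𝕄) n} {P : Pred (Elem 𝕄) p} → ∥ N ∥ ⊆ P →
    (A : Vector (Elem 𝕄) m) (A∈ : ∀ i → A i ∈ ∥ N ∥) → NonSplitting a P A →
    NonSplitting a P (real ∘ Coordinates.coord (coordinates-in N A A∈))
  nonSplitting-real-base N {P = P} N⊆P A A∈ ns = nonSplitting-base {P = P} ns (real ∘ A*.coord)
    (λ i → N⊆P (A*.coord∈ i)) λ _ → A*.fixed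
    where module A* = Coordinates (coordinates-in N A A∈)

  -- Real tuples already belong to the eq-models; only the finite base may contain classes and is
  -- replaced by coordinates inside `B`.
  lower-⇓ : (A B N : Modelᵉ) → ∥ A ∥ Monᵉ.⇓[ ∥ B ∥ ] ∥ N ∥ →
    ∣ realModel A ∣ Mon.⇓[ ∣ realModel B ∣ ] ∣ realModel N ∣
  lower-⇓ A B N A⇓N a a∈ =
    let _ , D , D∈ , ns = A⇓N (real ∘ a) a∈
        module D = Coordinates (coordinates-in B D D∈)
        ns′ = nonSplitting-real-base B {P = ∥ B ∥ ∪ ∥ N ∥} inj₁ D D∈ (¬splits⇒nonSplitting {P = ∥ B ∥ ∪ ∥ N ∥} ns) in
    _ , D.coord , D.coord∈ , nonSplittingʳ⇒¬splits {P = ∣ realModel B ∣ ∪ ∣ realModel N ∣} λ b d b∈ d∈ →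
      ns′ (real ∘ b) (real ∘ d) b∈ d∈

  -- A tuple x of coordinates of a is made independent from a copy e(ℬ) of ℬ over 𝒜, to which the axiom
  -- for 𝒦 applies.  By stationarity e preserves types over 𝒜a as well.
  module AV (𝒜 ℬ : Modelᵉ) (c𝒜 : Monᵉ.Countable 𝒜) (cℬ : Monᵉ.Countable ℬ) (𝒜⊆ℬ : ∥ 𝒜 ∥ ⊆ ∥ ℬ ∥)
            {n} (a : Vector (Elem 𝕄) n) (ℬ⇓a : ∥ ℬ ∥ Monᵉ.⇓[ ∥ 𝒜 ∥ ] Monᵉ.range a) where
    private
      𝒜ʳ = realModel 𝒜
      ℬʳ = realModel ℬ
      module C = Coordinates (coordinates-𝕄 a)
      x = C.coord

      enlarged = 𝕄ₘ.countable-submodel 𝕄∈𝕂 {X = ∣ 𝒜ʳ ∣ ∪ range x}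
        (covered-≲ 𝕄.setoid {T = Structure.setoid (structure 𝒜ʳ) ⊎ₛ ≡.setoid (Fin C.size)}
          (record { to = λ { (inj₁ (y , _)) → y ; (inj₂ i) → x i }
                  ; cong = λ { (inj₁ p) → p ; (inj₂ ≡.refl) → 𝕄.refl } })
          (λ { y (inj₁ y∈) → inj₁ (y , y∈) , 𝕄.refl ; y (inj₂ (i , e)) → inj₂ i , 𝕄.sym e })
        ⟫ ⊎-countable (realModel-countable 𝒜 c𝒜) Fin-countable)

      𝒟 : Model
      𝒟 = record
        { sub = proj₁ enlarged
        ; ∈𝕂 = proj₁ (proj₂ (proj₂ enlarged))
        ; strong = proj₁ (proj₂ (proj₂ (proj₂ enlarged)))
        ; small = 𝕄ₘ.countable⇒small (𝕄 ↾ proj₁ enlarged) (proj₂ (proj₂ (proj₂ (proj₂ enlarged)))) }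

      𝒜⊆𝒟 : ∣ 𝒜ʳ ∣ ⊆ ∣ 𝒟 ∣
      𝒜⊆𝒟 y∈ = proj₁ (proj₂ enlarged) (inj₁ y∈)
      x⊆𝒟 : range x ⊆ ∣ 𝒟 ∣
      x⊆𝒟 y∈ = proj₁ (proj₂ enlarged) (inj₂ y∈)

      independent = FUR.AVI 𝒜ʳ ℬʳ 𝒟 (λ y∈ → 𝒜⊆ℬ y∈ , 𝒜⊆𝒟 y∈)
      𝒞 = proj₁ independent
      e = proj₁ (proj₁ (proj₂ independent))
      𝒞≐ = proj₁ (proj₂ (proj₁ (proj₂ independent)))
      e-type = proj₂ (proj₂ (proj₁ (proj₂ independent)))
      𝒞⇓𝒟 = proj₂ (proj₂ independent)

      -- Over the empty tuple, the type of the whole enumeration is witnessed by a single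
      -- automorphism taking `𝒞` onto `ℬʳ`.
      e-aut = e-type {n = 0} (λ ()) (λ ())

      𝒞-countable : Mon.Countable 𝒞
      𝒞-countable = covered-≲ 𝕄.setoid {T = Structure.setoid (structure ℬʳ)}
        (record { to = e ; cong = λ {y} {z} p → Isomorphism.injective (proj₁ e-aut)
          (𝕄.trans (proj₂ (proj₂ e-aut) y) (𝕄.trans p (𝕄.sym (proj₂ (proj₂ e-aut) z)))) })
        (λ y y∈ → let z , p = proj₁ 𝒞≐ y∈ in z , 𝕄.sym p)
        ⟫ realModel-countable ℬ cℬ

      -- `e` is the identity on `𝒜ʳ`: an automorphism fixing `y` takes `e y` to `y`.
      𝒜⊆𝒞 : ∣ 𝒜ʳ ∣ ⊆ ∣ 𝒞 ∣
      𝒜⊆𝒞 {y} y∈ = let σ , fix , move = e-type {n = 1} (λ _ → y) (λ _ → y∈) in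
        proj₂ 𝒞≐ ((y , 𝒜⊆ℬ y∈) , Isomorphism.injective σ
          (𝕄.trans (fix y (zero , 𝕄.refl)) (𝕄.sym (move (y , 𝒜⊆ℬ y∈)))))

      𝒞⇓x : ∣ 𝒞 ∣ Mon.⇓[ ∣ 𝒜ʳ ∣ ] range x
      𝒞⇓x d d∈ = let _ , A , A∈ , ns = 𝒞⇓𝒟 d d∈ in
        _ , A , A∈ , λ (_ , b , b′ , b∈ , b′∈ , rest) →
          ns (_ , b , b′ , (λ i → widen (b∈ i)) , (λ i → widen (b′∈ i)) , rest)
        where
        widen : ∣ 𝒜ʳ ∣ ∪ range x ⊆ ∣ 𝒜ʳ ∣ ∪ ∣ 𝒟 ∣
        widen (inj₁ y∈) = inj₁ y∈
        widen (inj₂ y∈) = inj₂ (x⊆𝒟 y∈)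

      x↓𝒞 = FUR.AV 𝒜ʳ 𝒞 (realModel-countable 𝒜 c𝒜) 𝒞-countable 𝒜⊆𝒞 x 𝒞⇓x
      A₁ = proj₁ (proj₂ x↓𝒞)
      A₁∈ = proj₁ (proj₂ (proj₂ x↓𝒞))
      x-ns = ¬splits⇒nonSplittingʳ {P = ∣ 𝒜ʳ ∣ ∪ ∣ 𝒞 ∣} (proj₂ (proj₂ (proj₂ x↓𝒞)))

      module _ {l} (z : Vector (Structure.Carrier (structure ℬʳ)) l) where
        z₁ = proj₁ ∘ z
        z₂ = e ∘ z

        z₂∈ : z₂ inside ∣ 𝒞 ∣
        z₂∈ i = proj₂ 𝒞≐ (z i , 𝕄.refl)

        private
          z₁-ns = ℬ⇓a (real ∘ z₁) (λ i → proj₂ (z i))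
          A₂ = proj₁ (proj₂ z₁-ns)
          module A₂ = Coordinates (coordinates-in 𝒜 A₂ (proj₁ (proj₂ (proj₂ z₁-ns))))
          ns₂ : NonSplitting (real ∘ z₁) (∥ 𝒜 ∥ ∪ Monᵉ.range a) A₂
          ns₂ = ¬splits⇒nonSplitting {P = ∥ 𝒜 ∥ ∪ Monᵉ.range a} (proj₂ (proj₂ (proj₂ z₁-ns)))

          z₂-ns = 𝒞⇓𝒟 z₂ z₂∈
          A₃ = proj₁ (proj₂ z₂-ns)
          ns₃ : NonSplittingʳ (real ∘ z₂) (∣ 𝒜ʳ ∣ ∪ ∣ 𝒟 ∣) (real ∘ A₃)
          ns₃ = ¬splits⇒nonSplittingʳ {P = ∣ 𝒜ʳ ∣ ∪ ∣ 𝒟 ∣} (proj₂ (proj₂ (proj₂ z₂-ns)))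

          -- `A₂` and `A₃` are the bases for `z₁` and `z₂`; `A₁` is included because the resulting
          -- automorphism has to fix it.
          A : Vector 𝕄.Carrier _
          A = A₁ ++ (A₂.coord ++ A₃)

          A∈ : A inside ∣ 𝒜ʳ ∣
          A∈ = ++-all {P = ∣ 𝒜ʳ ∣} {u = A₁} {v = A₂.coord ++ A₃} A₁∈
            (++-all {P = ∣ 𝒜ʳ ∣} {u = A₂.coord} {v = A₃} A₂.coord∈ (proj₁ (proj₂ (proj₂ z₂-ns))))

          split-A : ∀ {τ} → Fixes τ (real ∘ A) →
            Fixes τ (real ∘ A₁) × Fixes τ (real ∘ A₂.coord) × Fixes τ (real ∘ A₃)
          split-A {τ} τA = let τA₁ , τA₂₃ = maps-real-++ τ A₁ A₁ τA in
            τA₁ , maps-real-++ τ A₂.coord A₂.coord τA₂₃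

          -- Stationarity through a copy `a°` of `a` inside `𝒜`. Nonsplitting of `z₁` and of `z₂`
          -- gives `α` and `β` taking `a°` to `a` and fixing `z₁` and `z₂` respectively. As `z₁` and
          -- `z₂` have the same type over `𝒜`, some `γ` fixing `a°` takes `z₁` to `z₂`, and βγα⁻¹ is
          -- as required.
          module Conjugate (x° : Vector 𝕄.Carrier C.size) (x°∈ : x° inside ∣ 𝒜ʳ ∣)
                           (μ : Aut) (μA : Fixes μ (real ∘ A)) (μx : Maps μ (real ∘ x°) (real ∘ x)) where
            μ⁻ = symⁱ μ

            μ⁻x : Maps μ⁻ (real ∘ x) (real ∘ x°)
            μ⁻x = maps-inverse μ μx

            a° : Vector (Elem 𝕄) n
            a° = act μ⁻ ∘ a

            a°∈ : ∀ i → a° i ∈ ∥ 𝒜 ∥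
            a°∈ i = over⇒∈ 𝒜 (C.moved μ⁻ {Q = ∣ 𝒜ʳ ∣}
              (λ j → Substructure.resp (sub 𝒜ʳ) (𝕄.sym (real≈⁻¹ (at μ⁻x j))) (x°∈ j)) i)

            z₁-step : Σ[ α ∈ Aut ] Fixes α (real ∘ A) × Fixes α (real ∘ z₁) × Maps α a° a
            z₁-step = nonSplitting-base {P = ∥ 𝒜 ∥ ∪ Monᵉ.range a} ns₂ (real ∘ A) (λ i → inj₁ (A∈ i))
              (λ τ τA → A₂.fixed (proj₁ (proj₂ (split-A τA))))
              a° a (λ i → inj₁ (a°∈ i)) (λ i → inj₂ (i , 𝕄ᵉ.refl)) (μ , μA , maps λ i → act-inverseʳ μ (a i))

            𝒜-step : Σ[ γ ∈ Aut ] Fixes γ (real ∘ A) × Fixes γ a° × Maps γ (real ∘ z₁) (real ∘ z₂)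
            𝒜-step =
              let γ , γAx° , γz = ≡ᵗ⇒∼ʳ {P = ∣ 𝒜ʳ ∣} e-type (A ++ x°)
                    (++-all {P = ∣ 𝒜ʳ ∣} {u = A} {v = x°} A∈ x°∈)
                  γ⁻ = symⁱ γ
                  γ⁻A , γ⁻x° = maps-real-++ γ⁻ A A (maps-inverse γ γAx°) in
              γ⁻ , γ⁻A , C.carried γ⁻ μ⁻ μ⁻ μ⁻x (maps-act μ⁻) μ⁻x (maps-act μ⁻) γ⁻x° ,
              maps-inverse γ {u = real ∘ z₂} (maps λ i → at γz (z i))

            z₂-step : Σ[ β ∈ Aut ] Fixes β (real ∘ A) × Fixes β (real ∘ z₂) × Maps β a° a
            z₂-step =
              let β , _ , βz , βAx = ns₃ (A ++ x°) (A ++ x)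
                    (++-all {P = ∣ 𝒜ʳ ∣ ∪ ∣ 𝒟 ∣} {u = A} {v = x°} (λ i → inj₁ (A∈ i)) (λ i → inj₁ (x°∈ i)))
                    (++-all {P = ∣ 𝒜ʳ ∣ ∪ ∣ 𝒟 ∣} {u = A} {v = x}
                      (λ i → inj₁ (A∈ i)) (λ i → inj₂ (x⊆𝒟 (i , 𝕄.refl))))
                    (μ , proj₂ (proj₂ (split-A μA)) , maps-++-real μ {A} {A} {x°} {x} μA μx)
                  βA , βx = maps-real-++ β A A βAx in
              β , βA , βz , C.carried β μ⁻ (idⁱ 𝕄) μ⁻x (maps-act μ⁻) maps-id maps-id βx

            glue : (Σ[ α ∈ Aut ] Fixes α (real ∘ A) × Fixes α (real ∘ z₁) × Maps α a° a) →
              (Σ[ γ ∈ Aut ] Fixes γ (real ∘ A) × Fixes γ a° × Maps γ (real ∘ z₁) (real ∘ z₂)) →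
              (Σ[ β ∈ Aut ] Fixes β (real ∘ A) × Fixes β (real ∘ z₂) × Maps β a° a) →
              Σ[ σ ∈ Aut ] Fixes σ (real ∘ A₁) × Fixes σ a × Maps σ (real ∘ z₁) (real ∘ z₂)
            glue (α , αA , αz , αa) (γ , γA , γa , γz) (β , βA , βz , βa) =
              β ∘ⁱ γ ∘ⁱ symⁱ α , proj₁ (split-A (compose αA γA βA)) , compose αa γa βa , compose αz γz βz
              where
              compose : ∀ {l} {u v v′ w : Vector (Elem 𝕄) l} →
                Maps α v u → Maps γ v v′ → Maps β v′ w → Maps (β ∘ⁱ γ ∘ⁱ symⁱ α) u w
              compose p q r = maps-∘ β (γ ∘ⁱ symⁱ α) r (maps-∘ γ (symⁱ α) q (maps-inverse α p))

            conclusion : Σ[ σ ∈ Aut ] Fixes σ (real ∘ A₁) × Fixes σ a × Maps σ (real ∘ z₁) (real ∘ z₂)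
            conclusion = glue z₁-step 𝒜-step z₂-step

        same-type-over-a : Σ[ σ ∈ Aut ] Fixes σ (real ∘ A₁) × Fixes σ a × Maps σ (real ∘ z₁) (real ∘ z₂)
        same-type-over-a =
          let x° , x°∈ , μ , μA , μx = saturated 𝒜ʳ x A A∈ in Conjugate.conclusion x° x°∈ μ μA μx

      -- `b` and `d` are carried over `A₁` and `a` into `𝒞`, over which `x` does not split; an
      -- automorphism fixing `x` fixes `a`.
      a-ns : NonSplittingʳ a ∣ ℬʳ ∣ (real ∘ A₁)
      a-ns b d b∈ d∈ (σ , σA , σb) =
        let bᵉ = λ i → b i , b∈ i
            dᵉ = λ i → d i , d∈ i
            β , βA , βa , βb = same-type-over-a bᵉ
            δ , δA , δa , δd = same-type-over-a dᵉ
            ε , εA , εe = ≡ᵗ⇒∼ʳ {P = ∣ 𝒜ʳ ∣} e-type A₁ A₁∈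
            ε⁻ = symⁱ ε
            τ , τA , τx , τb = x-ns (e ∘ bᵉ) (e ∘ dᵉ)
              (λ i → inj₂ (z₂∈ bᵉ i)) (λ i → inj₂ (z₂∈ dᵉ i))
              (ε⁻ ∘ⁱ σ ∘ⁱ ε ,
               maps-∘ ε⁻ (σ ∘ⁱ ε) (maps-inverse ε εA) (maps-∘ σ ε σA εA) ,
               maps-∘ ε⁻ (σ ∘ⁱ ε) (maps-inverse ε {u = real ∘ e ∘ dᵉ} (maps λ i → at εe (dᵉ i)))
                 (maps-∘ σ ε σb (maps λ i → at εe (bᵉ i)))) in
        symⁱ δ ∘ⁱ τ ∘ⁱ β ,
        maps-∘ (symⁱ δ) (τ ∘ⁱ β) (maps-inverse δ δA) (maps-∘ τ β τA βA) ,
        maps-∘ (symⁱ δ) (τ ∘ⁱ β) (maps-inverse δ δa) (maps-∘ τ β (C.fixed τx) βa) ,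
        maps-∘ (symⁱ δ) (τ ∘ⁱ β) (maps-inverse δ δd) (maps-∘ τ β τb βb)

    result : a Monᵉ.↓[ ∥ 𝒜 ∥ ] ∥ ℬ ∥
    result = _ , real ∘ A₁ , A₁∈ , nonSplitting⇒¬splits {P = ∥ 𝒜 ∥ ∪ ∥ ℬ ∥}
      (nonSplitting-mono {P = ∥ ℬ ∥} {Q = ∥ 𝒜 ∥ ∪ ∥ ℬ ∥} absorb
        (real-test ℬ A₁ (λ i → 𝒜⊆ℬ (A₁∈ i)) a-ns))
      where
      absorb : ∥ 𝒜 ∥ ∪ ∥ ℬ ∥ ⊆ ∥ ℬ ∥
      absorb (inj₁ u∈) = 𝒜⊆ℬ u∈
      absorb (inj₂ u∈) = u∈

  act-fixes : ∀ σ {P : Pred 𝕄.Carrier p} → (∀ x → P x → Isomorphism.to σ x 𝕄.≈ x) →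
    ∀ {u} → Over P u → act σ u 𝕄ᵉ.≈ u
  act-fixes σ fix (v , v≈u , v∈) = 𝕄ᵉ.trans (act-cong σ (𝕄ᵉ.sym v≈u)) (𝕄ᵉ.trans
    (act-parts σ (idⁱ 𝕄) v (λ i → fix _ (v∈ i))) (𝕄ᵉ.trans (𝕄ᵉ.reflexive (act-id v)) v≈u))

  -- One automorphism extends `e`, and moving `ℬ` by it enumerates the eq-model of `𝒞`. If `ρ` takes
  -- `e` back over finitely many coordinates, then `ρ ∘ⁱ σ⁻` fixes the real part of `ℬ` pointwise,
  -- hence all of `ℬ`.
  AVIᵉ : (𝒜 ℬ 𝒟 : Modelᵉ) → ∥ 𝒜 ∥ ⊆ ∥ ℬ ∥ ∩ ∥ 𝒟 ∥ →
    Σ[ 𝒞 ∈ Modelᵉ ] Monᵉ.SameTypeOfModels 𝒞 ℬ ∥ 𝒜 ∥ × (∥ 𝒞 ∥ Monᵉ.⇓[ ∥ 𝒜 ∥ ] ∥ 𝒟 ∥)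
  AVIᵉ 𝒜 ℬ 𝒟 𝒜⊆
    with FUR.AVI (realModel 𝒜) (realModel ℬ) (realModel 𝒟) (λ x∈ → proj₁ (𝒜⊆ x∈) , proj₂ (𝒜⊆ x∈))
  ... | 𝒞 , (e , 𝒞≐ , e-type) , 𝒞⇓𝒟 =
    eqModel 𝒞 ,
    ((λ (u , _) → act σ⁻ u) , ((λ y∈ → down (∈eqModel⇒over 𝒞 y∈)) , λ (u , p) → up u p) ,
      ∼⇒≡ᵗ {P = ∥ 𝒜 ∥} λ B B∈ →
        let module B = Coordinates (coordinates-in 𝒜 B B∈)
            ρ , ρB , ρe = ≡ᵗ⇒∼ʳ {P = ∣ realModel 𝒜 ∣} e-type B.coord B.coord∈ in
        ρ , B.fixed ρB , maps λ (u , u∈) → 𝕄ᵉ.trans (𝕄ᵉ.reflexive (≡.sym (act-∘ ρ σ⁻ u)))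
          (act-fixes (ρ ∘ⁱ σ⁻) {P = ∣ realModel ℬ ∣}
            (λ x x∈ → 𝕄.trans (Isomorphism.cong ρ (σ⁻≈e x x∈)) (real≈⁻¹ (at ρe (x , x∈)))) (∈⇒over ℬ u∈))) ,
    raise-⇓ 𝒜 𝒟 (λ u∈ → proj₂ (𝒜⊆ u∈)) {X = ∣ 𝒞 ∣} {Y = ∥ eqModel 𝒞 ∥} (λ y∈ → ∈eqModel⇒over 𝒞 y∈) 𝒞⇓𝒟
    where
    e-aut = e-type {n = 0} (λ ()) (λ ())
    σ = proj₁ e-aut
    σ⁻ = symⁱ σ
    σ⁻≈e : ∀ x x∈ → Isomorphism.to σ⁻ x 𝕄.≈ e (x , x∈)
    σ⁻≈e x x∈ = 𝕄.trans (Isomorphism.cong σ⁻ (𝕄.sym (proj₂ (proj₂ e-aut) (x , x∈)))) (⁻¹-to σ _)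
    up : ∀ (u : Structure.Carrier (Monᵉ.Model.structure ℬ)) {y} → y 𝕄ᵉ.≈ act σ⁻ (proj₁ u) → y ∈ ∥ eqModel 𝒞 ∥
    up (u , u∈) p = over⇒∈eqModel 𝒞 (over-resp {P = ∣ 𝒞 ∣} (𝕄ᵉ.sym p) (act-over {P = ∣ realModel ℬ ∣} {Q = ∣ 𝒞 ∣} σ⁻
      (λ {x} x∈ → proj₂ 𝒞≐ ((x , x∈) , σ⁻≈e x x∈)) (∈⇒over ℬ u∈)))
    down : ∀ {y} → Over ∣ 𝒞 ∣ y → ∃[ u ] y 𝕄ᵉ.≈ act σ⁻ (proj₁ u)
    down {y} y∈ = (act σ y , over⇒∈ ℬ (act-over {P = ∣ 𝒞 ∣} {Q = ∣ realModel ℬ ∣} σ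
      (λ x∈ → let (z , z∈) , p = proj₁ 𝒞≐ x∈ in Substructure.resp (sub (realModel ℬ))
        (𝕄.sym (𝕄.trans (Isomorphism.cong σ p) (proj₂ (proj₂ e-aut) (z , z∈)))) z∈) y∈)) ,
      𝕄ᵉ.sym (act-inverse σ y)

-- Prime models: the axiom AIII.

module PrimeModels (Z : ZermeloLogic) {s c r k} {L : Signature s}
    (𝒦 : StructureClass L c r k) (𝕄 : Structure L c r) (Δ : Set c)
    (fur : IsFURClass 𝒦 𝕄 Δ) (ℰ : Equivalences 𝒦 𝕄 Δ) where
  open StructureClass 𝒦
  open Independence Z 𝒦 𝕄 Δ fur ℰ public
  open Eq ℰ
  open StructureClass 𝒦ᵉ using () renaming (Strong to Strongᵉ)
  open Mon.Model
  open Mon.IsMonster FUR.isMonster using (𝕄∈𝕂)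
  open Monᵉ.Model using () renaming
    (∣_∣ to ∥_∥; structure to structureᵉ; sub to subᵉ; ∈𝕂 to ∈𝕂ᵉ)
  open 𝕄ₘ using (Aut)

  Parts : Pred 𝕄.Carrier p → Elem 𝕄 → Set p
  Parts P v = ∀ i → P (proj₂ (parts v) i)

  module _ (D : Model) (N : Modelᵉ) (g : Embedding (structure D) (structure (realModel N))) (sg : Strong g) where
    open Hull 𝕄∈𝕂 (idⁱ 𝕄ᵉ) (sub D) (∈𝕂 D) (strong D) using (hull-iso; hull∈𝕂ᵉ)
    private
      Nʳ = realModel N
      named = present (∈𝕂ᵉ N) (part N)

      lifted = _^ᵉ (∈𝕂 D) (∈𝕂 Nʳ) g sg
      down = _^ᵉ (∈𝕂 Nʳ) 𝕄∈𝕂 (inclusion (sub Nʳ)) (strong Nʳ)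

      named≈ : ∀ w → Embedding.to down w 𝕄ᵉ.≈ proj₁ (Isomorphism.to named w)
      named≈ = embedding-determined named down (inclusion (subᵉ N))
        λ x → 𝕄ᵉ.sym (present-real (∈𝕂ᵉ N) (part N) x)

    eqEmbedding : Embedding (structureᵉ (eqModel D)) (structureᵉ N)
    eqEmbedding = Isomorphism.embedding named ∘ᵉ lifted ∘ᵉ Isomorphism.embedding (symⁱ hull-iso)

    private
      on-hull : ∀ w → proj₁ (Embedding.to eqEmbedding (Isomorphism.to hull-iso w)) 𝕄ᵉ.≈
                      Embedding.to down (Embedding.to lifted w)
      on-hull w = 𝕄ᵉ.trans (Isomorphism.cong named (Embedding.cong lifted (⁻¹-to hull-iso w)))
        (𝕄ᵉ.sym (named≈ _))

    eqEmbedding-strong : Strongᵉ eqEmbedding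
    eqEmbedding-strong = strong⇒strongᵉ hull∈𝕂ᵉ (𝕄 ↾ sub Nʳ , ∈𝕂 Nʳ , named) eqEmbedding g sg
      λ x → Isomorphism.cong named (Embedding.cong lifted (⁻¹-to hull-iso (real x)))

    eqEmbedding-act : ∀ σ v (v∈ : Parts ∣ D ∣ v) →
      (∀ i → Isomorphism.to σ (proj₂ (parts v) i) 𝕄.≈ proj₁ (Embedding.to g (_ , v∈ i))) →
      ∀ u (u∈ : u ∈ ∥ eqModel D ∥) → v 𝕄ᵉ.≈ u → proj₁ (Embedding.to eqEmbedding (u , u∈)) 𝕄ᵉ.≈ act σ v
    eqEmbedding-act σ (real x) v∈ σ≈g u u∈ v≈u = 𝕄ᵉ.trans
      (Embedding.cong eqEmbedding {u , u∈} {Isomorphism.to hull-iso w} (𝕄ᵉ.sym v≈u))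
      (𝕄ᵉ.trans (on-hull w) (real≈ (𝕄.sym (σ≈g zero))))
      where w = real (x , v∈ zero)
    eqEmbedding-act σ (class e a) v∈ σ≈g u u∈ v≈u = 𝕄ᵉ.trans
      (Embedding.cong eqEmbedding {u , u∈} {Isomorphism.to hull-iso w} (𝕄ᵉ.sym v≈u))
      (𝕄ᵉ.trans (on-hull w) (quotient-cong 𝕄 (just e) (λ i → 𝕄.sym (σ≈g i))))
      where w = class e (λ i → a i , v∈ i)

  parts-act : ∀ σ v {P : Pred 𝕄.Carrier p} → (∀ i → P (Isomorphism.to σ (proj₂ (parts v) i))) →
    Parts P (act σ v)
  parts-act σ (real x) p = p
  parts-act σ (class e a) p = p

  -- The real family is a parameter tied to `𝒜` by `same`, because forming a `pair` commutes with
  -- `realModel` only index by index.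
  module _ {J : Set} (𝒜 : J → Modelᵉ) (𝒜ʳ : J → Model) (same : ∀ j → ∣ 𝒜ʳ j ∣ ≐ ∣ realModel (𝒜 j) ∣) where
    private
      X = Mon.⋃ 𝒜ʳ
      Xᵉ = Monᵉ.⋃ 𝒜

      over-𝒜ʳ : ∀ j {u} → u ∈ ∥ 𝒜 j ∥ → Over ∣ 𝒜ʳ j ∣ u
      over-𝒜ʳ j u∈ = over-mono {P = ∣ realModel (𝒜 j) ∣} {Q = ∣ 𝒜ʳ j ∣} (proj₂ (same j)) (∈⇒over (𝒜 j) u∈)

      𝒜ʳ⊆ : ∀ j {v} → Parts ∣ 𝒜ʳ j ∣ v → v ∈ ∥ 𝒜 j ∥
      𝒜ʳ⊆ j v∈ = over⇒∈ (𝒜 j) (_ , 𝕄ᵉ.refl , λ i → proj₁ (same j) (v∈ i))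

    module Raise (D : Model) (D-prime : Mon.IsSPrime 𝒜ʳ D) where
      private
        X⊆D : X ⊆ ∣ D ∣
        X⊆D = proj₁ D-prime

      module _ (N : Modelᵉ) (f : Func (restrict 𝕄ᵉ.setoid Xᵉ) 𝕄ᵉ.setoid)
               (f-elementary : Monᵉ.WeaklyElementary 𝒜 f) (f∈N : ∀ x → Func.to f x ∈ ∥ N ∥) where
        private
          f-type = proj₁ f-elementary
          f-models = proj₂ f-elementary

          realize : ∀ {n} (a : Vector (Σ (Elem 𝕄) Xᵉ) n) → Σ[ σ ∈ Aut ] Maps σ (proj₁ ∘ a) (Func.to f ∘ a)
          realize a = let σ , _ , move = ≡ᵗ⇒∼ {n = 0} {P = ∅} (f-type a) (λ ()) (λ ()) in σ , move

          up : Σ 𝕄.Carrier X → Σ (Elem 𝕄) Xᵉ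
          up (x , j , x∈) = real x , j , proj₁ (same j) x∈

          -- The value of `f` at a real element is its image under some automorphism; taking this
          -- image itself yields an element of 𝕄.
          to : Σ 𝕄.Carrier X → 𝕄.Carrier
          to x = Isomorphism.to (proj₁ (realize {1} λ _ → up x)) (proj₁ x)

          to≈ : ∀ x → real (to x) 𝕄ᵉ.≈ Func.to f (up x)
          to≈ x = at (proj₂ (realize {1} λ _ → up x)) zero

          fʳ : Func (restrict 𝕄.setoid X) 𝕄.setoid
          fʳ = record { to = to ; cong = λ {x} {y} p → real≈⁻¹
            (𝕄ᵉ.trans (to≈ x) (𝕄ᵉ.trans (Func.cong f (real≈ p)) (𝕄ᵉ.sym (to≈ y)))) }

          fʳ-elementary : Mon.WeaklyElementary 𝒜ʳ fʳ
          fʳ-elementary = (λ a → ∼⇒≡ᵗʳ {P = ∅} λ B B∈ →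
              let σ , fix , move = ≡ᵗ⇒∼ {P = ∅} (f-type (up ∘ a)) (real ∘ B) B∈ in
              σ , fix , maps λ i → 𝕄ᵉ.trans (at move i) (𝕄ᵉ.sym (to≈ (a i)))) ,
            λ j → let B , B≐ = f-models j in
              realModel B , (λ y∈ → preimage-real j (proj₁ B≐ y∈)) ,
              λ { (x , x∈ , p) → proj₂ B≐ (real x , proj₁ (same j) x∈ , 𝕄ᵉ.trans (real≈ p) (to≈ (x , j , x∈))) }
            where
            preimage-real : ∀ j {y} → (∃[ u ] Σ[ u∈ ∈ u ∈ ∥ 𝒜 j ∥ ] real y 𝕄ᵉ.≈ Func.to f (u , j , u∈)) →
              ∃[ x ] Σ[ x∈ ∈ x ∈ ∣ 𝒜ʳ j ∣ ] y 𝕄.≈ to (x , j , x∈)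
            preimage-real j {y} (real x , u∈ , p) = x , proj₂ (same j) u∈ , real≈⁻¹
              (𝕄ᵉ.trans p (𝕄ᵉ.trans (Func.cong f 𝕄ᵉ.refl) (𝕄ᵉ.sym (to≈ (x , j , proj₂ (same j) u∈)))))
            -- Automorphisms send classes to classes, so no real value of `f` comes from a class.
            preimage-real j {y} (class e a , u∈ , p) = ⊥-elim (class≉real
              (𝕄ᵉ.trans (at (proj₂ (realize {1} λ _ → class e a , j , u∈)) zero) (𝕄ᵉ.sym p)))
              where
              class≉real : ∀ {b y} → ¬ (class e b 𝕄ᵉ.≈ real y)
              class≉real ()

          extension = proj₂ D-prime (realModel N) fʳ fʳ-elementary λ x →
            Substructure.resp (subᵉ N) (𝕄ᵉ.sym (to≈ x)) (f∈N (up x))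
          g = proj₁ extension
          sg = proj₁ (proj₂ extension)
          g≈ = proj₂ (proj₂ extension)

        Xᵉ⊆eqModel : Xᵉ ⊆ ∥ eqModel D ∥
        Xᵉ⊆eqModel (j , u∈) = over⇒∈eqModel D
          (over-mono {P = ∣ 𝒜ʳ j ∣} {Q = ∣ D ∣} (λ x∈ → X⊆D (j , x∈)) (over-𝒜ʳ j u∈))

        -- One automorphism realizes `f` on `u` together with the entries of a representative. The
        -- prime embedding agrees with it on these entries, hence on `u`.
        extends : ∀ u (u∈ : u ∈ Xᵉ) →
          proj₁ (Embedding.to (eqEmbedding D N g sg) (u , Xᵉ⊆eqModel u∈)) 𝕄ᵉ.≈ Func.to f (u , u∈)
        extends u (j , u∈) = 𝕄ᵉ.trans
          (eqEmbedding-act D N g sg σ v (λ i → X⊆D (j , v∈ i))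
            (λ i → real≈⁻¹ (𝕄ᵉ.trans (at move (suc i)) (𝕄ᵉ.trans (𝕄ᵉ.sym (to≈ (x i)))
              (real≈ (𝕄.sym (g≈ _ (j , v∈ i)))))))
            u (Xᵉ⊆eqModel (j , u∈)) v≈u)
          (𝕄ᵉ.trans (act-cong σ v≈u) (at move zero))
          where
          v = proj₁ (over-𝒜ʳ j u∈)
          v≈u = proj₁ (proj₂ (over-𝒜ʳ j u∈))
          v∈ = proj₂ (proj₂ (over-𝒜ʳ j u∈))
          x : Vector (Σ 𝕄.Carrier X) _
          x i = proj₂ (parts v) i , j , v∈ i
          realized = realize ((u , j , u∈) ∷ (up ∘ x))
          σ = proj₁ realized
          move = proj₂ realized

        raised : Σ[ h ∈ Embedding (structureᵉ (eqModel D)) (structureᵉ N) ] Strongᵉ h ×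
          (∀ u (u∈ : u ∈ Xᵉ) → proj₁ (Embedding.to h (u , Xᵉ⊆eqModel u∈)) 𝕄ᵉ.≈ Func.to f (u , u∈))
        raised = eqEmbedding D N g sg , eqEmbedding-strong D N g sg , extends

    raise-prime : ∀ D → Mon.IsSPrime 𝒜ʳ D → Monᵉ.IsSPrime 𝒜 (eqModel D)
    raise-prime D prime@(X⊆D , _) =
      (λ (j , u∈) → over⇒∈eqModel D
        (over-mono {P = ∣ 𝒜ʳ j ∣} {Q = ∣ D ∣} (λ x∈ → X⊆D (j , x∈)) (over-𝒜ʳ j u∈))) ,
      Raise.raised D prime

    module Lower (B : Model) (f : Func (restrict 𝕄.setoid X) 𝕄.setoid)
                 (f-elementary : Mon.WeaklyElementary 𝒜ʳ f) (f∈B : ∀ x → Func.to f x ∈ ∣ B ∣) where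
      private
        f-type = proj₁ f-elementary
        f-models = proj₂ f-elementary

      Agrees : Aut → (v : Elem 𝕄) → Parts X v → Set _
      Agrees σ v v∈ = ∀ i → Isomorphism.to σ (proj₂ (parts v) i) 𝕄.≈ Func.to f (_ , v∈ i)

      realize : ∀ {n} (a : Vector (Σ 𝕄.Carrier X) n) → Σ[ σ ∈ Aut ] (∀ i → Isomorphism.to σ (proj₁ (a i)) 𝕄.≈ Func.to f (a i))
      realize a = let σ , _ , move = f-type a {0} (λ ()) (λ ()) in σ , move

      agreeing : ∀ v v∈ → ∃[ σ ] Agrees σ v v∈
      agreeing v v∈ = realize λ i → _ , v∈ i

      -- Two representatives of one element may be moved by different automorphisms; a third one,
      -- realizing `f` on both tuples at once, mediates between them.
      agree-unique : ∀ {σ τ v w} (v∈ : Parts X v) (w∈ : Parts X w) → v 𝕄ᵉ.≈ w →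
        Agrees σ v v∈ → Agrees τ w w∈ → act σ v 𝕄ᵉ.≈ act τ w
      agree-unique {σ} {τ} {v} {w} v∈ w∈ v≈w σv τw =
        𝕄ᵉ.trans (act-parts σ μ v (λ i → 𝕄.trans (σv i) (𝕄.sym (μv i))))
          (𝕄ᵉ.trans (act-cong μ v≈w) (act-parts μ τ w (λ i → 𝕄.trans (μw i) (𝕄.sym (τw i)))))
        where
        vX : Vector (Σ 𝕄.Carrier X) _
        vX i = proj₂ (parts v) i , v∈ i
        wX : Vector (Σ 𝕄.Carrier X) _
        wX i = proj₂ (parts w) i , w∈ i
        realized = realize (vX ++ wX)
        μ = proj₁ realized
        Good : Σ 𝕄.Carrier X → Set _
        Good x = Isomorphism.to μ (proj₁ x) 𝕄.≈ Func.to f x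
        μv : Agrees μ v v∈
        μv i = ≡.subst Good (++-left vX wX i) (proj₂ realized (i ↑ˡ _))
        μw : Agrees μ w w∈
        μw i = ≡.subst Good (++-right vX wX i) (proj₂ realized (_ ↑ʳ i))

      rep : ∀ {u} → u ∈ Xᵉ → ∃[ v ] v 𝕄ᵉ.≈ u × Parts X v
      rep (j , u∈) = let v , v≈u , v∈ = over-𝒜ʳ j u∈ in v , v≈u , λ i → j , v∈ i

      value : ∀ {u} → u ∈ Xᵉ → Elem 𝕄
      value u∈ = let v , _ , v∈ = rep u∈ in act (proj₁ (agreeing v v∈)) v

      value≈ : ∀ {u} (u∈ : u ∈ Xᵉ) {τ w} (w∈ : Parts X w) → w 𝕄ᵉ.≈ u → Agrees τ w w∈ →
        value u∈ 𝕄ᵉ.≈ act τ w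
      value≈ u∈ {τ} w∈ w≈u τw = let v , v≈u , v∈ = rep u∈ in
        agree-unique {proj₁ (agreeing v v∈)} {τ} v∈ w∈ (𝕄ᵉ.trans v≈u (𝕄ᵉ.sym w≈u)) (proj₂ (agreeing v v∈)) τw

      fᵉ : Func (restrict 𝕄ᵉ.setoid Xᵉ) 𝕄ᵉ.setoid
      fᵉ = record
        { to = λ (u , u∈) → value u∈
        ; cong = λ {(u , u∈)} {(u′ , u′∈)} p → let v , v≈u′ , v∈ = rep u′∈ in
            value≈ u∈ {proj₁ (agreeing v v∈)} v∈ (𝕄ᵉ.trans v≈u′ (𝕄ᵉ.sym p)) (proj₂ (agreeing v v∈)) }

      fᵉ-type : ∀ {n} (a : Vector (Σ (Elem 𝕄) Xᵉ) n) → proj₁ ∘ a Monᵉ.≡ᵗ Func.to fᵉ ∘ a over ∅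
      fᵉ-type a = ∼⇒≡ᵗ {P = ∅} λ D D∈ → σ , maps (λ i → ⊥-elim (D∈ i)) , maps λ i →
        𝕄ᵉ.sym (𝕄ᵉ.trans
          (value≈ (proj₂ (a i)) {σ} (λ l → ≡.subst X (≡.sym (proj₂ (C.located i l))) (C.coord∈ _)) (C.reps≈ i)
            (λ l → agree (proj₂ (C.located i l))))
          (act-cong σ (C.reps≈ i)))
        where
        module C = Coordinates (coordinates {P = X} (proj₁ ∘ a) (λ i → rep (proj₂ (a i))))
        realized = realize (λ j → C.coord j , C.coord∈ j)
        σ = proj₁ realized
        agree : ∀ {x j} (e : x ≡ C.coord j) →
          Isomorphism.to σ x 𝕄.≈ Func.to f (x , ≡.subst X (≡.sym e) (C.coord∈ j))
        agree {j = j} ≡.refl = proj₂ realized j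

      -- The image is the eq-model of the image of `𝒜ʳ j` under `f`: an element over the latter is
      -- pulled back by an automorphism realizing `f` on preimages of its entries.
      fᵉ-models : ∀ j → Σ[ N ∈ Modelᵉ ]
        ∥ N ∥ ≐ (λ y → ∃[ u ] Σ[ u∈ ∈ u ∈ ∥ 𝒜 j ∥ ] y 𝕄ᵉ.≈ Func.to fᵉ (u , j , u∈))
      fᵉ-models j = eqModel N ,
        (λ y∈ → preimage-of (∈eqModel⇒over N y∈)) ,
        λ (u , u∈ , p) → Substructure.resp (subᵉ (eqModel N)) (𝕄ᵉ.sym p) (value-in u∈)
        where
        N = proj₁ (f-models j)
        N≐ = proj₂ (f-models j)
        value-in : ∀ {u} (u∈ : u ∈ ∥ 𝒜 j ∥) → value (j , u∈) ∈ ∥ eqModel N ∥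
        value-in u∈ = let v , _ , v∈ = over-𝒜ʳ j u∈
                          σ , σv = agreeing v (λ i → j , v∈ i) in
          over⇒∈eqModel N (act σ v , 𝕄ᵉ.refl ,
            parts-act σ v {P = ∣ N ∣} λ i → proj₂ N≐ (_ , v∈ i , σv i))
        preimage-of : ∀ {y} → Over ∣ N ∣ y → ∃[ u ] Σ[ u∈ ∈ u ∈ ∥ 𝒜 j ∥ ] y 𝕄ᵉ.≈ value (j , u∈)
        preimage-of {y} (v , v≈y , v∈) = act σ⁻ v , 𝒜ʳ⊆ j w∈ , 𝕄ᵉ.sym (𝕄ᵉ.trans
          (value≈ (j , 𝒜ʳ⊆ j w∈) {σ} {act σ⁻ v} (λ i → j , w∈ i) 𝕄ᵉ.refl agrees)
          (𝕄ᵉ.trans (act-inverseʳ σ v) v≈y))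
          where
          source = λ i → proj₁ N≐ (v∈ i)
          realized = realize (λ i → proj₁ (source i) , j , proj₁ (proj₂ (source i)))
          σ = proj₁ realized
          σ⁻ = symⁱ σ
          σ⁻v : ∀ i → (σ ⁻¹) (proj₂ (parts v) i) 𝕄.≈ proj₁ (source i)
          σ⁻v i = 𝕄.trans (Isomorphism.cong σ⁻ (𝕄.trans (proj₂ (proj₂ (source i)))
            (𝕄.sym (proj₂ realized i)))) (⁻¹-to σ _)
          w∈ : Parts ∣ 𝒜ʳ j ∣ (act σ⁻ v)
          w∈ = parts-act σ⁻ v {P = ∣ 𝒜ʳ j ∣} λ i →
            Substructure.resp (sub (𝒜ʳ j)) (𝕄.sym (σ⁻v i)) (proj₁ (proj₂ (source i)))
          agrees-at : ∀ {x} i → x 𝕄.≈ (σ ⁻¹) (proj₂ (parts v) i) → (x∈ : x ∈ ∣ 𝒜ʳ j ∣) →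
            Isomorphism.to σ x 𝕄.≈ Func.to f (x , j , x∈)
          agrees-at i p x∈ = 𝕄.trans (Isomorphism.cong σ (𝕄.trans p (σ⁻v i)))
            (𝕄.trans (proj₂ realized i) (Func.cong f (𝕄.sym (𝕄.trans p (σ⁻v i)))))
          agrees : Agrees σ (act σ⁻ v) (λ i → j , w∈ i)
          agrees = λ i → parts-act σ⁻ v {P = λ x → ∀ x∈ → Isomorphism.to σ x 𝕄.≈ Func.to f (x , j , x∈)}
            (λ i x∈ → agrees-at i 𝕄.refl x∈) i (w∈ i)

      fᵉ∈B : ∀ u → Func.to fᵉ u ∈ ∥ eqModel B ∥
      fᵉ∈B (u , u∈) = let v , _ , v∈ = rep u∈
                          σ , σv = agreeing v v∈ in
        over⇒∈eqModel B (act σ v , 𝕄ᵉ.refl ,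
          parts-act σ v {P = ∣ B ∣} λ i → Substructure.resp (sub B) (𝕄.sym (σv i)) (f∈B _))

    -- The map on real elements is extended to `fᵉ`, primeness is applied inside the eq-model of
    -- `B`, and the embedding obtained is restricted to real parts.
    lower-prime : ∀ D → Monᵉ.IsSPrime 𝒜 D → Mon.IsSPrime 𝒜ʳ (realModel D)
    lower-prime D (Xᵉ⊆D , prime) = X⊆D , λ B f f-elementary f∈B →
      let open Lower B f f-elementary f∈B
          open Hull 𝕄∈𝕂 (idⁱ 𝕄ᵉ) (sub B) (∈𝕂 B) (strong B) using (hull-iso)
          h , sh , h≈ = prime (eqModel B) fᵉ (fᵉ-type , fᵉ-models) fᵉ∈B
          Q = transport (realPart (structure B)) hull-iso
          g , g≈ = restrictᵉ (part D) Q h in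
      g , strongᵉ⇒strong h sh (part D) Q g g≈ , λ x x∈ → real≈⁻¹ (
        𝕄ᵉ.trans (𝕄ᵉ.sym (g≈ (x , X⊆D x∈))) (𝕄ᵉ.trans
          (Embedding.cong h {real x , X⊆D x∈} {real x , Xᵉ⊆D (up x∈)} 𝕄ᵉ.refl) (𝕄ᵉ.trans (h≈ (real x) (up x∈))
            (𝕄ᵉ.trans (value≈ (up x∈) {proj₁ (agreeing (real x) (λ _ → x∈))} {real x} (λ _ → x∈) 𝕄ᵉ.refl
                (proj₂ (agreeing (real x) (λ _ → x∈))))
              (real≈ (proj₂ (agreeing (real x) (λ _ → x∈)) zero))))))
      where
      up : ∀ {x} → x ∈ X → real x ∈ Xᵉ
      up (j , x∈) = j , proj₁ (same j) x∈
      X⊆D : X ⊆ ∣ realModel D ∣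
      X⊆D x∈ = Xᵉ⊆D (up x∈)

  AIIIᵉ : (𝒜 ℬ 𝒞 : Modelᵉ) → ∥ 𝒜 ∥ Monᵉ.⇓[ ∥ ℬ ∥ ] ∥ 𝒞 ∥ → ∥ ℬ ∥ ≐ ∥ 𝒜 ∥ ∩ ∥ 𝒞 ∥ →
    Σ[ 𝒟 ∈ Modelᵉ ] Monᵉ.IsSPrime (Monᵉ.pair 𝒜 𝒞) 𝒟 ×
      (∀ 𝒟′ → Monᵉ.IsSPrime (Monᵉ.pair 𝒜 𝒞) 𝒟′ → ∥ 𝒟′ ∥ ≐ ∥ 𝒟 ∥) ×
      (∀ (𝒞′ : Modelᵉ) → ∥ 𝒞 ∥ ⊆ ∥ 𝒞′ ∥ → ∥ 𝒜 ∥ Monᵉ.⇓[ ∥ ℬ ∥ ] ∥ 𝒞′ ∥ → ∥ 𝒟 ∥ Monᵉ.⇓[ ∥ 𝒞 ∥ ] ∥ 𝒞′ ∥)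
  AIIIᵉ 𝒜 ℬ 𝒞 𝒜⇓𝒞 ℬ≐ =
    let 𝒟 , prime , unique , independent = FUR.AIII (realModel 𝒜) (realModel ℬ) (realModel 𝒞)
          (lower-⇓ 𝒜 ℬ 𝒞 𝒜⇓𝒞) ((λ x∈ → proj₁ ℬ≐ x∈) , λ x∈ → proj₂ ℬ≐ x∈) in
    eqModel 𝒟 , raise-prime (Monᵉ.pair 𝒜 𝒞) (Mon.pair (realModel 𝒜) (realModel 𝒞)) same 𝒟 prime ,
    -- Uniqueness descends to real parts, and a model in 𝕄^eq is recovered from its real part.
    (λ 𝒟′ prime′ →
      let 𝒟′≐ = unique (realModel 𝒟′)
            (lower-prime (Monᵉ.pair 𝒜 𝒞) (Mon.pair (realModel 𝒜) (realModel 𝒞)) same 𝒟′ prime′) in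
      (λ u∈ → over⇒∈eqModel 𝒟 (over-mono {P = ∣ realModel 𝒟′ ∣} {Q = ∣ 𝒟 ∣} (proj₁ 𝒟′≐) (∈⇒over 𝒟′ u∈))) ,
      λ u∈ → over⇒∈ 𝒟′ (over-mono {P = ∣ 𝒟 ∣} {Q = ∣ realModel 𝒟′ ∣} (proj₂ 𝒟′≐) (∈eqModel⇒over 𝒟 u∈))) ,
    λ 𝒞′ 𝒞⊆𝒞′ 𝒜⇓𝒞′ → raise-⇓ 𝒞 𝒞′ 𝒞⊆𝒞′ {X = ∣ 𝒟 ∣} {Y = ∥ eqModel 𝒟 ∥} (∈eqModel⇒over 𝒟)
      (independent (realModel 𝒞′) (λ x∈ → 𝒞⊆𝒞′ x∈) (lower-⇓ 𝒜 ℬ 𝒞′ 𝒜⇓𝒞′))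
    where
    same : ∀ j → ∣ Mon.pair (realModel 𝒜) (realModel 𝒞) j ∣ ≐ ∣ realModel (Monᵉ.pair 𝒜 𝒞 j) ∣
    same true = id , id
    same false = id , id

theorem2p75 : ZermeloLogic →
    ∀ {s c r k : Level} {L : Signature s}
    (𝒦 : StructureClass L c r k) (𝕄 : Structure L c r) (Δ : Set c) →
    IsFURClass 𝒦 𝕄 Δ →
    (ℰ : Equivalences 𝒦 𝕄 Δ) →
    IsFURClass (Eq.𝒦ᵉ ℰ) (Eq.𝕄ᵉ ℰ) Δ
theorem2p75 Z 𝒦 𝕄 Δ fur ℰ = record
  { isAEC = isAECᵉ ; isMonster = isMonsterᵉ ; ap = apᵉ ; jep = jepᵉ ; LS≡ω = lsᵉ
  ; large = largeᵉ ; infinite = infiniteᵉ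
  ; AI = AIᵉ
  ; AII = λ a N cN → AII.result a N cN
  ; AIII = AIIIᵉ
  ; AIV = AIVᵉ
  ; AV = λ 𝒜 ℬ c𝒜 cℬ 𝒜⊆ℬ a ℬ⇓a → AV.result 𝒜 ℬ c𝒜 cℬ 𝒜⊆ℬ a ℬ⇓a
  ; AVI = AVIᵉ }
  where open PrimeModels Z 𝒦 𝕄 Δ fur ℰ
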